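{- For every fixed integer $\delta\geq 2$ there exists a constant $K=K(\delta)$ such that for every graph $G$ of minimum degree $\delta$ and maximum degree $\Delta\geq 2$, $$\chi'_\subset(G)\leq \left(1+\frac{4}{\delta}\right)\Delta + K\,\Delta^{2/3}\log^4\Delta,$$ i.e. $\chi'_\subset(G)\leq (1+\frac{4}{\delta})\Delta + O(\Delta^{2/3}\log^4\Delta)$ with the implied constant depending only on $\delta$.
   Context: All graphs are simple and finite. For an edge colouring $c\colon E\to C$ of a graph $G=(V,E)$, the palette of a vertex $v$ is $S_c(v)=\{c(uv): u\in N(v)\}$. The colouring $c$ is inclusion-free if it is proper (adjacent edges receive distinct colours) and for every edge $uv\in E$ we have $S_c(u)\not\subseteq S_c(v)$ and $S_c(v)\not\subseteq S_c(u)$. Such a colouring exists iff $G$ has no vertex of degree one. The inclusion chromatic index $\chi'_{\subset}(G)$ is the least number of colours in an inclusion-free colouring of $G$. -}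

module Defs where

open import Data.Nat using (ℕ; _+_; _*_; _∸_; _^_; _≤_)
open import Data.Nat.Logarithm using (⌈log₂_⌉)
open import Data.Bool using (Bool; true; false; if_then_else_)
open import Data.Fin using (Fin)
open import Data.List using (List; map; allFin)
open import Data.Nat.ListAction using (sum)
open import Data.Product using (Σ; ∃; _×_)
open import Relation.Binary.PropositionalEquality using (_≡_; _≢_)
open import Relation.Nullary using (¬_)

record Graph : Set where
  field
    n     : ℕ
    adj   : Fin n → Fin n → Bool
    sym   : ∀ u v → adj u v ≡ adj v u
    irref : ∀ v → adj v v ≡ false
open Graph public

Adj : (G : Graph) → Fin (n G) → Fin (n G) → Set
Adj G u v = adj G u v ≡ true

degree : (G : Graph) → Fin (n G) → ℕ
degree G v = sum (map (λ u → if adj G v u then 1 else 0) (allFin (n G)))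

MinDegree : Graph → ℕ → Set
MinDegree G δ = (∀ v → δ ≤ degree G v) × (∃ λ v → degree G v ≡ δ)

MaxDegree : Graph → ℕ → Set
MaxDegree G Δ = (∀ v → degree G v ≤ Δ) × (∃ λ v → degree G v ≡ Δ)

-- An edge colouring with colours from Fin k: the colour of edge uv is c u v
-- (values on non-edges are irrelevant); it must be symmetric on edges.
EdgeColouring : Graph → ℕ → Set
EdgeColouring G k = Fin (n G) → Fin (n G) → Fin k

Proper : (G : Graph) {k : ℕ} → EdgeColouring G k → Set
Proper G c =
  (∀ u v → Adj G u v → c u v ≡ c v u) ×
  (∀ u v w → Adj G u v → Adj G u w → v ≢ w → c u v ≢ c u w)

PaletteSub : (G : Graph) {k : ℕ} → EdgeColouring G k → Fin (n G) → Fin (n G) → Set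
PaletteSub G c u v = ∀ w → Adj G u w → ∃ λ w' → Adj G v w' × (c v w' ≡ c u w)

InclusionFree : (G : Graph) {k : ℕ} → EdgeColouring G k → Set
InclusionFree G c = Proper G c ×
  (∀ u v → Adj G u v → ¬ PaletteSub G c u v × ¬ PaletteSub G c v u)

InclChromIndexAtMost : Graph → ℕ → Set
InclChromIndexAtMost G k = Σ (EdgeColouring G k) (InclusionFree G)

-- Integer encoding of  χ ≤ (1 + 4/δ)Δ + K Δ^{2/3} log⁴ Δ:
--   (δ·χ ∸ (δ+4)·Δ)³ ≤ K · Δ² · ⌈log₂ Δ⌉¹²
Bound : ℕ → ℕ → ℕ → ℕ → Set
Bound K δ Δ χ = (δ * χ ∸ (δ + 4) * Δ) ^ 3 ≤ K * Δ ^ 2 * ⌈log₂ Δ ⌉ ^ 12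

{-# OPTIONS --safe #-}
module Submission where

-- Let D be about Δ^(1/3). Call a vertex low if its degree is less than W = 8 (D + 1), and high otherwise.
--
-- An equitable edge colouring with δ classes (König's theorem, after splitting the vertices into pieces of degree δ)
-- provides a subgraph J, the union of two classes, with about 2 d(v) / δ edges at every high vertex v and at least
-- two edges at every low vertex. The rest has maximum degree about (1 - 2/δ) Δ and is coloured by Vizing's argument
-- with O(D²) spare colours; since D⁴ > Δ, fans of length one are enough.
--
-- The colours of J form about 3 Δ / δ pairs. A low vertex u without low neighbours gives the two colours of a pair
-- to two of its edges in J, and no high vertex sees both colours of a pair, so no neighbour of u contains the palette
-- of u. To choose the pairs, regard the two edges at u as one edge joining their high ends. In a suitable orientation
-- this multigraph has in- and out-degrees about Δ / δ, so by König's theorem it splits into about Δ / δ systems of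
-- paths and cycles, each of which is 3-edge-colourable. In total this takes (1 - 2/δ) Δ + 2 · 3 Δ / δ colours.
--
-- Edges between low vertices receive O(D²) colours of their own in a greedy strong edge colouring, which settles the
-- low vertices with low neighbours. Every high vertex owns four edges, in two groups of two, with O(D²) owned edges at
-- any vertex. An owner has one label per group; the colours of its edges record group and label. Labels of owners
-- whose edges of the same group meet are distinct, and adjacent owners differ in one of the two labels; so in that
-- group a neighbour cannot see both colours. A greedy choice needs O(D²) labels because D⁴ > Δ.

open import Defs renaming (sym to adj-sym)
open import Data.Bool using (Bool; true; false; not; if_then_else_)
import Data.Bool.Properties as Boolₚ
open import Data.Empty using (⊥; ⊥-elim)
open import Data.Fin as Fin using (Fin; zero; suc; toℕ; combine; fromℕ<; remQuot; _↑ˡ_; join; splitAt)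
import Data.Fin.Properties as Finₚ
open import Data.List using (List; []; _∷_; _++_; map; filter; length; lookup; concatMap; allFin; cartesianProduct)
open import Data.List.Properties using (length-map; length-++; length-upTo; length-filter; length-tabulate; filter-reject)
open import Data.List.Membership.Propositional using (_∈_; _∉_; find; lose)
open import Data.List.Membership.Propositional.Properties using (∈-map⁺; ∈-++⁺ˡ; ∈-++⁺ʳ; ∈-++⁻; ∈-filter⁺; ∈-filter⁻; ∈-lookup; ∈-allFin; ∈-cartesianProduct⁺; ∈-upTo⁺; ∈-concatMap⁺)
open import Data.List.Membership.DecPropositional using () renaming (_∈?_ to member?)
open import Data.List.Membership.Setoid.Properties using (index-injective)
open import Data.List.Relation.Unary.Any as Any using (here; there; index)
import Data.List.Relation.Unary.All as All
open import Data.List.Relation.Unary.AllPairs using ([]; _∷_)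
open import Data.List.Relation.Unary.Unique.Propositional using (Unique)
import Data.List.Relation.Unary.Unique.Propositional.Properties as Uniqueₚ
open import Data.Maybe using (Maybe; just; nothing)
import Data.Maybe.Properties as Maybeₚ
open import Data.Nat using (ℕ; zero; suc; _+_; _*_; _^_; _∸_; _≤_; _<_; z≤n; s≤s; NonZero; >-nonZero; >-nonZero⁻¹)
open import Data.Nat.Divisibility using (divides-refl)
open import Data.Nat.DivMod using (_/_; _%_; _mod_; m≡m%n+[m/n]*n; m/n≤m; /-monoˡ-≤; m%n<n; m<n⇒m%n≡m; m<n⇒m/n≡0; m/n*n≤m; m*n/n≡m; +-distrib-/-∣ʳ; [m+kn]%n≡m%n)
open import Data.Nat.ListAction using (sum)
open import Data.Nat.Logarithm using (⌈log₂_⌉; ⌈log₂⌉-mono-≤)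
open import Data.Nat.Properties
open import Data.Nat.Solver using (module +-*-Solver)
open import Data.Product using (Σ; ∃; ∃₂; _×_; _,_; proj₁; proj₂)
open import Data.Product.Properties using (≡-dec)
open import Data.Sum using (_⊎_; inj₁; inj₂; [_,_]′; swap)
open import Function using (_∘_; id)
open import Relation.Binary.Definitions using (DecidableEquality)
open import Relation.Binary.PropositionalEquality using (_≡_; _≢_; refl; sym; trans; cong; cong₂; subst; setoid)
open import Relation.Nullary using (¬_; Dec; yes; no; does; contradiction)
open import Relation.Nullary.Decidable using (¬?; _×-dec_; _⊎-dec_; _→-dec_; dec-true)
open import Relation.Unary using (Decidable)
open +-*-Solver using (solve; _:+_; _:*_; _:^_; _:=_; con)

-- The threshold between low and high balances two costs: the conflicts around a low vertex number
-- about W², and the owned edges at a high vertex about Δ / W, because they lie in two classes of an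
-- equitable colouring with about W / 8 classes. Both are of order Δ^(2/3) exactly when W is of
-- order Δ^(1/3). Owned edges may lie in J and would then break a pair. Ownership therefore concerns
-- a whole pair: its two edges get colours that agree except in a last bit, which tells whether the
-- edge is at the owner. The strong colouring alone cannot separate a low vertex u from its only low
-- neighbour w, since uw is the only edge between low vertices at u and w sees its colour. An edge
-- of J at u other than uw is used instead; for this, different edges of J at adjacent low vertices
-- never share a colour. The multigraph of pairs can have parallel edges, as several low vertices
-- may choose the same two ends; 3 Δ / δ is Shannon's bound, 3/2 times its degree 2 Δ / δ.

private
  variable
    A B : Set

-- Counting by injections and choosing fresh colours

lookup-injective : {xs : List A} → Unique xs → (i j : Fin (length xs)) → lookup xs i ≡ lookup xs j → i ≡ j
lookup-injective (_ ∷ _) zero zero _ = refl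
lookup-injective (x∉ ∷ _) zero (suc j) eq = contradiction eq (All.lookup x∉ (∈-lookup j))
lookup-injective (x∉ ∷ _) (suc i) zero eq = contradiction (sym eq) (All.lookup x∉ (∈-lookup i))
lookup-injective (_ ∷ u) (suc i) (suc j) eq = cong suc (lookup-injective u i j eq)

injection-length : {xs : List A} {ys : List B} → Unique xs → (f : A → B) →
  (∀ {x y} → x ∈ xs → y ∈ xs → f x ≡ f y → x ≡ y) → (∀ {x} → x ∈ xs → f x ∈ ys) →
  length xs ≤ length ys
injection-length {B = B} {xs = xs} u f inj mem = Finₚ.injective⇒≤ {f = λ i → index (mem (∈-lookup i))}
  λ {i} {j} eq → lookup-injective u i j
    (inj (∈-lookup i) (∈-lookup j) (index-injective (setoid B) (mem (∈-lookup i)) (mem (∈-lookup j)) eq))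

-- The form of most degree bounds below: the edges at a vertex get an injective code smaller than
-- the bound.
filter-length : {P : A → Set} (P? : Decidable P) {xs : List A} → Unique xs → (f : A → ℕ) {m : ℕ} →
  (∀ {x} → x ∈ xs → P x → f x < m) →
  (∀ {x y} → x ∈ xs → P x → y ∈ xs → P y → f x ≡ f y → x ≡ y) →
  length (filter P? xs) ≤ m
filter-length P? {xs} u f {m} lt inj = subst (length (filter P? xs) ≤_) (length-upTo m)
  (injection-length (Uniqueₚ.filter⁺ P? u) f
    (λ x∈ y∈ → let a , b = ∈-filter⁻ P? x∈ ; a′ , b′ = ∈-filter⁻ P? y∈ in inj a b a′ b′)
    (λ x∈ → let a , b = ∈-filter⁻ P? x∈ in ∈-upTo⁺ (lt a b)))

concatMap-length : (f : A → List B) (xs : List A) {m : ℕ} → (∀ {x} → x ∈ xs → length (f x) ≤ m) →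
  length (concatMap f xs) ≤ length xs * m
concatMap-length f [] _ = z≤n
concatMap-length f (x ∷ xs) {m} b = ≤-trans (≤-reflexive (length-++ (f x)))
  (+-mono-≤ (b (here refl)) (concatMap-length f xs (b ∘ there)))

∈-concatMap : (f : A → List B) {xs : List A} {x : A} {y : B} → x ∈ xs → y ∈ f x → y ∈ concatMap f xs
∈-concatMap f x∈ y∈ = ∈-concatMap⁺ f (Any.map (λ { refl → y∈ }) x∈)

module _ {k : ℕ} where
  open import Data.List.Membership.DecPropositional (Finₚ._≟_ {k}) using (_∈?_)

  fresh : (used : List (Fin k)) → length used < k → ∃ λ x → x ∉ used
  fresh used lt with Finₚ.any? (λ x → ¬? (x ∈? used))
  ... | yes p = p
  ... | no np = contradiction lt (≤⇒≯ (Finₚ.injective⇒≤ {f = λ x → index (mem x)}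
          λ {x} {y} eq → index-injective (setoid (Fin k)) (mem x) (mem y) eq))
    where
    mem : ∀ x → x ∈ used
    mem x with x ∈? used
    ... | yes p = p
    ... | no q = contradiction (x , q) np

  fresh-many : ∀ s (used : List (Fin k)) → length used + s ≤ k →
    Σ (Fin s → Fin k) λ g → (∀ i j → g i ≡ g j → i ≡ j) × (∀ i → g i ∉ used)
  fresh-many zero used _ = (λ ()) , (λ ()) , λ ()
  fresh-many (suc s) used le
    with x , x∉ ← fresh used (≤-trans (≤-trans (m≤m+n (suc (length used)) s) (≤-reflexive (sym (+-suc (length used) s)))) le)
    with g , inj , g∉ ← fresh-many s (x ∷ used) (≤-trans (≤-reflexive (sym (+-suc (length used) s))) le)
    = h , h-inj , h∉
    where
    h : Fin (suc s) → Fin k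
    h zero = x
    h (suc i) = g i
    h-inj : ∀ i j → h i ≡ h j → i ≡ j
    h-inj zero zero _ = refl
    h-inj zero (suc j) eq = contradiction (here (sym eq)) (g∉ j)
    h-inj (suc i) zero eq = contradiction (here eq) (g∉ i)
    h-inj (suc i) (suc j) eq = cong suc (inj i j eq)
    h∉ : ∀ i → h i ∉ used
    h∉ zero = x∉
    h∉ (suc i) = g∉ i ∘ there

search : ∀ {n} {P Q : Fin n → Set} → (∀ i → P i ⊎ Q i) → ∃ P ⊎ (∀ i → Q i)
search {zero} _ = inj₂ λ ()
search {suc n} {P} {Q} pq with pq zero | search (pq ∘ suc)
... | inj₁ p | _ = inj₁ (zero , p)
... | inj₂ _ | inj₁ (i , p) = inj₁ (suc i , p)
... | inj₂ q | inj₂ qs = inj₂ λ { zero → q ; (suc i) → qs i }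

-- Together `x` and the image of `g` would be `d + 1` elements of `Fin d`. It provides the free
-- colour in König's argument and shows that a full block meets every class.
overfull : ∀ {d} (x : Fin d) (g : Fin d → Fin d) → (∀ i j → g i ≡ g j → i ≡ j) → (∀ i → g i ≢ x) → ⊥
overfull {d} x g inj avoid = <-irrefl refl (Finₚ.injective⇒≤ {f = h} λ {i} {j} → h-inj i j)
  where
  h : Fin (suc d) → Fin d
  h zero = x
  h (suc i) = g i
  h-inj : ∀ i j → h i ≡ h j → i ≡ j
  h-inj zero zero _ = refl
  h-inj zero (suc j) eq = contradiction (sym eq) (avoid j)
  h-inj (suc i) zero eq = contradiction eq (avoid i)
  h-inj (suc i) (suc j) eq = cong suc (inj i j eq)

module Update {E C : Set} (_≟_ : DecidableEquality E) where

  _[_↦_] : (E → C) → E → C → E → C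
  (c [ e ↦ x ]) f with f ≟ e
  ... | yes _ = x
  ... | no _ = c f

  update-at : ∀ c e x → (c [ e ↦ x ]) e ≡ x
  update-at c e x with e ≟ e
  ... | yes _ = refl
  ... | no e≢e = contradiction refl e≢e

  update-off : ∀ c e x {f} → f ≢ e → (c [ e ↦ x ]) f ≡ c f
  update-off c e x {f} f≢e with f ≟ e
  ... | yes f≡e = contradiction f≡e f≢e
  ... | no _ = refl

-- Greedy colouring under a general conflict relation

module Greedy {E : Set} (_≟_ : DecidableEquality E) {k : ℕ}
  (Bad : E → E → Fin k → Fin k → Set)
  (Bad-sym : ∀ {e f x y} → Bad e f x y → Bad f e y x)
  (forbidden : E → (E → Fin k) → List (Fin k)) where

  open Update {E} {Fin k} _≟_

  Good : (E → Fin k) → List E → Set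
  Good c es = ∀ {e f} → e ∈ es → f ∈ es → e ≢ f → ¬ Bad e f (c e) (c f)

  -- The hypotheses quantify over every `c′` because the colouring at the moment when an element is
  -- treated is not known in advance. `old` allows a colouring found by other means to be continued,
  -- and `Bad` sees both colours, so that conflicts need not be equalities.
  extend : ∀ (new old : List E) (c : E → Fin k) → Good c old →
    (∀ {e} → e ∈ new → ∀ c′ → length (forbidden e c′) < k) →
    (∀ {e f} → e ∈ new → f ∈ new ++ old → e ≢ f → ∀ c′ x → Bad e f x (c′ f) → x ∈ forbidden e c′) →
    Σ (E → Fin k) λ c′ → Good c′ (new ++ old)
  extend [] old c good _ _ = c , good
  extend (e ∷ es) old c good few covers
    with c₁ , good₁ ← extend es old c good (few ∘ there) (λ e∈ f∈ → covers (there e∈) (there f∈))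
    with x , x∉ ← fresh (forbidden e c₁) (few (here refl) c₁)
    = c₁ [ e ↦ x ] , good₂
    where
    new-ok : ∀ {f} → f ∈ es ++ old → f ≢ e → ¬ Bad e f x (c₁ f)
    new-ok f∈ f≢e bad = x∉ (covers (here refl) (there f∈) (f≢e ∘ sym) c₁ x bad)
    good₂ : Good (c₁ [ e ↦ x ]) (e ∷ es ++ old)
    good₂ {f} {g} f∈ g∈ f≢g bad with f ≟ e | g ≟ e
    ... | yes refl | yes refl = f≢g refl
    ... | yes refl | no g≢e with g∈
    ... | here g≡e = g≢e g≡e
    ... | there g∈′ = new-ok g∈′ g≢e bad
    good₂ {f} {g} f∈ g∈ f≢g bad | no f≢e | yes refl with f∈
    ... | here f≡e = f≢e f≡e
    ... | there f∈′ = new-ok f∈′ f≢e (Bad-sym bad)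
    good₂ {f} {g} f∈ g∈ f≢g bad | no f≢e | no g≢e with f∈ | g∈
    ... | here f≡e | _ = f≢e f≡e
    ... | _ | here g≡e = g≢e g≡e
    ... | there f∈′ | there g∈′ = good₁ f∈′ g∈′ f≢g bad

-- Kempe chains in loopless multigraphs

transpose : ∀ {k} → Fin k → Fin k → Fin k → Fin k
transpose a b x with x Finₚ.≟ a | x Finₚ.≟ b
... | yes _ | _ = b
... | no _ | yes _ = a
... | no _ | no _ = x

module _ {k : ℕ} (a b : Fin k) where

  transpose-left : transpose a b a ≡ b
  transpose-left with a Finₚ.≟ a | a Finₚ.≟ b
  ... | yes _ | _ = refl
  ... | no a≢a | _ = contradiction refl a≢a

  transpose-right : transpose a b b ≡ a
  transpose-right with b Finₚ.≟ a | b Finₚ.≟ b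
  ... | yes b≡a | _ = b≡a
  ... | no _ | yes _ = refl
  ... | no _ | no b≢b = contradiction refl b≢b

  transpose-other : ∀ {x} → x ≢ a → x ≢ b → transpose a b x ≡ x
  transpose-other {x} x≢a x≢b with x Finₚ.≟ a | x Finₚ.≟ b
  ... | yes x≡a | _ = contradiction x≡a x≢a
  ... | no _ | yes x≡b = contradiction x≡b x≢b
  ... | no _ | no _ = refl

  transpose-involutive : ∀ x → transpose a b (transpose a b x) ≡ x
  transpose-involutive x with x Finₚ.≟ a | x Finₚ.≟ b
  ... | yes x≡a | _ = trans transpose-right (sym x≡a)
  ... | no _ | yes x≡b = trans transpose-left (sym x≡b)
  ... | no x≢a | no x≢b = transpose-other x≢a x≢b

module Multigraph {V E : Set} (_≟V_ : DecidableEquality V) (_≟E_ : DecidableEquality E)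
  {N : ℕ} (code : V → Fin N) (code-injective : ∀ {v w} → code v ≡ code w → v ≡ w)
  (s t : E → V) where

  Inc : E → V → Set
  Inc e v = s e ≡ v ⊎ t e ≡ v

  inc? : ∀ e v → Dec (Inc e v)
  inc? e v = (s e ≟V v) ⊎-dec (t e ≟V v)

  Joins : E → V → V → Set
  Joins e v w = (s e ≡ v × t e ≡ w) ⊎ (s e ≡ w × t e ≡ v)

  joins-sym : ∀ {e v w} → Joins e v w → Joins e w v
  joins-sym (inj₁ p) = inj₂ p
  joins-sym (inj₂ p) = inj₁ p

  joins-inc : ∀ {e v w} → Joins e v w → Inc e v
  joins-inc (inj₁ (p , _)) = inj₁ p
  joins-inc (inj₂ (_ , p)) = inj₂ p

  inc-joins : ∀ {e v} → Inc e v → ∃ λ w → Joins e v w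
  inc-joins {e} (inj₁ p) = t e , inj₁ (p , refl)
  inc-joins {e} (inj₂ p) = s e , inj₂ (refl , p)

  joins-ends : ∀ {e v w x} → Joins e v w → Inc e x → x ≡ v ⊎ x ≡ w
  joins-ends (inj₁ (p , q)) (inj₁ r) = inj₁ (trans (sym r) p)
  joins-ends (inj₁ (p , q)) (inj₂ r) = inj₂ (trans (sym r) q)
  joins-ends (inj₂ (p , q)) (inj₁ r) = inj₂ (trans (sym r) p)
  joins-ends (inj₂ (p , q)) (inj₂ r) = inj₁ (trans (sym r) q)

  Loopless : List E → Set
  Loopless es = ∀ {e} → e ∈ es → s e ≢ t e

  joins-unique : ∀ {e v w w′} → s e ≢ t e → Joins e v w → Joins e v w′ → w ≡ w′
  joins-unique _ (inj₁ (_ , q)) (inj₁ (_ , q′)) = trans (sym q) q′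
  joins-unique l (inj₁ (p , q)) (inj₂ (p′ , q′)) = contradiction (trans p (sym q′)) l
  joins-unique l (inj₂ (p , q)) (inj₁ (p′ , q′)) = contradiction (trans p′ (sym q)) l
  joins-unique _ (inj₂ (p , _)) (inj₂ (p′ , _)) = trans (sym p) p′

  ProperOn : ∀ {k} → List E → (E → Fin k) → Set
  ProperOn es c = ∀ {e f v} → e ∈ es → f ∈ es → Inc e v → Inc f v → c e ≡ c f → e ≡ f

  Missing : ∀ {k} → List E → (E → Fin k) → V → Fin k → Set
  Missing es c v x = ∀ {f} → f ∈ es → Inc f v → c f ≢ x

  present-or-missing : ∀ {k} es (c : E → Fin k) v x →
    (∃ λ f → f ∈ es × Inc f v × c f ≡ x) ⊎ Missing es c v x
  present-or-missing es c v x with Any.any? (λ f → inc? f v ×-dec (c f Finₚ.≟ x)) es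
  ... | yes p = inj₁ (find p)
  ... | no np = inj₂ λ f∈ i eq → np (lose f∈ (i , eq))

  module Kempe {k : ℕ} (es : List E) (loopless : Loopless es) (c : E → Fin k)
    (proper : ProperOn es c) (a b : Fin k) where

    swapIf : Bool → Fin k → Fin k
    swapIf false x = x
    swapIf true x = transpose a b x

    swapIf-involutive : ∀ β x → swapIf β (swapIf β x) ≡ x
    swapIf-involutive false x = refl
    swapIf-involutive true x = transpose-involutive a b x

    swapIf-other : ∀ β {x} → x ≢ a → x ≢ b → swapIf β x ≡ x
    swapIf-other false _ _ = refl
    swapIf-other true = transpose-other a b

    -- The characteristic function of a union of components of the subgraph with colours `a` and
    -- `b`.
    Closed : (V → Bool) → Set
    Closed C = ∀ {f v w} → f ∈ es → Joins f v w → c f ≡ a ⊎ c f ≡ b → C v ≡ C w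

    module Swap (C : V → Bool) (closed : Closed C) where

      swapped : E → Fin k
      swapped f = swapIf (C (s f)) (c f)

      -- Closedness makes both ends of an edge of colour `a` or `b` agree, and the transposition
      -- fixes all other colours; so either end decides.
      swapped-at : ∀ {f v} → f ∈ es → Inc f v → swapped f ≡ swapIf (C v) (c f)
      swapped-at f∈ (inj₁ refl) = refl
      swapped-at {f} f∈ (inj₂ refl) with c f Finₚ.≟ a | c f Finₚ.≟ b
      ... | yes p | _ = cong (λ β → swapIf β (c f)) (closed f∈ (inj₁ (refl , refl)) (inj₁ p))
      ... | no _ | yes p = cong (λ β → swapIf β (c f)) (closed f∈ (inj₁ (refl , refl)) (inj₂ p))
      ... | no p | no q = trans (swapIf-other (C (s f)) p q) (sym (swapIf-other (C (t f)) p q))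

      swapped-proper : ProperOn es swapped
      swapped-proper {e} {f} {v} e∈ f∈ ie if eq = proper e∈ f∈ ie if
        (trans (sym (swapIf-involutive (C v) (c e))) (trans (cong (swapIf (C v))
          (trans (sym (swapped-at e∈ ie)) (trans eq (swapped-at f∈ if)))) (swapIf-involutive (C v) (c f))))

      swapped-missing : ∀ {v x} → Missing es c v x → Missing es swapped v (swapIf (C v) x)
      swapped-missing {v} {x} m {f} f∈ i eq = m f∈ i
        (trans (sym (swapIf-involutive (C v) (c f))) (trans (cong (swapIf (C v))
          (trans (sym (swapped-at f∈ i)) eq)) (swapIf-involutive (C v) x)))

    colour : Bool → Fin k
    colour true = a
    colour false = b

    State : Set
    State = V × Bool

    -- (v , β) : the walk stands at v and leaves along the edge of colour β.
    Step : State → State → Set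
    Step (v , β) (w , γ) = γ ≡ not β × ∃ λ f → f ∈ es × Joins f v w × c f ≡ colour β

    -- The colour of the edge just used is read off from `γ`, and properness leaves one edge of that
    -- colour at the vertex. Walks can thus be traced back.
    step-injective : ∀ {σ σ′ τ} → Step σ τ → Step σ′ τ → σ ≡ σ′
    step-injective {v , β} {v′ , β′} (p , f , f∈ , j , q) (p′ , f′ , f∈′ , j′ , q′)
      with refl ← Boolₚ.not-injective {β} {β′} (trans (sym p) p′)
      with refl ← proper f∈ f∈′ (joins-inc (joins-sym j)) (joins-inc (joins-sym j′)) (trans q (sym q′))
      = cong (_, β) (joins-unique (loopless f∈) (joins-sym j) (joins-sym j′))

    step-functional : ∀ {σ τ τ′} → Step σ τ → Step σ τ′ → τ ≡ τ′
    step-functional {v , β} (refl , f , f∈ , j , q) (refl , f′ , f∈′ , j′ , q′)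
      with refl ← proper f∈ f∈′ (joins-inc j) (joins-inc j′) (trans q (sym q′))
      = cong (_, not β) (joins-unique (loopless f∈) j j′)

    step? : ∀ σ → (∃ λ τ → Step σ τ) ⊎ (∀ τ → ¬ Step σ τ)
    step? (v , β) with present-or-missing es c v (colour β)
    ... | inj₁ (f , f∈ , i , q) = let w , j = inc-joins i in inj₁ ((w , not β) , refl , f , f∈ , j , q)
    ... | inj₂ m = inj₂ λ { _ (_ , f , f∈ , j , q) → m f∈ (joins-inc j) q }

    next : State → Maybe State
    next σ with step? σ
    ... | inj₁ (τ , _) = just τ
    ... | inj₂ _ = nothing

    next-step : ∀ {σ τ} → next σ ≡ just τ → Step σ τ
    next-step {σ} eq with step? σ
    next-step refl | inj₁ (τ , st) = st

    step-next : ∀ {σ τ} → Step σ τ → next σ ≡ just τ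
    step-next {σ} st with step? σ
    ... | inj₁ (τ′ , st′) = cong just (step-functional st′ st)
    ... | inj₂ no-step = contradiction st (no-step _)

    module Walk (p : V) (p-missing : Missing es c p b) where

      walk : ℕ → Maybe State
      walk zero = just (p , true)
      walk (suc i) with walk i
      ... | just σ = next σ
      ... | nothing = nothing

      walk-pred : ∀ i {τ} → walk (suc i) ≡ just τ → ∃ λ σ → walk i ≡ just σ × Step σ τ
      walk-pred i eq with walk i
      ... | just σ = σ , refl , next-step eq

      walk-suc : ∀ i {σ τ} → walk i ≡ just σ → Step σ τ → walk (suc i) ≡ just τ
      walk-suc i eq st rewrite eq = step-next st

      -- Entering `p` in this state would use an edge of colour `b`, which `p` misses. With backward
      -- determinism this excludes repeated states.
      start-no-pred : ∀ {σ} → ¬ Step σ (p , true)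
      start-no-pred {_ , false} (_ , f , f∈ , j , q) = p-missing f∈ (joins-inc (joins-sym j)) q

      walk-injective : ∀ i j {σ} → walk i ≡ just σ → walk j ≡ just σ → i ≡ j
      walk-injective zero zero _ _ = refl
      walk-injective zero (suc j) refl eq = contradiction (proj₂ (proj₂ (walk-pred j eq))) start-no-pred
      walk-injective (suc i) zero eq refl = contradiction (proj₂ (proj₂ (walk-pred i eq))) start-no-pred
      walk-injective (suc i) (suc j) eq eq′
        with σ , w , st ← walk-pred i eq | σ′ , w′ , st′ ← walk-pred j eq′
        with refl ← step-injective st st′
        = cong suc (walk-injective i j w w′)

      walk-prefix : ∀ j i {σ} → walk (j + i) ≡ just σ → ∃ λ τ → walk i ≡ just τ
      walk-prefix zero i eq = _ , eq
      walk-prefix (suc j) i eq = walk-prefix j i (proj₁ (proj₂ (walk-pred (j + i) eq)))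

      encode : State → Fin (N * 2)
      encode (v , true) = combine (code v) zero
      encode (v , false) = combine (code v) (suc zero)

      encode-injective : ∀ σ τ → encode σ ≡ encode τ → σ ≡ τ
      encode-injective (v , true) (w , true) eq = cong (_, true) (code-injective (Finₚ.combine-injectiveˡ (code v) zero (code w) zero eq))
      encode-injective (v , false) (w , false) eq = cong (_, false) (code-injective (Finₚ.combine-injectiveˡ (code v) (suc zero) (code w) (suc zero) eq))
      encode-injective (v , true) (w , false) eq with () ← Finₚ.combine-injectiveʳ (code v) zero (code w) (suc zero) eq
      encode-injective (v , false) (w , true) eq with () ← Finₚ.combine-injectiveʳ (code v) (suc zero) (code w) zero eq

      -- A walk without repeated states ends after at most as many steps as there are states; the
      -- bound makes membership in the component decidable.
      walk-bounded : ∀ i {σ} → walk i ≡ just σ → i < N * 2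
      walk-bounded i eq = Finₚ.injective⇒≤ {f = encode ∘ state}
          λ {j} {j′} e → Finₚ.toℕ-injective (walk-injective (toℕ j) (toℕ j′) (at j)
            (trans (at j′) (cong just (sym (encode-injective (state j) (state j′) e)))))
        where
        ex : (j : Fin (suc i)) → ∃ λ τ → walk (toℕ j) ≡ just τ
        ex j = walk-prefix (i ∸ toℕ j) (toℕ j) (trans (cong walk (m∸n+n≡m (Finₚ.toℕ≤pred[n] j))) eq)
        state : Fin (suc i) → State
        state = proj₁ ∘ ex
        at : ∀ j → walk (toℕ j) ≡ just (state j)
        at = proj₂ ∘ ex

      Visits : ℕ → V → Set
      Visits i v = ∃ λ β → walk i ≡ just (v , β)

      visits? : ∀ i v → Dec (Visits i v)
      visits? i v with walk i
      ... | nothing = no λ ()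
      ... | just (w , β) with w ≟V v
      ... | yes refl = yes (β , refl)
      ... | no w≢v = no λ { (_ , refl) → w≢v refl }

      component : V → Bool
      component v = does (Finₚ.any? (λ (i : Fin (N * 2)) → visits? (toℕ i) v))

      visits⇒component : ∀ i {v} → Visits i v → component v ≡ true
      visits⇒component i {v} (β , eq) = dec-true (Finₚ.any? (λ (i : Fin (N * 2)) → visits? (toℕ i) v))
        (fromℕ< (walk-bounded i eq) , subst (λ j → Visits j v) (sym (Finₚ.toℕ-fromℕ< (walk-bounded i eq))) (β , eq))

      component⇒visits : ∀ {v} → component v ≡ true → ∃ λ i → Visits i v
      component⇒visits {v} eq with Finₚ.any? (λ (i : Fin (N * 2)) → visits? (toℕ i) v)
      ... | yes (i , vis) = toℕ i , vis

      start∈ : component p ≡ true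
      start∈ = visits⇒component 0 (true , refl)

      entered : ∀ i {v β} → walk (suc i) ≡ just (v , β) → ∃ λ f → f ∈ es × Inc f v × c f ≡ colour (not β)
      entered i eq with (w , γ) , _ , refl , f , f∈ , j , q ← walk-pred i eq
        = f , f∈ , joins-inc (joins-sym j) , trans q (cong colour (sym (Boolₚ.not-involutive γ)))

      -- At a visited vertex one of the two colours leads to the next state and the other is that of
      -- the edge by which the walk arrived; at the start `p` the latter is missing.
      component-closed : ∀ {f v w} → f ∈ es → Joins f v w → c f ≡ a ⊎ c f ≡ b →
        component v ≡ true → component w ≡ true
      component-closed {f} {v} {w} f∈ j col v∈ with i , β , eq ← component⇒visits v∈ = go col β i eq
        where
        forward : ∀ i β → c f ≡ colour β → walk i ≡ just (v , β) → component w ≡ true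
        forward i β q eq = visits⇒component (suc i) (not β , walk-suc i eq (refl , f , f∈ , j , q))
        backward : ∀ i β → c f ≡ colour (not β) → walk i ≡ just (v , β) → component w ≡ true
        backward zero true q refl = contradiction q (p-missing f∈ (joins-inc j))
        backward (suc i) β q eq with (u , γ) , weq , refl , g , g∈ , j′ , q′ ← walk-pred i eq
          with refl ← proper f∈ g∈ (joins-inc j) (joins-inc (joins-sym j′))
                 (trans q (trans (cong colour (Boolₚ.not-involutive γ)) (sym q′)))
          with refl ← joins-unique (loopless f∈) j (joins-sym j′)
          = visits⇒component i (γ , weq)
        go : c f ≡ a ⊎ c f ≡ b → ∀ β i → walk i ≡ just (v , β) → component w ≡ true
        go (inj₁ q) true i = forward i true q
        go (inj₁ q) false i = backward i false q
        go (inj₂ q) true i = backward i true q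
        go (inj₂ q) false i = forward i false q

      closed : Closed component
      closed {f} {v} {w} f∈ j col with component v in eqv | component w in eqw
      ... | true | true = refl
      ... | false | false = refl
      ... | true | false = trans (sym (component-closed f∈ j col eqv)) eqw
      ... | false | true = sym (trans (sym (component-closed f∈ (joins-sym j) col eqw)) eqv)

      -- A vertex that misses `a` was not entered along `a`, so it is visited in the state that
      -- waits for `a`.
      reaches-end : ∀ {x} → Missing es c x a → x ≢ p → component x ≡ true → ∃ λ i → walk i ≡ just (x , true)
      reaches-end x-missing x≢p x∈ with component⇒visits x∈
      ... | i , true , eq = i , eq
      ... | suc i , false , eq with f , f∈ , if , q ← entered i eq = contradiction q (x-missing f∈ if)

    open Walk using (walk; walk-pred; component; closed; start∈; reaches-end; entered)

    -- Tracing both walks back in step arrives at a start, and a start cannot be an inner state of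
    -- the other walk.
    meet : ∀ {p q} (mp : Missing es c p b) (mq : Missing es c q b) {σ} i j →
      walk p mp i ≡ just σ → walk q mq j ≡ just σ → p ≡ q
    meet mp mq zero zero refl refl = refl
    meet mp mq zero (suc j) refl eq with f , f∈ , if , q ← entered _ mq j eq = contradiction q (mp f∈ if)
    meet mp mq (suc i) zero eq refl with f , f∈ , if , q ← entered _ mp i eq = contradiction q (mq f∈ if)
    meet mp mq (suc i) (suc j) eq eq′
      with σ , w , st ← walk-pred _ mp i eq | σ′ , w′ , st′ ← walk-pred _ mq j eq′
      with refl ← step-injective st st′
      = meet mp mq i j w w′

    -- A Kempe component has at most two ends, so x cannot lie in the components of both p and q.
    avoiding : ∀ {x p q} → Missing es c x a → Missing es c p b → Missing es c q b →
      x ≢ p → x ≢ q → p ≢ q →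
      Σ (V → Bool) λ C → Closed C × C x ≡ false × (C p ≡ true ⊎ C q ≡ true)
    avoiding {x} {p} {q} mx mp mq x≢p x≢q p≢q with component p mp x in eqp
    ... | false = component p mp , closed p mp , eqp , inj₁ (start∈ p mp)
    ... | true with component q mq x in eqq
    ... | false = component q mq , closed q mq , eqq , inj₂ (start∈ q mq)
    ... | true with i , wi ← reaches-end p mp mx x≢p eqp | j , wj ← reaches-end q mq mx x≢q eqq
      = contradiction (meet mp mq i j wi wj) p≢q

    -- The side alternates together with the colour along the walk, so the walk from `p` could visit
    -- `x` only in the wrong state.
    bipartite-avoiding : (side : V → Bool) → (∀ {f v w} → f ∈ es → Joins f v w → side w ≡ not (side v)) →
      ∀ {x p} → Missing es c x a → Missing es c p b → side p ≡ true → side x ≡ false →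
      Σ (V → Bool) λ C → Closed C × C x ≡ false × C p ≡ true
    bipartite-avoiding side alternate {x} {p} mx mp sp sx with component p mp x in eqx
    ... | false = component p mp , closed p mp , eqx , start∈ p mp
    ... | true with i , eq ← reaches-end p mp mx (λ { refl → contradiction (trans (sym sp) sx) λ () }) eqx
      = contradiction (trans (sym (parity i eq)) sx) λ ()
      where
      parity : ∀ i {v β} → walk p mp i ≡ just (v , β) → side v ≡ β
      parity zero refl = sp
      parity (suc i) eq with (w , γ) , weq , refl , f , f∈ , j , q ← walk-pred p mp i eq
        = trans (alternate f∈ j) (cong not (parity i weq))

    bipartite-swap : (side : V → Bool) → (∀ {f v w} → f ∈ es → Joins f v w → side w ≡ not (side v)) →
      ∀ {x p} → Missing es c x a → Missing es c p b → side p ≡ true → side x ≡ false →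
      Σ (E → Fin k) λ c′ → ProperOn es c′ × Missing es c′ x a × Missing es c′ p a
    bipartite-swap side alternate {x} {p} mx mp sp sx
      with C , cl , Cx , Cp ← bipartite-avoiding side alternate mx mp sp sx
      = Swap.swapped C cl , Swap.swapped-proper C cl ,
        subst (Missing es (Swap.swapped C cl) x) (cong (λ β → swapIf β a) Cx) (Swap.swapped-missing C cl mx) ,
        subst (Missing es (Swap.swapped C cl) p) (trans (cong (λ β → swapIf β b) Cp) (transpose-right a b)) (Swap.swapped-missing C cl mp)

    avoiding-swap : ∀ {x p q} → Missing es c x a → Missing es c p b → Missing es c q b →
      x ≢ p → x ≢ q → p ≢ q →
      Σ (E → Fin k) λ c′ → ProperOn es c′ × Missing es c′ x a × (Missing es c′ p a ⊎ Missing es c′ q a) ×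
        (∀ f → c f ≢ a → c f ≢ b → c′ f ≡ c f) × (∀ {v y} → y ≢ a → y ≢ b → Missing es c v y → Missing es c′ v y)
    avoiding-swap {x} mx mp mq x≢p x≢q p≢q
      with C , cl , Cx , Cpq ← avoiding mx mp mq x≢p x≢q p≢q
      = Swap.swapped C cl , Swap.swapped-proper C cl ,
        subst (Missing es (Swap.swapped C cl) x) (cong (λ β → swapIf β a) Cx) (Swap.swapped-missing C cl mx) ,
        [ inj₁ ∘ gains mp , inj₂ ∘ gains mq ]′ Cpq ,
        (λ f → swapIf-other (C (s f))) ,
        λ {v} ≢a ≢b m → subst (Missing es (Swap.swapped C cl) v) (swapIf-other (C v) ≢a ≢b) (Swap.swapped-missing C cl m)
      where
      gains : ∀ {v} → Missing es c v b → C v ≡ true → Missing es (Swap.swapped C cl) v a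
      gains {v} m Cv = subst (Missing es (Swap.swapped C cl) v) (trans (cong (λ β → swapIf β b) Cv) (transpose-right a b))
        (Swap.swapped-missing C cl m)

  module _ {k : ℕ} where
    open Update {E} {Fin k} _≟E_

    recolour : ∀ {es} {c : E → Fin k} {f a} → ProperOn es c → (∀ {v} → Inc f v → Missing es c v a) →
      ProperOn es (c [ f ↦ a ])
    recolour {f = f} proper m {e} {g} e∈ g∈ ie ig eq with e ≟E f | g ≟E f
    ... | yes refl | yes refl = refl
    ... | yes refl | no _ = contradiction (sym eq) (m ie g∈ ig)
    ... | no _ | yes refl = contradiction eq (m ig e∈ ie)
    ... | no _ | no _ = proper e∈ g∈ ie ig eq

    add-edge : ∀ {es} {c : E → Fin k} {f a} → ProperOn es c → f ∉ es → (∀ {v} → Inc f v → Missing es c v a) →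
      ProperOn (f ∷ es) (c [ f ↦ a ])
    add-edge {es} {c} {f} {a} proper f∉ m (here refl) (here refl) _ _ _ = refl
    add-edge {es} {c} {f} {a} proper f∉ m (here refl) (there g∈) ie ig eq = contradiction
      (trans (sym (update-off c f a λ { refl → f∉ g∈ })) (trans (sym eq) (update-at c f a))) (m ie g∈ ig)
    add-edge {es} {c} {f} {a} proper f∉ m (there e∈) (here refl) ie ig eq = contradiction
      (trans (sym (update-off c f a λ { refl → f∉ e∈ })) (trans eq (update-at c f a))) (m ig e∈ ie)
    add-edge proper f∉ m (there e∈) (there g∈) ie ig eq = recolour proper m e∈ g∈ ie ig eq

    proper-dup : ∀ {es} {c : E → Fin k} {f} → f ∈ es → ProperOn es c → ProperOn (f ∷ es) c
    proper-dup {es} f∈ proper e∈ g∈ = proper (back e∈) (back g∈)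
      where
      back : ∀ {x} → x ∈ _ ∷ es → x ∈ es
      back (here refl) = f∈
      back (there p) = p

  -- König's edge colouring theorem

  module König {d : ℕ} (default : Fin d) (side : V → Bool) (position : V → E → Fin d) where
    open Update {E} {Fin d} _≟E_

    -- Maximum degree at most `d`, expressed by a numbering of the edges at each vertex.
    Distinguishes : List E → Set
    Distinguishes es = ∀ {e f v} → e ∈ es → f ∈ es → Inc e v → Inc f v → position v e ≡ position v f → e ≡ f

    -- If every colour were present at `v`, the edges showing them would occupy all `d` positions
    -- and leave none for `e`.
    free-colour : ∀ {e es v} (c : E → Fin d) → e ∉ es → Inc e v → Distinguishes (e ∷ es) →
      ∃ λ a → Missing es c v a
    free-colour {e} {es} {v} c e∉ ie dist with search (λ x → swap (present-or-missing es c v x))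
    ... | inj₁ p = p
    ... | inj₂ q = ⊥-elim (overfull (position v e) (λ x → position v (proj₁ (q x))) inj off)
      where
      inj : ∀ x y → position v (proj₁ (q x)) ≡ position v (proj₁ (q y)) → x ≡ y
      inj x y eq with q x | q y
      ... | f , f∈ , if , cf | g , g∈ , ig , cg =
        trans (sym cf) (trans (cong c (dist (there f∈) (there g∈) if ig eq)) cg)
      off : ∀ x → position v (proj₁ (q x)) ≢ position v e
      off x eq with q x
      ... | f , f∈ , if , _ with refl ← dist (there f∈) (here refl) if ie eq = e∉ f∈

    Bipartite : List E → Set
    Bipartite es = ∀ {e} → e ∈ es → side (s e) ≡ false × side (t e) ≡ true

    module _ {es : List E} (bip : Bipartite es) where

      bipartite-loopless : Loopless es
      bipartite-loopless e∈ eq with p , q ← bip e∈ = contradiction (trans (sym p) (trans (cong side eq) q)) λ ()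

      alternate : ∀ {f v w} → f ∈ es → Joins f v w → side w ≡ not (side v)
      alternate f∈ (inj₁ (refl , refl)) with p , q ← bip f∈ rewrite p | q = refl
      alternate f∈ (inj₂ (refl , refl)) with p , q ← bip f∈ rewrite p | q = refl

    -- The source misses `a` and the target misses `b`. Swapping along the chain from the target,
    -- which avoids the source, makes `a` free at both.
    insert : ∀ {es e} (c : E → Fin d) → ProperOn es c → e ∉ es → Bipartite (e ∷ es) → Distinguishes (e ∷ es) →
      Σ (E → Fin d) (ProperOn (e ∷ es))
    insert {es} {e} c proper e∉ bip dist
      with a , ma ← free-colour c e∉ (inj₁ refl) dist | b , mb ← free-colour c e∉ (inj₂ refl) dist
      with c′ , proper′ , ms , mt ← Kempe.bipartite-swap es (bipartite-loopless (bip ∘ there)) c proper a b side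
             (alternate (bip ∘ there)) ma mb (proj₂ (bip (here refl))) (proj₁ (bip (here refl)))
      = c′ [ e ↦ a ] , add-edge proper′ e∉ λ { (inj₁ refl) → ms ; (inj₂ refl) → mt }

    könig : (es : List E) → Bipartite es → Distinguishes es → Σ (E → Fin d) (ProperOn es)
    könig [] _ _ = (λ _ → default) , λ ()
    könig (e ∷ es) bip dist with könig es (bip ∘ there) (λ e∈ f∈ → dist (there e∈) (there f∈))
    ... | c , proper with member? _≟E_ e es
    ... | yes e∈ = c , proper-dup e∈ proper
    ... | no e∉ = insert c proper e∉ bip dist

  -- Vizing's argument with fans of length one

  module Vizing {Δ r k : ℕ} (default : Fin k) (cover : V → List E) (cover-small : ∀ v → length (cover v) ≤ Δ)
    (enough : Δ + suc r ≤ k) (slack : k < suc r * r) where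
    open Update {E} {Fin k} _≟E_

    Covered : List E → Set
    Covered es = ∀ {e v} → e ∈ es → Inc e v → e ∈ cover v

    Simple : List E → Set
    Simple es = ∀ {e f v w} → e ∈ es → f ∈ es → Joins e v w → Joins f v w → e ≡ f

    free-colours : ∀ {es m} (c : E → Fin k) → Covered es → m ≤ suc r → ∀ v →
      Σ (Fin m → Fin k) λ g → (∀ i j → g i ≡ g j → i ≡ j) × (∀ i → Missing es c v (g i))
    free-colours {m = m} c cov m≤ v
      with g , inj , g∉ ← fresh-many m (map c (cover v)) (≤-trans
             (+-mono-≤ (≤-trans (≤-reflexive (length-map c (cover v))) (cover-small v)) m≤) enough)
      = g , inj , λ i f∈ if eq → g∉ i (subst (_∈ map c (cover v)) eq (∈-map⁺ c (cov f∈ if)))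

    -- Shifting: f passes its colour b to e and takes over a.
    shift : ∀ {es e f x y z} {c : E → Fin k} {a} → ProperOn es c → e ∉ es → f ∈ es →
      Joins e x y → Joins f x z → Missing es c y (c f) → Missing es c x a → Missing es c z a →
      Σ (E → Fin k) (ProperOn (e ∷ es))
    shift {es} {e} {f} {x} {y} {z} {c} {a} proper e∉ f∈ je jf my mx mz =
      c₁ [ e ↦ c f ] , add-edge proper₁ e∉ missing
      where
      c₁ : E → Fin k
      c₁ = c [ f ↦ a ]
      proper₁ : ProperOn es c₁
      proper₁ = recolour proper λ i → [ (λ { refl → mx }) , (λ { refl → mz }) ]′ (joins-ends jf i)
      unchanged : ∀ {g} → c₁ g ≡ c f → g ≢ f × c g ≡ c f
      unchanged {g} eq with g ≟E f
      ... | yes refl = contradiction (sym eq) (mx f∈ (joins-inc jf))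
      ... | no g≢f = g≢f , eq
      missing : ∀ {v} → Inc e v → Missing es c₁ v (c f)
      missing i {g} g∈ ig eq with unchanged eq | joins-ends je i
      ... | g≢f , q | inj₁ refl = g≢f (proper g∈ f∈ ig (joins-inc jf) q)
      ... | g≢f , q | inj₂ refl = my g∈ ig q

    -- The target of `e` misses `suc r` colours. If the source sees them all, the edges carrying
    -- them have `suc r` far ends, each missing `r` colours. As `suc r * r` exceeds `k`, two far
    -- ends miss a common colour `h`. A chain of `a₀` and `h` has only two ends, so one of these far
    -- ends can be given `a₀` as a missing colour without touching the source; its edge then takes
    -- `a₀` and hands its colour to `e`.
    insert : ∀ {es e} (c : E → Fin k) → ProperOn es c → e ∉ es → Loopless (e ∷ es) → Simple (e ∷ es) →
      Covered es → Σ (E → Fin k) (ProperOn (e ∷ es))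
    insert {es} {e} c proper e∉ loopless simple cov
      with b , b-inj , b-missing ← free-colours {m = suc r} c cov ≤-refl (t e)
         | a , _ , a-missing ← free-colours {m = 1} c cov (s≤s z≤n) (s e)
      with search (λ i → swap (present-or-missing es c (s e) (b i)))
    ... | inj₁ (i , m) = c [ e ↦ b i ] , add-edge proper e∉
            λ { (inj₁ refl) → m ; (inj₂ refl) → b-missing i }
    -- The pigeons are the pairs of a fan edge and a colour missing at its far end. Colours of the
    -- same far end are distinct, so a collision concerns two fan edges.
    ... | inj₂ q = collide (Finₚ.pigeonhole slack (λ ij → hole (Fin.remQuot r ij)))
      where
      x y : V
      x = s e
      y = t e
      f : Fin (suc r) → E
      f i = proj₁ (q i)
      f∈ : ∀ i → f i ∈ es
      f∈ i = proj₁ (proj₂ (q i))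
      cf : ∀ i → c (f i) ≡ b i
      cf i = proj₂ (proj₂ (proj₂ (q i)))
      z : Fin (suc r) → V
      z i = proj₁ (inc-joins (proj₁ (proj₂ (proj₂ (q i)))))
      jf : ∀ i → Joins (f i) x (z i)
      jf i = proj₂ (inc-joins (proj₁ (proj₂ (proj₂ (q i)))))
      holes : ∀ i → Σ (Fin r → Fin k) λ g → (∀ j j′ → g j ≡ g j′ → j ≡ j′) × (∀ j → Missing es c (z i) (g j))
      holes i = free-colours {m = r} c cov (n≤1+n r) (z i)
      hole : Fin (suc r) × Fin r → Fin k
      hole (i , j) = proj₁ (holes i) j
      hole-missing : ∀ ij → Missing es c (z (proj₁ ij)) (hole ij)
      hole-missing (i , j) = proj₂ (proj₂ (holes i)) j
      a₀ : Fin k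
      a₀ = a zero
      my : ∀ i → Missing es c y (c (f i))
      my i = subst (Missing es c y) (sym (cf i)) (b-missing i)
      x≢z : ∀ i → x ≢ z i
      x≢z i eq with jf i
      ... | inj₁ (p , q) = loopless (there (f∈ i)) (trans p (trans eq (sym q)))
      ... | inj₂ (p , q) = loopless (there (f∈ i)) (trans p (trans (sym eq) (sym q)))

      resolve : ∀ i i′ h → i ≢ i′ → Missing es c (z i) h → Missing es c (z i′) h →
        Σ (E → Fin k) (ProperOn (e ∷ es))
      resolve i i′ h i≢i′ mi mi′
        with c′ , proper′ , mx , mz , kept , still ← Kempe.avoiding-swap es (loopless ∘ there) c proper a₀ h
               (a-missing zero) mi mi′ (x≢z i) (x≢z i′)
               (λ eq → i≢i′ (b-inj i i′ (trans (sym (cf i)) (trans (cong c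
                 (simple (there (f∈ i)) (there (f∈ i′)) (jf i) (subst (Joins (f i′) x) (sym eq) (jf i′)))) (cf i′)))))
        = [ finish i mi , finish i′ mi′ ]′ mz
        where
        finish : ∀ i → Missing es c (z i) h → Missing es c′ (z i) a₀ → Σ (E → Fin k) (ProperOn (e ∷ es))
        -- The colour of `f i` is neither `a₀`, missing at the source, nor `h`, missing at `z i`; so
        -- the swap preserves both it and its absence at the target.
        finish i mi mz = shift proper′ e∉ (f∈ i) (inj₁ (refl , refl)) (jf i)
            (subst (Missing es c′ y) (sym (kept (f i) ≢a ≢h)) (still ≢a ≢h (my i))) mx mz
          where
          ≢a : c (f i) ≢ a₀
          ≢a = a-missing zero (f∈ i) (joins-inc (jf i))
          ≢h : c (f i) ≢ h
          ≢h = mi (f∈ i) (joins-inc (joins-sym (jf i)))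

      collide : (∃₂ λ m n → m Fin.< n × hole (Fin.remQuot r m) ≡ hole (Fin.remQuot r n)) →
        Σ (E → Fin k) (ProperOn (e ∷ es))
      collide (m , n , m<n , eq) = resolve (proj₁ u) (proj₁ v) (hole u) distinct (hole-missing u)
          (subst (Missing es c (z (proj₁ v))) (sym eq) (hole-missing v))
        where
        u v : Fin (suc r) × Fin r
        u = Fin.remQuot r m
        v = Fin.remQuot r n
        same : ∀ (u v : Fin (suc r) × Fin r) → hole u ≡ hole v → proj₁ u ≡ proj₁ v → u ≡ v
        same (i , j) (.i , j′) eq refl = cong (i ,_) (proj₁ (proj₂ (holes i)) j j′ eq)
        distinct : proj₁ u ≢ proj₁ v
        distinct ieq = Finₚ.<⇒≢ m<n (trans (sym (Finₚ.combine-remQuot {suc r} r m))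
          (trans (cong (λ w → combine (proj₁ w) (proj₂ w)) (same u v eq ieq)) (Finₚ.combine-remQuot {suc r} r n)))

    vizing : (es : List E) → Loopless es → Simple es → Covered es → Σ (E → Fin k) (ProperOn es)
    vizing [] _ _ _ = (λ _ → default) , λ ()
    vizing (e ∷ es) loopless simple cov
      with vizing es (loopless ∘ there) (λ e∈ f∈ → simple (there e∈) (there f∈)) (cov ∘ there)
    ... | c , proper with member? _≟E_ e es
    ... | yes e∈ = c , proper-dup e∈ proper
    ... | no e∉ = insert c proper e∉ loopless simple (cov ∘ there)

-- Equitable colourings by splitting vertices into blocks

module Rank {E : Set} {n : ℕ} (_≟E_ : DecidableEquality E) (l : E → Fin n) where

  count : List E → Fin n → ℕ
  count es v = length (filter (λ e → l e Finₚ.≟ v) es)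

  -- The number of entries with the label of `e` behind its first occurrence. In a list without
  -- repetitions the elements of one label get the ranks from `0` to `count - 1`.
  rank : List E → E → ℕ
  rank [] e = 0
  rank (x ∷ xs) e with e ≟E x
  ... | yes _ = count xs (l e)
  ... | no _ = rank xs e

  count-∷-≤ : ∀ x xs v → count xs v ≤ count (x ∷ xs) v
  count-∷-≤ x xs v with l x Finₚ.≟ v
  ... | yes _ = n≤1+n _
  ... | no _ = ≤-refl

  count-∷-≡ : ∀ x xs {v} → l x ≡ v → count (x ∷ xs) v ≡ suc (count xs v)
  count-∷-≡ x xs {v} eq with l x Finₚ.≟ v
  ... | yes _ = refl
  ... | no ne = contradiction eq ne

  rank<count : ∀ {es e} → e ∈ es → rank es e < count es (l e)
  rank<count {x ∷ xs} {e} e∈ with e ≟E x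
  ... | yes refl = ≤-reflexive (sym (count-∷-≡ x xs refl))
  rank<count {x ∷ xs} {e} (here e≡x) | no e≢x = contradiction e≡x e≢x
  rank<count {x ∷ xs} {e} (there e∈) | no e≢x = ≤-trans (rank<count e∈) (count-∷-≤ x xs (l e))

  rank≤length : ∀ es e → rank es e ≤ length es
  rank≤length [] e = z≤n
  rank≤length (x ∷ xs) e with e ≟E x
  ... | yes _ = m≤n⇒m≤1+n (length-filter (λ f → l f Finₚ.≟ l e) xs)
  ... | no _ = m≤n⇒m≤1+n (rank≤length xs e)

  tail-∈ : ∀ {x xs} {e : E} → e ∈ x ∷ xs → e ≢ x → e ∈ xs
  tail-∈ (here e≡x) e≢x = contradiction e≡x e≢x
  tail-∈ (there e∈) _ = e∈

  rank-injective : ∀ {es e f} → e ∈ es → f ∈ es → l e ≡ l f → rank es e ≡ rank es f → e ≡ f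
  rank-injective {x ∷ xs} {e} {f} e∈ f∈ leq req with e ≟E x | f ≟E x
  ... | yes refl | yes refl = refl
  ... | yes refl | no f≢x = contradiction (rank<count (tail-∈ f∈ f≢x)) (<-irrefl (trans (sym req) (cong (count xs) leq)))
  ... | no e≢x | yes refl = contradiction (rank<count (tail-∈ e∈ e≢x)) (<-irrefl (trans req (cong (count xs) (sym leq))))
  ... | no e≢x | no f≢x = rank-injective (tail-∈ e∈ e≢x) (tail-∈ f∈ f≢x) leq req

  rank-surjective : ∀ {es v m} → Unique es → m < count es v → ∃ λ e → e ∈ es × l e ≡ v × rank es e ≡ m
  rank-surjective {x ∷ xs} {v} {m} (x∉ ∷ u) lt = go (m ≟ count xs v) (l x Finₚ.≟ v)
    where
    lift : m < count xs v → ∃ λ e → e ∈ x ∷ xs × l e ≡ v × rank (x ∷ xs) e ≡ m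
    lift lt with e , e∈ , le , re ← rank-surjective u lt = e , there e∈ , le , trans shifted re
      where
      shifted : rank (x ∷ xs) e ≡ rank xs e
      shifted with e ≟E x
      ... | yes refl = contradiction refl (All.lookup x∉ e∈)
      ... | no _ = refl
    at-head : l x ≡ v → rank (x ∷ xs) x ≡ count xs v
    at-head eq with x ≟E x
    ... | yes _ = cong (count xs) eq
    ... | no x≢x = contradiction refl x≢x
    go : Dec (m ≡ count xs v) → Dec (l x ≡ v) → ∃ λ e → e ∈ x ∷ xs × l e ≡ v × rank (x ∷ xs) e ≡ m
    go (yes p) (yes q) = x , here refl , q , trans (at-head q) (sym p)
    go (no p) (yes q) = lift (≤∧≢⇒< (≤-pred (subst (m <_) (count-∷-≡ x xs q) lt)) p)
    go _ (no q) = lift (subst (m <_) (cong length (filter-reject (λ e → l e Finₚ.≟ v) q)) lt)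

bit : Bool → Fin 2
bit true = zero
bit false = suc zero

bit-injective : ∀ β γ → bit β ≡ bit γ → β ≡ γ
bit-injective true true _ = refl
bit-injective false false _ = refl

module Equitable {E : Set} {n : ℕ} (_≟E_ : DecidableEquality E) (d-1 : ℕ)
  (es : List E) (unique : Unique es) (l r : E → Fin n) where

  d : ℕ
  d = suc d-1

  module L = Rank _≟E_ l
  module R = Rank _≟E_ r

  block-l block-r : E → ℕ
  block-l e = L.rank es e / d
  block-r e = R.rank es e / d

  -- A vertex piece: side, vertex and block number. At most `d` edges meet a piece, numbered by the
  -- rank modulo `d`.
  Node : Set
  Node = Bool × Fin n × Fin (suc (length es))

  _≟N_ : DecidableEquality Node
  _≟N_ = ≡-dec Boolₚ._≟_ (≡-dec Finₚ._≟_ Finₚ._≟_)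

  code : Node → Fin (2 * (n * suc (length es)))
  code (β , v , j) = combine (bit β) (combine v j)

  code-injective : ∀ {x y} → code x ≡ code y → x ≡ y
  code-injective {β , v , j} {γ , w , i} eq
    with p , q ← Finₚ.combine-injective (bit β) (combine v j) (bit γ) (combine w i) eq
    with refl ← bit-injective β γ p
    with refl , refl ← Finₚ.combine-injective v j w i q = refl

  block-l< : ∀ e → block-l e < suc (length es)
  block-l< e = s≤s (≤-trans (m/n≤m (L.rank es e) d) (L.rank≤length es e))

  block-r< : ∀ e → block-r e < suc (length es)
  block-r< e = s≤s (≤-trans (m/n≤m (R.rank es e) d) (R.rank≤length es e))

  left right : E → Node
  left e = false , l e , fromℕ< (block-l< e)
  right e = true , r e , fromℕ< (block-r< e)

  position : Node → E → Fin d
  position (false , _) e = L.rank es e mod d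
  position (true , _) e = R.rank es e mod d

  div-mod-injective : ∀ {x y} → x / d ≡ y / d → x mod d ≡ y mod d → x ≡ y
  div-mod-injective {x} {y} p q = trans (m≡m%n+[m/n]*n x d) (trans (cong₂ (λ u v → u + v * d)
    (trans (sym (Finₚ.toℕ-fromℕ< (m%n<n x d))) (trans (cong toℕ q) (Finₚ.toℕ-fromℕ< (m%n<n y d)))) p) (sym (m≡m%n+[m/n]*n y d)))

  same-l : ∀ {e f} → left e ≡ left f → l e ≡ l f × block-l e ≡ block-l f
  same-l {e} {f} eq = cong (proj₁ ∘ proj₂) eq , Finₚ.fromℕ<-injective _ _ (block-l< e) (block-l< f) (cong (proj₂ ∘ proj₂) eq)

  same-r : ∀ {e f} → right e ≡ right f → r e ≡ r f × block-r e ≡ block-r f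
  same-r {e} {f} eq = cong (proj₁ ∘ proj₂) eq , Finₚ.fromℕ<-injective _ _ (block-r< e) (block-r< f) (cong (proj₂ ∘ proj₂) eq)

  distinguishes : Multigraph.König.Distinguishes _≟N_ _≟E_ code code-injective left right {d} zero proj₁ position es
  distinguishes e∈ f∈ (inj₁ refl) (inj₁ q) pos with leq , beq ← same-l q =
    L.rank-injective e∈ f∈ (sym leq) (div-mod-injective (sym beq) pos)
  distinguishes e∈ f∈ (inj₂ refl) (inj₂ q) pos with req , beq ← same-r q =
    R.rank-injective e∈ f∈ (sym req) (div-mod-injective (sym beq) pos)

  abstract
    colouring : Σ (E → Fin d) λ c → ∀ {e f v} → e ∈ es → f ∈ es → left e ≡ v ⊎ right e ≡ v → left f ≡ v ⊎ right f ≡ v →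
      c e ≡ c f → e ≡ f
    colouring = Multigraph.König.könig _≟N_ _≟E_ code code-injective left right {d} zero proj₁ position es (λ _ → refl , refl) distinguishes

  class : E → Fin d
  class = proj₁ colouring

  class-l : ∀ {e f} → e ∈ es → f ∈ es → l e ≡ l f → class e ≡ class f → block-l e ≡ block-l f → e ≡ f
  class-l {e} {f} e∈ f∈ leq ceq beq = proj₂ colouring e∈ f∈ (inj₁ refl)
    (inj₁ (cong (false ,_) (cong₂ _,_ (sym leq) (Finₚ.fromℕ<-cong _ _ (sym beq) (block-l< f) (block-l< e))))) ceq

  class-r : ∀ {e f} → e ∈ es → f ∈ es → r e ≡ r f → class e ≡ class f → block-r e ≡ block-r f → e ≡ f
  class-r {e} {f} e∈ f∈ req ceq beq = proj₂ colouring e∈ f∈ (inj₂ refl)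
    (inj₂ (cong (true ,_) (cong₂ _,_ (sym req) (Finₚ.fromℕ<-cong _ _ (sym beq) (block-r< f) (block-r< e))))) ceq

  block-l≤ : ∀ {e} → e ∈ es → block-l e ≤ L.count es (l e) / d
  block-l≤ e∈ = /-monoˡ-≤ d (<⇒≤ (L.rank<count e∈))

  block-r≤ : ∀ {e} → e ∈ es → block-r e ≤ R.count es (r e) / d
  block-r≤ e∈ = /-monoˡ-≤ d (<⇒≤ (R.rank<count e∈))

  in-block : ∀ j (i : Fin d) → (toℕ i + j * d) / d ≡ j
  in-block j i = trans (+-distrib-/-∣ʳ (toℕ i) (divides-refl j)) (cong₂ _+_ (m<n⇒m/n≡0 (Finₚ.toℕ<n i)) (m*n/n≡m j d))

  module FullBlock (m : E → Fin n) (block-injective : ∀ {e f} → e ∈ es → f ∈ es → m e ≡ m f → class e ≡ class f →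
    Rank.rank _≟E_ m es e / d ≡ Rank.rank _≟E_ m es f / d → e ≡ f) where

    open Rank _≟E_ m using (count; rank; rank-surjective)

    module _ {v : Fin n} (j : ℕ) (full : suc j * d ≤ count es v) where

      member : (i : Fin d) → ∃ λ e → e ∈ es × m e ≡ v × rank es e ≡ toℕ i + j * d
      member i = rank-surjective unique (≤-trans (+-monoˡ-≤ (j * d) (Finₚ.toℕ<n i)) full)

      member-block : ∀ i → rank es (proj₁ (member i)) / d ≡ j
      member-block i = trans (cong (_/ d) (proj₂ (proj₂ (proj₂ (member i))))) (in-block j i)

      member-injective : ∀ i i′ → class (proj₁ (member i)) ≡ class (proj₁ (member i′)) → i ≡ i′
      member-injective i i′ eq
        with e , e∈ , me , re ← member i | p ← member-block i | f , f∈ , mf , rf ← member i′ | p′ ← member-block i′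
        with refl ← block-injective e∈ f∈ (trans me (sym mf)) eq (trans p (sym p′))
        = Finₚ.toℕ-injective (+-cancelʳ-≡ (j * d) (toℕ i) (toℕ i′) (trans (sym re) rf))

      -- The `d` members of a full block have pairwise different classes, so none of the `d` classes
      -- is left out.
      full-block : ∀ x → ∃ λ e → e ∈ es × m e ≡ v × class e ≡ x × rank es e / d ≡ j
      full-block x with Finₚ.any? (λ i → class (proj₁ (member i)) Finₚ.≟ x)
      ... | yes (i , eq) = proj₁ (member i) , proj₁ (proj₂ (member i)) , proj₁ (proj₂ (proj₂ (member i))) , eq , member-block i
      ... | no none = ⊥-elim (overfull x (λ i → class (proj₁ (member i))) member-injective λ i eq → none (i , eq))

  open FullBlock l class-l using () renaming (full-block to full-block-l) public
  open FullBlock r class-r using () renaming (full-block to full-block-r) public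

  -- Numbers the elements at v on either side; X separates the two sides.
  slot : ℕ → Fin n → E → ℕ
  slot X v e with r e Finₚ.≟ v
  ... | yes _ = block-r e
  ... | no _ = X + block-l e

  slot-bound : ∀ {X v m e} → R.count es v / d < X → X + L.count es v / d < m → e ∈ es →
    l e ≡ v ⊎ r e ≡ v → slot X v e < m
  slot-bound {X} {v} {m} {e} x< <m e∈ end with r e Finₚ.≟ v
  ... | yes refl = ≤-<-trans (block-r≤ e∈) (<-trans (<-≤-trans x< (m≤m+n X _)) <m)
  slot-bound {X} x< <m e∈ (inj₁ refl) | no _ = ≤-<-trans (+-monoʳ-≤ X (block-l≤ e∈)) <m
  slot-bound x< <m e∈ (inj₂ q) | no r≢v = contradiction q r≢v

  slot-injective : ∀ {X v e f} → R.count es v / d < X → e ∈ es → f ∈ es → l e ≡ v ⊎ r e ≡ v → l f ≡ v ⊎ r f ≡ v →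
    slot X v e ≡ slot X v f →
    (r e ≡ v × r f ≡ v × block-r e ≡ block-r f) ⊎ (l e ≡ v × l f ≡ v × block-l e ≡ block-l f)
  slot-injective {X} {v} {e} {f} x< e∈ f∈ pe pf eq with r e Finₚ.≟ v | r f Finₚ.≟ v
  ... | yes p | yes q = inj₁ (p , q , eq)
  ... | yes refl | no _ = contradiction (≤-<-trans (block-r≤ e∈) x<) (≤⇒≯ (subst (X ≤_) (sym eq) (m≤m+n X _)))
  ... | no _ | yes refl = contradiction (≤-<-trans (block-r≤ f∈) x<) (≤⇒≯ (subst (X ≤_) eq (m≤m+n X _)))
  ... | no p | no q with pe | pf
  ... | inj₂ p′ | _ = contradiction p′ p
  ... | _ | inj₂ q′ = contradiction q′ q
  ... | inj₁ p′ | inj₁ q′ = inj₂ (p′ , q′ , +-cancelˡ-≡ X _ _ eq)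

-- Parameters and their sizes, measured in multiples of D²

module Linear (E : ℕ) .{{_ : NonZero E}} where

  infix 4 _≲_
  infixl 6 _⊕_

  -- A record, so that the constants are inferred by unification.
  record _≲_ (x a : ℕ) : Set where
    constructor lin
    field bound : x ≤ a * E

  open _≲_ public

  const : ∀ k → k ≲ k
  const k = lin (m≤m*n k E)

  _⊕_ : ∀ {x y a b} → x ≲ a → y ≲ b → x + y ≲ a + b
  _⊕_ {a = a} {b} (lin p) (lin q) = lin (≤-trans (+-mono-≤ p q) (≤-reflexive (sym (*-distribʳ-+ E a b))))

  scale : ∀ k {x a} → x ≲ a → k * x ≲ k * a
  scale k {a = a} (lin p) = lin (≤-trans (*-monoʳ-≤ k p) (≤-reflexive (sym (*-assoc k a E))))

  scaleʳ : ∀ k {x a} → x ≲ a → x * k ≲ k * a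
  scaleʳ k {x} p = lin (≤-trans (≤-reflexive (*-comm x k)) (bound (scale k p)))

module Constants (δ-2 : ℕ) where

  -- Apart from `δ` and `a` these are coefficients of `E` in the bounds of `Numbers`, written as the
  -- sums and products from which those bounds arise. The value of `a` makes `r * r` exceed the
  -- degree left to Vizing's argument.
  δ a cT cC cq₂ cS ck₃ cRest c : ℕ
  δ = suc (suc δ-2)
  a = δ-2 * 2 + 18
  cT = (1 + 2) + (1 + 2)
  cC = 256 + 2 * cT
  cq₂ = 2 * (3 * cC) + 2 * (3 * cC) + (1 + 1)
  cS = 1 + (256 + 256)
  ck₃ = 1 + 3 * (256 + 256)
  cRest = 8 * (1 + 1) + (1 + a) + 2 * cS + 8 * cq₂ + ck₃
  c = (δ + 4) * (δ * 2) + δ * cRest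

module Numbers (δ-2 Δ D-1 : ℕ) where

  open Constants δ-2 public

  -- The colours: `kA` for the plain edges, two for each of `P` pairs, eight (group, rank, end bit)
  -- for each of `q₂` labels, and `k₃` for the edges between low vertices. The factor `8` in `W`
  -- gives every high vertex four full blocks of size `w` on one of two sides. The `2` in `q` stands
  -- for one incomplete block on either side. `M` bounds the block numbers in the ownership
  -- colouring, where up to `Δ + Δ` items lie on a side; `T` counts both sides, `C` the conflicts
  -- through one vertex, `N` those through the three touched vertices. In `q₂`, each group
  -- contributes `2 * N` rivals, and `Y` leaves room for the codes of `Δ` neighbours.
  D E w W q S P M T C N Y q₂ r ΔA kA k₃ χ : ℕ
  D = suc D-1
  E = D * D
  w = suc D
  W = 8 * w
  q = suc (suc (Δ / δ))
  S = suc (W * W + W * W)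
  P = q * 3 + S
  M = (Δ + Δ) / w
  T = suc M + suc M
  C = W * W + 2 * T
  N = 3 * C
  Y = suc E
  q₂ = 2 * N + 2 * N + Y
  r = a * E
  ΔA = δ-2 * q + W
  kA = ΔA + suc r
  k₃ = suc (3 * (W * (W + W)))
  χ = kA + (P * 2 + (q₂ * 8 + k₃))

  open Linear E

  δ-2*q≤ : δ-2 * q ≤ δ-2 * 2 + Δ
  δ-2*q≤ = ≤-trans (≤-reflexive (*-distribˡ-+ δ-2 2 (Δ / δ))) (+-monoʳ-≤ (δ-2 * 2)
    (≤-trans (*-monoˡ-≤ (Δ / δ) (m≤n+m δ-2 2)) (≤-trans (≤-reflexive (*-comm δ (Δ / δ))) (m/n*n≤m Δ δ))))

  D≲E : D ≲ 1
  D≲E = lin (≤-trans (m≤m*n D D) (≤-reflexive (sym (*-identityˡ E))))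

  W≲ : W ≲ 8 * (1 + 1)
  W≲ = scale 8 (const 1 ⊕ D≲E)

  W²≲ : W * W ≲ 256
  W²≲ = lin (≤-trans (*-mono-≤ step step) (≤-reflexive (solve 1 (λ D → (con 16 :* D) :* (con 16 :* D) := con 256 :* (D :* D)) refl D)))
    where
    step : W ≤ 16 * D
    step = ≤-trans (*-monoʳ-≤ 8 (+-mono-≤ (s≤s (z≤n {D-1})) (m≤m+n D 0))) (≤-reflexive (sym (*-assoc 8 2 D)))

  module _ (cube : Δ ≤ D * E) where

    Δ≤E² : Δ ≤ E * E
    Δ≤E² = ≤-trans cube (*-monoˡ-≤ E (m≤m*n D D))

    -- After cancelling `r`, the square of `r = a * E` has to beat `ΔA + 1`. Every term of `ΔA` is
    -- at most a multiple of `E * E`, the main one because `Δ ≤ D * E`.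
    slack : kA < suc r * r
    slack = begin-strict
      δ-2 * q + W + suc r                        ≤⟨ +-monoˡ-≤ (suc r) (+-mono-≤ δ-2*q≤ (bound W≲)) ⟩
      δ-2 * 2 + Δ + 16 * E + suc r               ≤⟨ +-monoˡ-≤ (suc r) (+-mono-≤ (+-mono-≤ (m≤m*n (δ-2 * 2) (E * E) {{E*E≠0}}) Δ≤E²)
                                                       (*-monoʳ-≤ 16 (m≤m*n E E))) ⟩
      δ-2 * 2 * (E * E) + E * E + 16 * (E * E) + suc r ≡⟨ collect (δ-2 * 2) (E * E) r ⟩
      r + (suc ((δ-2 * 2 + 17) * (E * E)))       <⟨ +-monoʳ-< r (s≤s (+-monoˡ-≤ ((δ-2 * 2 + 17) * (E * E)) (>-nonZero⁻¹ (E * E) {{E*E≠0}}))) ⟩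
      r + (suc (suc (δ-2 * 2 + 17) * (E * E)))   ≤⟨ +-monoʳ-≤ r (+-monoˡ-≤ (suc (δ-2 * 2 + 17) * (E * E)) (>-nonZero⁻¹ (E * E) {{E*E≠0}})) ⟩
      r + suc (suc (δ-2 * 2 + 17)) * (E * E)     ≤⟨ +-monoʳ-≤ r (*-monoˡ-≤ (E * E) big) ⟩
      r + a * a * (E * E)                        ≡⟨ cong (r +_) (regroup a E) ⟩
      suc r * r                                  ∎
      where
      open ≤-Reasoning
      E*E≠0 : NonZero (E * E)
      E*E≠0 = m*n≢0 E E
      collect : ∀ x y r → x * y + y + 16 * y + suc r ≡ r + suc ((x + 17) * y)
      collect = solve 3 (λ x y r → x :* y :+ y :+ con 16 :* y :+ (con 1 :+ r) := r :+ (con 1 :+ (x :+ con 17) :* y)) refl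
      regroup : ∀ a E → a * a * (E * E) ≡ a * E * (a * E)
      regroup = solve 2 (λ a E → a :* a :* (E :* E) := a :* E :* (a :* E)) refl
      big : suc (suc (δ-2 * 2 + 17)) ≤ a * a
      big = ≤-trans (≤-reflexive (cong suc (sym (+-suc (δ-2 * 2) 17))))
        (≤-trans (+-monoˡ-≤ a (≤-trans (s≤s z≤n) (m≤n+m 18 (δ-2 * 2))))
          (≤-trans (≤-reflexive (cong (a +_) (sym (+-identityʳ a)))) (*-monoˡ-≤ a (≤-trans (s≤s (s≤s z≤n)) (m≤n+m 18 (δ-2 * 2))))))

    M≲ : M ≲ 2
    M≲ = lin (≤-trans (/-monoˡ-≤ w (≤-trans (+-mono-≤ cube cube) (≤-trans (≤-reflexive (double D E)) (*-monoʳ-≤ (2 * E) (n≤1+n D)))))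
      (≤-reflexive (m*n/n≡m (2 * E) w)))
      where
      double : ∀ D E → D * E + D * E ≡ 2 * E * D
      double = solve 2 (λ D E → D :* E :+ D :* E := con 2 :* E :* D) refl

    E≲ : E ≲ 1
    E≲ = lin (≤-reflexive (sym (*-identityˡ E)))

    T≲ : T ≲ cT
    T≲ = (const 1 ⊕ M≲) ⊕ (const 1 ⊕ M≲)

    C≲ : C ≲ cC
    C≲ = W²≲ ⊕ scale 2 T≲

    q₂≲ : q₂ ≲ cq₂
    q₂≲ = scale 2 (scale 3 C≲) ⊕ scale 2 (scale 3 C≲) ⊕ (const 1 ⊕ E≲)

    S≲ : S ≲ cS
    S≲ = const 1 ⊕ (W²≲ ⊕ W²≲)

    k₃≲ : k₃ ≲ ck₃
    k₃≲ = const 1 ⊕ scale 3 (subst (_≲ 256 + 256) (sym (*-distribˡ-+ W W W)) (W²≲ ⊕ W²≲))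

    rest : ℕ
    rest = W + suc r + S * 2 + q₂ * 8 + k₃

    rest≲ : rest ≲ cRest
    rest≲ = W≲ ⊕ (const 1 ⊕ lin {a = a} ≤-refl) ⊕ scaleʳ 2 S≲ ⊕ scaleʳ 8 q₂≲ ⊕ k₃≲

    -- The coefficient `δ + 4` is `δ - 2` for the plain classes plus `3 * 2` for the two colours of
    -- each of `3 * q` pairs.
    δχ≡ : δ * χ ≡ (δ + 4) * (δ * q) + δ * rest
    δχ≡ = total δ-2 q W (suc r) S q₂ k₃
      where
      total : ∀ d q W r S p k → (2 + d) * (d * q + W + r + ((q * 3 + S) * 2 + (p * 8 + k))) ≡
        (2 + d + 4) * ((2 + d) * q) + (2 + d) * (W + r + S * 2 + p * 8 + k)
      total = solve 7 (λ d q W r S p k → (con 2 :+ d) :* (d :* q :+ W :+ r :+ ((q :* con 3 :+ S) :* con 2 :+ (p :* con 8 :+ k))) :=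
        (con 2 :+ d :+ con 4) :* ((con 2 :+ d) :* q) :+ (con 2 :+ d) :* (W :+ r :+ S :* con 2 :+ p :* con 8 :+ k)) refl

    δq≤ : δ * q ≤ Δ + δ * 2
    δq≤ = ≤-trans (≤-reflexive (trans (*-distribˡ-+ δ 2 (Δ / δ)) (+-comm (δ * 2) (δ * (Δ / δ)))))
      (+-monoˡ-≤ (δ * 2) (≤-trans (≤-reflexive (*-comm δ (Δ / δ))) (m/n*n≤m Δ δ)))

    excess : δ * χ ∸ (δ + 4) * Δ ≤ c * E
    excess = ≤-trans (∸-monoˡ-≤ ((δ + 4) * Δ) upper) (≤-reflexive (m+n∸m≡n ((δ + 4) * Δ) (c * E)))
      where
      open ≤-Reasoning
      upper : δ * χ ≤ (δ + 4) * Δ + c * E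
      upper = begin
        δ * χ                                                 ≡⟨ δχ≡ ⟩
        (δ + 4) * (δ * q) + δ * rest                          ≤⟨ +-mono-≤ (*-monoʳ-≤ (δ + 4) δq≤) (bound (scale δ rest≲)) ⟩
        (δ + 4) * (Δ + δ * 2) + δ * cRest * E                 ≡⟨ cong (_+ δ * cRest * E) (*-distribˡ-+ (δ + 4) Δ (δ * 2)) ⟩
        (δ + 4) * Δ + (δ + 4) * (δ * 2) + δ * cRest * E       ≡⟨ +-assoc ((δ + 4) * Δ) _ _ ⟩
        (δ + 4) * Δ + ((δ + 4) * (δ * 2) + δ * cRest * E)     ≤⟨ +-monoʳ-≤ ((δ + 4) * Δ) (bound (const ((δ + 4) * (δ * 2)) ⊕ lin {a = δ * cRest} ≤-refl)) ⟩
        (δ + 4) * Δ + c * E                                   ∎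

-- Opaque copies, as the normal forms of the numbers of colours are huge.
module Parameters (δ-2 Δ D-1 : ℕ) where

  private module X = Numbers δ-2 Δ D-1
  open X public using (δ; D; E; w; q; c; Δ≤E²)

  abstract
    W S M C q₂ r ΔA kA k₃ : ℕ
    W = X.W
    S = X.S
    M = X.M
    C = X.C
    q₂ = X.q₂
    r = X.r
    ΔA = X.ΔA
    kA = X.kA
    k₃ = X.k₃

  P T N χ : ℕ
  P = q * 3 + S
  T = suc M + suc M
  N = 3 * C
  χ = kA + (P * 2 + (q₂ * 8 + k₃))

  abstract
    W≡ : W ≡ 8 * w
    W≡ = refl

    S≡ : S ≡ suc (W * W + W * W)
    S≡ = refl

    M≡ : M ≡ (Δ + Δ) / w
    M≡ = refl

    C≡ : C ≡ W * W + 2 * T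
    C≡ = refl

    q₂≡ : q₂ ≡ 2 * N + 2 * N + suc E
    q₂≡ = refl

    ΔA≡ : ΔA ≡ δ-2 * q + W
    ΔA≡ = refl

    kA≡ : kA ≡ ΔA + suc r
    kA≡ = refl

    k₃≡ : k₃ ≡ suc (3 * (W * (W + W)))
    k₃≡ = refl

    slack : Δ ≤ D * E → kA < suc r * r
    slack = X.slack

    excess : Δ ≤ D * E → δ * χ ∸ (δ + 4) * Δ ≤ c * E
    excess = X.excess

-- Number codes for small data

length-filter-true : {A : Set} (f : A → Bool) (xs : List A) →
  length (filter (λ x → f x Boolₚ.≟ true) xs) ≡ sum (map (λ x → if f x then 1 else 0) xs)
length-filter-true f [] = refl
length-filter-true f (x ∷ xs) with f x
... | true = cong suc (length-filter-true f xs)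
... | false = length-filter-true f xs

radix-injective : ∀ q .{{_ : NonZero q}} {a b a′ b′} → b < q → b′ < q → b + a * q ≡ b′ + a′ * q → a ≡ a′ × b ≡ b′
radix-injective q {a} {b} {a′} {b′} b< b′< eq =
    *-cancelʳ-≡ a a′ q (+-cancelˡ-≡ b _ _ (trans eq (cong (_+ a′ * q) (sym digit)))) , digit
  where
  digit : b ≡ b′
  digit = trans (sym (m<n⇒m%n≡m b<)) (trans (sym ([m+kn]%n≡m%n b a q)) (trans (cong (_% q) eq)
    (trans ([m+kn]%n≡m%n b′ a′ q) (m<n⇒m%n≡m b′<))))

radix-bound : ∀ {q a b m} → b < q → a < m → b + a * q < m * q
radix-bound {q} {a} b< a< = <-≤-trans (+-monoˡ-< (a * q) b<) (*-monoˡ-≤ q a<)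

/-superadditive : ∀ x y d .{{_ : NonZero d}} → x / d + y / d ≤ (x + y) / d
/-superadditive x y d = subst (_≤ (x + y) / d) (m*n/n≡m (x / d + y / d) d) (/-monoˡ-≤ d
  (≤-trans (≤-reflexive (*-distribʳ-+ d (x / d) (y / d))) (+-mono-≤ (m/n*n≤m x d) (m/n*n≤m y d))))

-- The block number of an owned edge, read as its group and its rank in the group.
encodeSlot : Bool × Bool → ℕ
encodeSlot (false , false) = 0
encodeSlot (false , true) = 1
encodeSlot (true , false) = 2
encodeSlot (true , true) = 3

decodeSlot : ℕ → Bool × Bool
decodeSlot 0 = false , false
decodeSlot 1 = false , true
decodeSlot 2 = true , false
decodeSlot _ = true , true

encode-decode : ∀ {j} → j < 4 → encodeSlot (decodeSlot j) ≡ j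
encode-decode {0} _ = refl
encode-decode {1} _ = refl
encode-decode {2} _ = refl
encode-decode {3} _ = refl
encode-decode {suc (suc (suc (suc _)))} (s≤s (s≤s (s≤s (s≤s ()))))

decode-encode : ∀ s → decodeSlot (encodeSlot s) ≡ s
decode-encode (false , false) = refl
decode-encode (false , true) = refl
decode-encode (true , false) = refl
decode-encode (true , true) = refl

encode<4 : ∀ s → encodeSlot s < 4
encode<4 (false , false) = s≤s z≤n
encode<4 (false , true) = s≤s (s≤s z≤n)
encode<4 (true , false) = s≤s (s≤s (s≤s z≤n))
encode<4 (true , true) = s≤s (s≤s (s≤s (s≤s z≤n)))

unbit : Fin 2 → Bool
unbit zero = true
unbit (suc _) = false

unbit-bit : ∀ β → unbit (bit β) ≡ β
unbit-bit true = refl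
unbit-bit false = refl

-- Darts and the δ classes

module Construction (G : Graph) (δ-2 Δ D-1 : ℕ) (min-degree : ∀ v → 2 + δ-2 ≤ degree G v)
  (max-degree : ∀ v → degree G v ≤ Δ) (cube : Δ ≤ suc D-1 * (suc D-1 * suc D-1)) where

  V Dart : Set
  V = Fin (n G)
  Dart = V × V

  abstract
    _≟D_ : DecidableEquality Dart
    _≟D_ = ≡-dec Finₚ._≟_ Finₚ._≟_

  open Parameters δ-2 Δ D-1 hiding (c; excess)

  abstract
    adj? : ∀ u v → Dec (Adj G u v)
    adj? u v = adj G u v Boolₚ.≟ true

  adj-comm : ∀ {u v} → Adj G u v → Adj G v u
  adj-comm {u} {v} = trans (adj-sym G v u)

  adj-distinct : ∀ {u v} → Adj G u v → u ≢ v
  adj-distinct {u} p refl = contradiction (trans (sym p) (irref G u)) λ ()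

  abstract
    neighbours : V → List V
    neighbours v = filter (adj? v) (allFin (n G))

    ∈-neighbours : ∀ {u v} → Adj G u v → v ∈ neighbours u
    ∈-neighbours {u} {v} p = ∈-filter⁺ (adj? u) (∈-allFin v) p

    neighbours-∈ : ∀ {u v} → v ∈ neighbours u → Adj G u v
    neighbours-∈ {u} v∈ = proj₂ (∈-filter⁻ (adj? u) {xs = allFin (n G)} v∈)

    neighbours-unique : ∀ v → Unique (neighbours v)
    neighbours-unique v = Uniqueₚ.filter⁺ (adj? v) (Uniqueₚ.allFin⁺ (n G))

    length-neighbours : ∀ v → length (neighbours v) ≡ degree G v
    length-neighbours v = length-filter-true (adj G v) (allFin (n G))

  neighbours-few : ∀ v → length (neighbours v) ≤ Δ
  neighbours-few v = ≤-trans (≤-reflexive (length-neighbours v)) (max-degree v)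

  abstract
    Low : V → Set
    Low v = degree G v < W

    low? : ∀ v → Dec (Low v)
    low? v = degree G v <? W

    low-few : ∀ {v} → Low v → length (neighbours v) < W
    low-few {v} = subst (_< W) (sym (length-neighbours v))

    high-many : ∀ {v} → ¬ Low v → W ≤ length (neighbours v)
    high-many {v} hi = subst (W ≤_) (sym (length-neighbours v)) (≮⇒≥ hi)

  High : V → Set
  High v = ¬ Low v

  -- Every edge with a high end is represented by exactly one dart with a high second component;
  -- low-low edges give two darts.
  IsDart IsEdge : Dart → Set
  IsDart e = Adj G (proj₁ e) (proj₂ e) × (Low (proj₁ e) ⊎ (High (proj₁ e) × High (proj₂ e) × proj₁ e Fin.< proj₂ e))
  IsEdge e = IsDart e × High (proj₂ e)

  abstract
    isDart? : ∀ e → Dec (IsDart e)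
    isDart? e = adj? (proj₁ e) (proj₂ e) ×-dec (low? (proj₁ e) ⊎-dec
      (¬? (low? (proj₁ e)) ×-dec (¬? (low? (proj₂ e)) ×-dec (proj₁ e Finₚ.<? proj₂ e))))

  abstract
    isEdge? : ∀ e → Dec (IsEdge e)
    isEdge? e = isDart? e ×-dec ¬? (low? (proj₂ e))

  abstract
    allDarts : List Dart
    allDarts = cartesianProduct (allFin (n G)) (allFin (n G))

    allDarts-unique : Unique allDarts
    allDarts-unique = Uniqueₚ.cartesianProduct⁺ (Uniqueₚ.allFin⁺ (n G)) (Uniqueₚ.allFin⁺ (n G))

    ∈-allDarts : ∀ e → e ∈ allDarts
    ∈-allDarts (a , b) = ∈-cartesianProduct⁺ (∈-allFin a) (∈-allFin b)

    darts : List Dart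
    darts = filter isDart? allDarts

    darts-unique : Unique darts
    darts-unique = Uniqueₚ.filter⁺ isDart? allDarts-unique

    ∈-darts : ∀ {e} → IsDart e → e ∈ darts
    ∈-darts {e} = ∈-filter⁺ isDart? (∈-allDarts e)

    darts-∈ : ∀ {e} → e ∈ darts → IsDart e
    darts-∈ e∈ = proj₂ (∈-filter⁻ isDart? {xs = allDarts} e∈)

  edge-dart : ∀ {e} → IsEdge e → e ∈ darts
  edge-dart = ∈-darts ∘ proj₁

  edge-adj : ∀ {e} → IsEdge e → Adj G (proj₁ e) (proj₂ e)
  edge-adj = proj₁ ∘ proj₁

  edge-distinct : ∀ {e} → IsEdge e → proj₁ e ≢ proj₂ e
  edge-distinct = adj-distinct ∘ edge-adj

  edge-asym : ∀ {a b} → IsEdge (a , b) → ¬ IsEdge (b , a)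
  edge-asym ((_ , inj₁ lo) , _) (_ , hi) = hi lo
  edge-asym ((_ , inj₂ _) , hi) ((_ , inj₁ lo) , _) = hi lo
  edge-asym ((_ , inj₂ (_ , _ , lt)) , hi) ((_ , inj₂ (_ , _ , gt)) , _) = Finₚ.<-asym lt gt

  module Q = Equitable _≟D_ (suc δ-2) darts darts-unique proj₁ proj₂
  open Q using (class) public

  low-count : ∀ {u} → Low u → degree G u ≤ Q.L.count darts u
  low-count {u} lo = subst (_≤ Q.L.count darts u) (length-neighbours u) (injection-length (neighbours-unique u) (u ,_)
    (λ _ _ → cong proj₂) (λ v∈ → ∈-filter⁺ (λ e → proj₁ e Finₚ.≟ u) (∈-darts (neighbours-∈ v∈ , inj₁ lo)) refl))

  abstract
    -- Every edge at a low vertex is a dart with that vertex on the left, which is why edges between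
    -- low vertices give two darts. The minimum degree then makes the first block full.
    special : ∀ x u → Low u → ∃ λ e → e ∈ darts × proj₁ e ≡ u × class e ≡ x
    special x u lo = forget (Q.full-block-l 0 (≤-trans (≤-reflexive (*-identityˡ δ)) (≤-trans (min-degree u) (low-count lo))) x)
      where
      forget : (∃ λ e → e ∈ darts × proj₁ e ≡ u × class e ≡ x × Q.block-l e ≡ 0) → ∃ λ e → e ∈ darts × proj₁ e ≡ u × class e ≡ x
      forget (e , e∈ , p , q , _) = e , e∈ , p , q

  abstract
    pick : Fin δ → V → Dart
    pick x u with low? u
    ... | yes lo = proj₁ (special x u lo)
    -- A junk value; the specification concerns low vertices only.
    ... | no _ = u , u

    pick-spec : ∀ x {u} → Low u → pick x u ∈ darts × proj₁ (pick x u) ≡ u × class (pick x u) ≡ x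
    pick-spec x {u} lo with low? u
    ... | yes lo′ = proj₂ (special x u lo′)
    ... | no hi = contradiction lo hi

  -- Items: single darts, and the two chosen darts of an active vertex

  e₁ e₂ : V → Dart
  e₁ = pick zero
  e₂ = pick (suc zero)

  Active : V → Set
  Active u = Low u × (∀ v → Adj G u v → High v)

  abstract
    active? : ∀ u → Dec (Active u)
    active? u = low? u ×-dec Finₚ.all? (λ v → adj? u v →-dec ¬? (low? v))

  pick-left : ∀ x {u} → Active u → proj₁ (pick x u) ≡ u
  pick-left x (lo , _) = proj₁ (proj₂ (pick-spec x lo))

  pick-class : ∀ x {u} → Active u → class (pick x u) ≡ x
  pick-class x (lo , _) = proj₂ (proj₂ (pick-spec x lo))

  pick-edge : ∀ x {u} → Active u → IsEdge (pick x u)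
  pick-edge x {u} ac@(lo , hi) with pick x u | pick-spec x lo
  ... | .u , b | e∈ , refl , _ = darts-∈ e∈ , hi b (proj₁ (darts-∈ e∈))

  e₁≢e₂ : ∀ {u} → Active u → e₁ u ≢ e₂ u
  e₁≢e₂ ac eq with () ← trans (sym (pick-class zero ac)) (trans (cong class eq) (pick-class (suc zero) ac))

  ends-differ : ∀ {u} → Active u → proj₂ (e₁ u) ≢ proj₂ (e₂ u)
  ends-differ ac eq = e₁≢e₂ ac (cong₂ _,_ (trans (pick-left zero ac) (sym (pick-left (suc zero) ac))) eq)

  First Second : Dart → Set
  First e = Active (proj₁ e) × e ≡ e₁ (proj₁ e)
  Second e = Active (proj₁ e) × e ≡ e₂ (proj₁ e)

  abstract
    first? : ∀ e → Dec (First e)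
    first? e = active? (proj₁ e) ×-dec (e ≟D e₁ (proj₁ e))

  abstract
    second? : ∀ e → Dec (Second e)
    second? e = active? (proj₁ e) ×-dec (e ≟D e₂ (proj₁ e))

  e₁-first : ∀ {u} → Active u → First (e₁ u)
  e₁-first {u} ac = subst (λ x → Active x × e₁ u ≡ e₁ x) (sym (pick-left zero ac)) (ac , refl)

  e₂-second : ∀ {u} → Active u → Second (e₂ u)
  e₂-second {u} ac = subst (λ x → Active x × e₂ u ≡ e₂ x) (sym (pick-left (suc zero) ac)) (ac , refl)

  first-not-second : ∀ {e} → First e → ¬ Second e
  first-not-second (ac , p) (_ , q) = e₁≢e₂ ac (trans (sym p) q)

  -- The two darts e₁ u and e₂ u of an active vertex u form a single item, represented by e₁ u, which is regarded
  -- as an edge between their high ends; any other dart is an item of its own.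
  IsItem : Dart → Set
  IsItem e = IsEdge e × ¬ Second e

  abstract
    isItem? : ∀ e → Dec (IsItem e)
    isItem? e = isEdge? e ×-dec ¬? (second? e)

  abstract
    items : List Dart
    items = filter isItem? allDarts

    items-unique : Unique items
    items-unique = Uniqueₚ.filter⁺ isItem? allDarts-unique

    ∈-items : ∀ {e} → IsItem e → e ∈ items
    ∈-items {e} = ∈-filter⁺ isItem? (∈-allDarts e)

    items-∈ : ∀ {e} → e ∈ items → IsItem e
    items-∈ e∈ = proj₂ (∈-filter⁻ isItem? {xs = allDarts} e∈)

  partner : Dart → Dart
  partner e with first? e
  ... | yes _ = e₂ (proj₁ e)
  ... | no _ = e

  -- The second end of an item regarded as an edge; the first end is always `proj₂`.
  other : Dart → V
  other e with first? e
  ... | yes _ = proj₂ (e₂ (proj₁ e))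
  ... | no _ = proj₁ e

  item : Dart → Dart
  item e with second? e
  ... | yes _ = e₁ (proj₁ e)
  ... | no _ = e

  side : Dart → Bool
  side e = does (second? e)

  other-first : ∀ {e} → First e → other e ≡ proj₂ (e₂ (proj₁ e))
  other-first {e} f with first? e
  ... | yes _ = refl
  ... | no nf = contradiction f nf

  other-single : ∀ {e} → ¬ First e → other e ≡ proj₁ e
  other-single {e} nf with first? e
  ... | yes f = contradiction f nf
  ... | no _ = refl

  item-second : ∀ {e} → Second e → item e ≡ e₁ (proj₁ e)
  item-second {e} s with second? e
  ... | yes _ = refl
  ... | no ns = contradiction s ns

  item-single : ∀ {e} → ¬ Second e → item e ≡ e
  item-single {e} ns with second? e
  ... | yes s = contradiction s ns
  ... | no _ = refl

  item-is-item : ∀ {e} → IsEdge e → IsItem (item e)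
  item-is-item {e} ed with second? e
  ... | yes (ac , _) = pick-edge zero ac , first-not-second (e₁-first ac)
  ... | no ns = ed , ns

  item-e₁ : ∀ {u} → Active u → item (e₁ u) ≡ e₁ u
  item-e₁ ac = item-single (first-not-second (e₁-first ac))

  item-e₂ : ∀ {u} → Active u → item (e₂ u) ≡ e₁ u
  item-e₂ {u} ac = trans (item-second (e₂-second ac)) (cong e₁ (pick-left (suc zero) ac))

  item-side-injective : ∀ {d d′} → item d ≡ item d′ → side d ≡ side d′ → d ≡ d′
  item-side-injective {d} {d′} ieq seq with second? d | second? d′
  ... | yes (ac , p) | yes (ac′ , p′) = trans p (trans (cong e₂
          (trans (sym (pick-left zero ac)) (trans (cong proj₁ ieq) (pick-left zero ac′)))) (sym p′))
  ... | no _ | no _ = ieq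
  item-side-injective _ () | yes _ | no _
  item-side-injective _ () | no _ | yes _

  item-partner : ∀ {e} → ¬ Second e → item (partner e) ≡ e
  item-partner {e} ns with first? e
  ... | yes (ac , p) = trans (item-e₂ ac) (sym p)
  ... | no _ = item-single ns

  partner-edge : ∀ {e} → IsEdge e → IsEdge (partner e)
  partner-edge {e} ed with first? e
  ... | yes (ac , _) = pick-edge (suc zero) ac
  ... | no _ = ed

  partner-end : ∀ e → other e ≡ proj₂ (partner e) × First e ⊎ other e ≡ proj₁ (partner e) × partner e ≡ e × ¬ First e
  partner-end e with first? e
  ... | yes f = inj₁ (refl , f)
  ... | no nf = inj₂ (refl , refl , nf)

  partner-single : ∀ {e} → ¬ First e → partner e ≡ e
  partner-single {e} nf with first? e
  ... | yes f = contradiction f nf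
  ... | no _ = refl

  partner-first : ∀ {e} → First e → partner e ≡ e₂ (proj₁ e)
  partner-first {e} f with first? e
  ... | yes _ = refl
  ... | no nf = contradiction f nf

  first-low : ∀ {e} → First e → Low (proj₁ e)
  first-low ((lo , _) , _) = lo

  -- The vertices whose palettes contain a colour of the item. For a single dart the left end is
  -- listed twice, which doubles its share in the counts below.
  touched : Dart → List V
  touched e = proj₁ e ∷ proj₂ e ∷ other e ∷ []

  End : Dart → V → Set
  End e v = proj₁ e ≡ v ⊎ proj₂ e ≡ v

  end-touched : ∀ {d v} → End d v → v ∈ touched (item d)
  end-touched {d} end with second? d
  end-touched (inj₁ refl) | yes (ac , _) = here (sym (pick-left zero ac))
  end-touched {d} (inj₂ refl) | yes (ac , p) = there (there (here (sym (trans (other-first (e₁-first ac))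
    (trans (cong (proj₂ ∘ e₂) (pick-left zero ac)) (cong proj₂ (sym p)))))))
  end-touched (inj₁ refl) | no _ = here refl
  end-touched (inj₂ refl) | no _ = there (here refl)

  low-touched : ∀ {e v} → IsEdge e → v ∈ touched e → Low v → proj₁ e ≡ v
  low-touched ed (here refl) lo = refl
  low-touched (_ , hi) (there (here refl)) lo = contradiction lo hi
  low-touched {e} ed (there (there (here refl))) lo with first? e
  ... | yes (ac , _) = contradiction lo (proj₂ (pick-edge (suc zero) ac))
  ... | no _ = refl

  high-end : ∀ {e v} → v ∈ touched e → High v → v ≡ proj₂ e ⊎ v ≡ other e
  high-end {e} (here refl) hi = inj₂ (sym (other-single (hi ∘ first-low)))
  high-end (there (here p)) hi = inj₁ p
  high-end (there (there (here p))) hi = inj₂ p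

  -- The two darts of a pair have different high ends, so a high vertex meets at most one of them;
  -- among the darts at `v`, `item` and `dartAt v` are inverse to each other.
  dartAt : V → Dart → Dart
  dartAt v e with proj₂ e Finₚ.≟ v
  ... | yes _ = e
  ... | no _ = partner e

  high-touched : ∀ {e v} → IsItem e → v ∈ touched e → High v → End (dartAt v e) v
  high-touched {e} {v} it v∈ hi with proj₂ e Finₚ.≟ v
  ... | yes p = inj₂ p
  high-touched {e} it (here refl) hi | no _ = inj₁ (cong proj₁ (partner-single (hi ∘ first-low)))
  high-touched it (there (here refl)) hi | no p = contradiction refl p
  high-touched {e} it (there (there (here refl))) hi | no p with partner-end e
  ... | inj₁ (q , _) = inj₂ (sym q)
  ... | inj₂ (q , _) = inj₁ (sym q)

  dartAt-edge : ∀ {e} v → IsEdge e → IsEdge (dartAt v e)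
  dartAt-edge {e} v ed with proj₂ e Finₚ.≟ v
  ... | yes _ = ed
  ... | no _ = partner-edge ed

  item-dartAt : ∀ {e} v → IsItem e → item (dartAt v e) ≡ e
  item-dartAt {e} v (_ , ns) with proj₂ e Finₚ.≟ v
  ... | yes _ = item-single ns
  ... | no _ = item-partner ns

  dartAt-item : ∀ {d v} → High v → End d v → dartAt v (item d) ≡ d
  dartAt-item {d} {v} hi end with second? d
  dartAt-item {d} {v} hi (inj₁ refl) | yes ((lo , _) , _) = contradiction lo hi
  dartAt-item {d} {v} hi (inj₂ refl) | yes (ac , p) with proj₂ (e₁ (proj₁ d)) Finₚ.≟ proj₂ d
  ... | yes q = contradiction (trans q (cong proj₂ p)) (ends-differ ac)
  ... | no _ = trans (partner-first (e₁-first ac)) (trans (cong e₂ (pick-left zero ac)) (sym p))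
  dartAt-item {d} {v} hi end | no _ with proj₂ d Finₚ.≟ v
  ... | yes _ = refl
  dartAt-item hi (inj₁ refl) | no _ | no _ = partner-single (hi ∘ first-low)
  dartAt-item hi (inj₂ q) | no _ | no p = contradiction q p

  -- The dart of an edge, and conflicts between items

  canon : V → V → Dart
  canon u v with low? u | low? v
  ... | yes _ | no _ = u , v
  ... | no _ | yes _ = v , u
  ... | _ | _ with u Finₚ.<? v
  ... | yes _ = u , v
  ... | no _ = v , u

  canon-cases : ∀ u v → canon u v ≡ (u , v) ⊎ canon u v ≡ (v , u)
  canon-cases u v with low? u | low? v
  ... | yes _ | no _ = inj₁ refl
  ... | no _ | yes _ = inj₂ refl
  ... | yes _ | yes _ with u Finₚ.<? v
  ... | yes _ = inj₁ refl
  ... | no _ = inj₂ refl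
  canon-cases u v | no _ | no _ with u Finₚ.<? v
  ... | yes _ = inj₁ refl
  ... | no _ = inj₂ refl

  ≮-flip : ∀ {u v : V} → u ≢ v → ¬ u Fin.< v → v Fin.< u
  ≮-flip u≢v u≮v = ≤∧≢⇒< (≮⇒≥ u≮v) (u≢v ∘ sym ∘ Finₚ.toℕ-injective)

  canon-comm : ∀ {u v} → u ≢ v → canon u v ≡ canon v u
  canon-comm {u} {v} u≢v with low? u | low? v
  ... | yes _ | no _ = refl
  ... | no _ | yes _ = refl
  ... | yes _ | yes _ with u Finₚ.<? v | v Finₚ.<? u
  ... | yes p | yes p′ = contradiction p′ (Finₚ.<-asym p)
  ... | yes _ | no _ = refl
  ... | no _ | yes _ = refl
  ... | no p | no p′ = contradiction (≮-flip u≢v p) p′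
  canon-comm {u} {v} u≢v | no _ | no _ with u Finₚ.<? v | v Finₚ.<? u
  ... | yes p | yes p′ = contradiction p′ (Finₚ.<-asym p)
  ... | yes _ | no _ = refl
  ... | no _ | yes _ = refl
  ... | no p | no p′ = contradiction (≮-flip u≢v p) p′

  canon-edge : ∀ {u v} → Adj G u v → ¬ (Low u × Low v) → IsEdge (canon u v)
  canon-edge {u} {v} p nl with low? u | low? v
  ... | yes lo | yes lo′ = contradiction (lo , lo′) nl
  ... | yes lo | no hi = (p , inj₁ lo) , hi
  ... | no hi | yes lo = (adj-comm p , inj₁ lo) , hi
  ... | no hi | no hi′ with u Finₚ.<? v
  ... | yes lt = (p , inj₂ (hi , hi′ , lt)) , hi′
  ... | no nlt = (adj-comm p , inj₂ (hi′ , hi , ≮-flip (adj-distinct p) nlt)) , hi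

  canon-low : ∀ {u v} → Adj G u v → Low u → Low v → proj₁ (canon u v) Fin.< proj₂ (canon u v)
  canon-low {u} {v} p lo lo′ with low? u | low? v
  ... | no hi | _ = contradiction lo hi
  ... | yes _ | no hi = contradiction lo′ hi
  ... | yes _ | yes _ with u Finₚ.<? v
  ... | yes lt = lt
  ... | no nlt = ≮-flip (adj-distinct p) nlt

  canon-low-high : ∀ {u v} → Low u → High v → canon u v ≡ (u , v)
  canon-low-high {u} {v} lo hi with low? u | low? v
  ... | yes _ | no _ = refl
  ... | yes _ | yes lo′ = contradiction lo′ hi
  ... | no hi′ | _ = contradiction lo hi′

  canon-end : ∀ u v → End (canon u v) u
  canon-end u v with canon-cases u v
  ... | inj₁ p = inj₁ (cong proj₁ p)
  ... | inj₂ p = inj₂ (cong proj₂ p)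

  canon-injective : ∀ {u v v′} → canon u v ≡ canon u v′ → v ≡ v′
  canon-injective {u} {v} {v′} eq with canon-cases u v | canon-cases u v′
  ... | inj₁ p | inj₁ p′ = cong proj₂ (trans (sym p) (trans eq p′))
  ... | inj₂ p | inj₂ p′ = cong proj₁ (trans (sym p) (trans eq p′))
  ... | inj₁ p | inj₂ p′ with refl ← trans (sym p) (trans eq p′) = refl
  ... | inj₂ p | inj₁ p′ with refl ← trans (sym p) (trans eq p′) = refl

  abstract
    touches? : ∀ v e → Dec (v ∈ touched e)
    touches? v e = member? Finₚ._≟_ v (touched e)

  -- Low neighbours are included so that the palettes of adjacent low vertices can be told apart. A
  -- high vertex has too many neighbours for this and stands only for itself.
  near : V → List V
  near v with low? v
  ... | yes _ = v ∷ filter low? (neighbours v)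
  ... | no _ = v ∷ []

  near-refl : ∀ v → v ∈ near v
  near-refl v with low? v
  ... | yes _ = here refl
  ... | no _ = here refl

  near-low : ∀ {u v} → Low u → Low v → Adj G u v → v ∈ near u
  near-low {u} lo lo′ p with low? u
  ... | yes _ = there (∈-filter⁺ low? (∈-neighbours p) lo′)
  ... | no hi = contradiction lo hi

  near-cases : ∀ {u v} → v ∈ near u → u ≡ v ⊎ (Low u × Low v × Adj G u v)
  near-cases {u} v∈ with low? u
  near-cases (here refl) | yes _ = inj₁ refl
  near-cases {u} (there v∈) | yes lo with p , q ← ∈-filter⁻ low? {xs = neighbours u} v∈ = inj₂ (lo , q , neighbours-∈ p)
  near-cases (here refl) | no _ = inj₁ refl

  near-sym : ∀ {u v} → v ∈ near u → u ∈ near v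
  near-sym {u} v∈ with near-cases v∈
  ... | inj₁ refl = near-refl u
  ... | inj₂ (lo , lo′ , p) = near-low lo′ lo (adj-comm p)

  near-few : ∀ {v} → Low v → length (near v) ≤ W
  near-few {v} lo with low? v
  ... | yes _ = ≤-trans (s≤s (length-filter low? (neighbours v))) (low-few lo)
  ... | no hi = contradiction lo hi

  near-high : ∀ {v} → High v → near v ≡ v ∷ []
  near-high {v} hi with low? v
  ... | yes lo = contradiction lo hi
  ... | no _ = refl

  Conflict : Dart → Dart → Set
  Conflict e f = ∃₂ λ u v → u ∈ touched e × v ∈ near u × v ∈ touched f

  conflict-sym : ∀ {e f} → Conflict e f → Conflict f e
  conflict-sym (u , v , u∈ , near , v∈) = v , u , v∈ , near-sym near , u∈

  module _ (es : List Dart) where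

    touching : V → List Dart
    touching v = filter (touches? v) es

    conflicting : Dart → List Dart
    conflicting e = concatMap (concatMap touching ∘ near) (touched e)

    ∈-conflicting : ∀ {e f} → f ∈ es → Conflict e f → f ∈ conflicting e
    ∈-conflicting f∈ (u , v , u∈ , v∈ , p) = ∈-concatMap (concatMap touching ∘ near) u∈
      (∈-concatMap touching v∈ (∈-filter⁺ (touches? v) f∈ p))

    near-touching : V → List Dart
    near-touching v = concatMap touching (near v)

    near-low-length : ∀ {m v} → (∀ {u} → Low u → length (touching u) ≤ m) → Low v → length (near-touching v) ≤ W * m
    near-low-length {m} {v} few lo = ≤-trans (concatMap-length touching (near v) (few ∘ low-near)) (*-monoˡ-≤ m (near-few lo))
      where
      low-near : ∀ {u} → u ∈ near v → Low u
      low-near u∈ with near-cases u∈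
      ... | inj₁ refl = lo
      ... | inj₂ (_ , lo′ , _) = lo′

    near-high-length : ∀ {v} → High v → length (near-touching v) ≡ length (touching v)
    near-high-length {v} hi rewrite near-high hi = trans (length-++ (touching v)) (+-identityʳ _)

    conflicting-length : ∀ e → length (conflicting e) ≡
      length (near-touching (proj₁ e)) + (length (near-touching (proj₂ e)) + (length (near-touching (other e)) + 0))
    conflicting-length e = trans (length-++ (near-touching (proj₁ e))) (cong (length (near-touching (proj₁ e)) +_)
      (trans (length-++ (near-touching (proj₂ e))) (cong (length (near-touching (proj₂ e)) +_)
        (length-++ (near-touching (other e))))))

    low-touching : (∀ {e} → e ∈ es → IsEdge e) → Unique es → ∀ {v} → Low v → length (touching v) ≤ W
    low-touching edges unique {v} lo = ≤-trans (injection-length (Uniqueₚ.filter⁺ (touches? v) unique) proj₂ inj into) (<⇒≤ (low-few lo))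
      where
      left : ∀ {e} → e ∈ touching v → proj₁ e ≡ v
      left e∈ with p , q ← ∈-filter⁻ (touches? v) {xs = es} e∈ = low-touched (edges p) q lo
      inj : ∀ {e f} → e ∈ touching v → f ∈ touching v → proj₂ e ≡ proj₂ f → e ≡ f
      inj e∈ f∈ eq = cong₂ _,_ (trans (left e∈) (sym (left f∈))) eq
      into : ∀ {e} → e ∈ touching v → proj₂ e ∈ neighbours v
      into e∈ = ∈-neighbours (subst (λ x → Adj G x _) (left e∈)
        (edge-adj (edges (proj₁ (∈-filter⁻ (touches? v) {xs = es} e∈)))))

  -- Pair colours for the two classes of J

  module Pairs where

    opposite : V → Dart → V
    opposite v e with proj₂ e Finₚ.≟ v
    ... | yes _ = proj₁ e
    ... | no _ = proj₂ e

    opposite-neighbour : ∀ {e v} → IsDart e → End e v → opposite v e ∈ neighbours v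
    opposite-neighbour {e} {v} is end with proj₂ e Finₚ.≟ v
    opposite-neighbour (p , _) end | yes refl = ∈-neighbours (adj-comm p)
    opposite-neighbour (p , _) (inj₁ refl) | no _ = ∈-neighbours p
    opposite-neighbour _ (inj₂ r) | no nr = contradiction r nr

    high-asym : ∀ {v a} → High v → IsDart (v , a) → ¬ IsDart (a , v)
    high-asym hi (_ , inj₁ lo) _ = hi lo
    high-asym hi (_ , inj₂ (_ , ha , _)) (_ , inj₁ lo) = ha lo
    high-asym hi (_ , inj₂ (_ , _ , lt)) (_ , inj₂ (_ , _ , gt)) = Finₚ.<-asym lt gt

    opposite-injective : ∀ {e f v} → High v → IsDart e → IsDart f → End e v → End f v →
      opposite v e ≡ opposite v f → e ≡ f
    opposite-injective {e} {f} {v} hi de df ee ef eq with proj₂ e Finₚ.≟ v | proj₂ f Finₚ.≟ v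
    opposite-injective hi de df _ _ refl | yes refl | yes refl = refl
    opposite-injective hi de df _ (inj₁ refl) refl | yes refl | no _ = contradiction de (high-asym hi df)
    opposite-injective hi de df (inj₁ refl) _ refl | no _ | yes refl = contradiction df (high-asym hi de)
    opposite-injective hi de df (inj₁ refl) (inj₁ refl) refl | no _ | no _ = refl
    opposite-injective hi de df (inj₂ r) _ _ | no nr | _ = contradiction r nr
    opposite-injective hi de df _ (inj₂ r) _ | _ | no nr = contradiction r nr

    incoming outgoing : V → ℕ
    incoming v = Q.R.count darts v
    outgoing v = Q.L.count darts v

    -- Only edges between low vertices have two darts, so at a high vertex the darts of both sides
    -- together inject into the neighbours.
    high-degree : ∀ {v} → High v → incoming v + outgoing v ≤ Δ
    high-degree {v} hi = ≤-trans (≤-reflexive (sym (length-++ rights)))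
        (≤-trans (injection-length (Uniqueₚ.++⁺ (Uniqueₚ.filter⁺ r? darts-unique) (Uniqueₚ.filter⁺ l? darts-unique) disjoint)
          (opposite v)
          (λ e∈ f∈ → let de , ee = info e∈ ; df , ef = info f∈ in opposite-injective hi de df ee ef)
          (λ e∈ → let de , ee = info e∈ in opposite-neighbour de ee))
        (neighbours-few v))
      where
      r? : ∀ e → Dec (proj₂ e ≡ v)
      r? e = proj₂ e Finₚ.≟ v
      l? : ∀ e → Dec (proj₁ e ≡ v)
      l? e = proj₁ e Finₚ.≟ v
      rights lefts : List Dart
      rights = filter r? darts
      lefts = filter l? darts
      disjoint : ∀ {e} → ¬ (e ∈ rights × e ∈ lefts)
      disjoint (p , p′) with e∈ , refl ← ∈-filter⁻ r? {xs = darts} p | _ , eq ← ∈-filter⁻ l? {xs = darts} p′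
        = adj-distinct (proj₁ (darts-∈ e∈)) eq
      info : ∀ {e} → e ∈ rights ++ lefts → IsDart e × End e v
      info e∈ with ∈-++⁻ rights e∈
      ... | inj₁ p with e∈ , r ← ∈-filter⁻ r? {xs = darts} p = darts-∈ e∈ , inj₂ r
      ... | inj₂ p with e∈ , l ← ∈-filter⁻ l? {xs = darts} p = darts-∈ e∈ , inj₁ l

    -- Within one class, the darts at a high vertex are numbered by 0, …, q - 1.
    pos : V → Dart → ℕ
    pos v = Q.slot (suc (incoming v / δ)) v

    -- Rounding up on each of the two sides costs one, hence `2 + Δ / δ`.
    pos-bound : ∀ {v e} → High v → e ∈ darts → End e v → pos v e < q
    pos-bound {v} hi = Q.slot-bound ≤-refl (s≤s (s≤s (≤-trans (/-superadditive (incoming v) (outgoing v) δ)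
      (/-monoˡ-≤ δ (high-degree hi)))))

    pos-cases : ∀ {v e f} → e ∈ darts → f ∈ darts → End e v → End f v → pos v e ≡ pos v f →
      (proj₂ e ≡ v × proj₂ f ≡ v × Q.block-r e ≡ Q.block-r f) ⊎ (proj₁ e ≡ v × proj₁ f ≡ v × Q.block-l e ≡ Q.block-l f)
    pos-cases = Q.slot-injective ≤-refl

    pos-injective : ∀ {v e f} → e ∈ darts → f ∈ darts → End e v → End f v → class e ≡ class f → pos v e ≡ pos v f → e ≡ f
    pos-injective e∈ f∈ ee ef ceq peq with pos-cases e∈ f∈ ee ef peq
    ... | inj₁ (p , p′ , beq) = Q.class-r e∈ f∈ (trans p (sym p′)) ceq beq
    ... | inj₂ (p , p′ , beq) = Q.class-l e∈ f∈ (trans p (sym p′)) ceq beq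

    -- Membership in the subgraph J: its two classes include those of `e₁` and `e₂`.
    Small : Dart → Set
    Small e = toℕ (class e) < 2

    abstract
      small? : ∀ e → Dec (Small e)
      small? e = toℕ (class e) <? 2

    bItems : List Dart
    bItems = filter small? items

    bItems-unique : Unique bItems
    bItems-unique = Uniqueₚ.filter⁺ small? items-unique

    ∈-bItems : ∀ {e} → IsItem e → Small e → e ∈ bItems
    ∈-bItems it = ∈-filter⁺ small? (∈-items it)

    bItems-∈ : ∀ {e} → e ∈ bItems → IsItem e × Small e
    bItems-∈ e∈ with p , sm ← ∈-filter⁻ small? {xs = items} e∈ = items-∈ p , sm

    pick-small : ∀ {u} x → Active u → toℕ x < 2 → Small (pick x u)
    pick-small x ac lt = subst (λ y → toℕ y < 2) (sym (pick-class x ac)) lt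

    dartAt-small : ∀ {e} v → Small e → Small (dartAt v e)
    dartAt-small {e} v sm with proj₂ e Finₚ.≟ v
    ... | yes _ = sm
    ... | no _ with first? e
    ... | yes (ac , _) = pick-small (suc zero) ac (s≤s (s≤s z≤n))
    ... | no _ = sm

    high-touching : ∀ {v} → High v → length (touching bItems v) ≤ 2 * q
    high-touching {v} hi = filter-length (touches? v) bItems-unique
        (λ e → pos v (dartAt v e) + toℕ (class (dartAt v e)) * q)
        (λ e∈ v∈ → let it , sm = bItems-∈ e∈ in radix-bound (bound it v∈) (dartAt-small v sm))
        λ e∈ v∈ f∈ v∈′ eq → let it , _ = bItems-∈ e∈ ; it′ , _ = bItems-∈ f∈
                                ceq , peq = radix-injective q (bound it v∈) (bound it′ v∈′) eq
          in trans (sym (item-dartAt v it)) (trans (cong item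
               (pos-injective (edge-dart (dartAt-edge v (proj₁ it))) (edge-dart (dartAt-edge v (proj₁ it′)))
                 (high-touched it v∈ hi) (high-touched it′ v∈′ hi) (Finₚ.toℕ-injective ceq) peq)) (item-dartAt v it′))
      where
      bound : ∀ {e} → IsItem e → v ∈ touched e → pos v (dartAt v e) < q
      bound it v∈ = pos-bound hi (edge-dart (dartAt-edge v (proj₁ it))) (high-touched it v∈ hi)

    -- The items with two high ends. A greedy choice would have to avoid about `4 * q` pairs for
    -- them, more than the `3 * q` available; a flexible item has a single high end, and `2 * q`
    -- plus the conflicts at its low end are affordable.
    Rigid : Dart → Set
    Rigid e = First e ⊎ High (proj₁ e)

    abstract
      rigid? : ∀ e → Dec (Rigid e)
      rigid? e = first? e ⊎-dec ¬? (low? (proj₁ e))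

    rigid flexible : List Dart
    rigid = filter rigid? bItems
    flexible = filter (¬? ∘ rigid?) bItems

    rigid-unique : Unique rigid
    rigid-unique = Uniqueₚ.filter⁺ rigid? bItems-unique

    rigid-∈ : ∀ {e} → e ∈ rigid → IsItem e × Small e × Rigid e
    rigid-∈ e∈ with p , r ← ∈-filter⁻ rigid? {xs = bItems} e∈ = proj₁ (bItems-∈ p) , proj₂ (bItems-∈ p) , r

    -- At a high vertex, items leave by class-0 darts on the right or class-1 darts on the left, and enter by the
    -- opposite combinations; hence both the out-degree and the in-degree are at most q.
    tail head : Dart → V
    tail e with class e Finₚ.≟ zero
    ... | yes _ = proj₂ e
    ... | no _ = other e
    head e with class e Finₚ.≟ zero
    ... | yes _ = other e
    ... | no _ = proj₂ e

    small-nonzero : ∀ {e} → Small e → class e ≢ zero → class e ≡ suc zero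
    small-nonzero {e} sm nz with class e
    ... | zero = contradiction refl nz
    ... | suc zero = refl
    small-nonzero {e} (s≤s (s≤s ())) nz | suc (suc _)

    first-class : ∀ {e} → First e → class e ≡ zero
    first-class (ac , p) = trans (cong class p) (pick-class zero ac)

    -- Class `x` on the right of `v` and class `y` on its left. With one class per side, `pos v`
    -- remains injective although two classes are mixed.
    View : Fin δ → Fin δ → V → Dart → Set
    View x y v e = IsEdge e × High v × ((class e ≡ x × proj₂ e ≡ v) ⊎ (class e ≡ y × proj₁ e ≡ v))

    view-end : ∀ {x y v e} → View x y v e → End e v
    view-end (_ , _ , inj₁ (_ , p)) = inj₂ p
    view-end (_ , _ , inj₂ (_ , p)) = inj₁ p

    view-right : ∀ {x y v e} → View x y v e → proj₂ e ≡ v → class e ≡ x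
    view-right (_ , _ , inj₁ (c , _)) _ = c
    view-right (ed , _ , inj₂ (_ , p)) q = contradiction (trans p (sym q)) (edge-distinct ed)

    view-left : ∀ {x y v e} → View x y v e → proj₁ e ≡ v → class e ≡ y
    view-left (ed , _ , inj₁ (_ , p)) q = contradiction (trans q (sym p)) (edge-distinct ed)
    view-left (_ , _ , inj₂ (c , _)) _ = c

    view-injective : ∀ {x y v e f} → View x y v e → View x y v f → pos v e ≡ pos v f → e ≡ f
    view-injective ve vf eq with pos-cases (edge-dart (proj₁ ve)) (edge-dart (proj₁ vf)) (view-end ve) (view-end vf) eq
    ... | inj₁ (p , p′ , _) = pos-injective (edge-dart (proj₁ ve)) (edge-dart (proj₁ vf)) (inj₂ p) (inj₂ p′)
            (trans (view-right ve p) (sym (view-right vf p′))) eq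
    ... | inj₂ (p , p′ , _) = pos-injective (edge-dart (proj₁ ve)) (edge-dart (proj₁ vf)) (inj₁ p) (inj₁ p′)
            (trans (view-left ve p) (sym (view-left vf p′))) eq

    not-first : ∀ {e} → class e ≢ zero → ¬ First e
    not-first nz f = nz (first-class f)

    rigid-high : ∀ {e} → Rigid e → ¬ First e → High (proj₁ e)
    rigid-high (inj₁ f) nf = contradiction f nf
    rigid-high (inj₂ hi) _ = hi

    tail-view : ∀ {e} → e ∈ rigid → View zero (suc zero) (tail e) e
    tail-view {e} e∈ with rigid-∈ e∈
    ... | (ed , _) , sm , rg with class e Finₚ.≟ zero
    ... | yes c = ed , proj₂ ed , inj₁ (c , refl)
    ... | no nz = ed , subst High (sym o) (rigid-high rg (not-first nz)) , inj₂ (small-nonzero sm nz , sym o)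
      where
      o : other e ≡ proj₁ e
      o = other-single (not-first nz)

    -- For a pair the head is the end of `e₂`, a dart of class one on the right. That `e₁` and `e₂`
    -- come from different classes is what fits the pair into the orientation.
    head-view : ∀ {e} → e ∈ rigid → View (suc zero) zero (head e) (partner e)
    head-view {e} e∈ with rigid-∈ e∈
    ... | (ed , _) , sm , rg with class e Finₚ.≟ zero
    ... | no nz rewrite partner-single (not-first nz) = ed , proj₂ ed , inj₁ (small-nonzero sm nz , refl)
    ... | yes c with first? e
    ... | yes (ac , _) = pick-edge (suc zero) ac , proj₂ (pick-edge (suc zero) ac) , inj₁ (pick-class (suc zero) ac , refl)
    ... | no nf = ed , rigid-high rg nf , inj₂ (c , refl)

    -- Splitting every vertex into an out-copy and an in-copy makes the oriented multigraph
    -- bipartite.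
    End₂ : Set
    End₂ = Bool × V

    code₂ : End₂ → Fin (2 * n G)
    code₂ (β , v) = combine (bit β) v

    code₂-injective : ∀ {x y} → code₂ x ≡ code₂ y → x ≡ y
    code₂-injective {β , v} {γ , w} eq with p , refl ← Finₚ.combine-injective (bit β) v (bit γ) w eq
      = cong (_, v) (bit-injective β γ p)

    position : End₂ → Dart → Fin q
    position (false , v) e = pos v e mod q
    position (true , v) e = pos v (partner e) mod q

    mod-injective : ∀ {x y} → x < q → y < q → x mod q ≡ y mod q → x ≡ y
    mod-injective {x} {y} x< y< eq = trans (sym (m<n⇒m%n≡m x<)) (trans (sym (Finₚ.toℕ-fromℕ< (m%n<n x q)))
      (trans (cong toℕ eq) (trans (Finₚ.toℕ-fromℕ< (m%n<n y q)) (m<n⇒m%n≡m y<))))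

    view-bound : ∀ {x y v e} → View x y v e → pos v e < q
    view-bound ve = pos-bound (proj₁ (proj₂ ve)) (edge-dart (proj₁ ve)) (view-end ve)

    distinguishes : Multigraph.König.Distinguishes (≡-dec Boolₚ._≟_ Finₚ._≟_) _≟D_ code₂ code₂-injective
      (λ e → false , tail e) (λ e → true , head e) {q} zero proj₁ position rigid
    distinguishes {e} {f} e∈ f∈ (inj₁ refl) (inj₁ p) eq
      with ve ← tail-view e∈ | vf ← subst (λ v → View zero (suc zero) v f) (cong proj₂ p) (tail-view f∈)
      = view-injective ve vf (mod-injective (view-bound ve) (view-bound vf) eq)
    distinguishes {e} {f} e∈ f∈ (inj₂ refl) (inj₂ p) eq
      with ve ← head-view e∈ | vf ← subst (λ v → View (suc zero) zero v (partner f)) (cong proj₂ p) (head-view f∈)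
      = trans (sym (item-partner (proj₂ (proj₁ (rigid-∈ e∈))))) (trans (cong item
          (view-injective ve vf (mod-injective (view-bound ve) (view-bound vf) eq)))
          (item-partner (proj₂ (proj₁ (rigid-∈ f∈)))))

    abstract
      indexing : Σ (Dart → Fin q) λ idx → ∀ {e f} → e ∈ rigid → f ∈ rigid → tail e ≡ tail f ⊎ head e ≡ head f → idx e ≡ idx f → e ≡ f
      indexing = proj₁ found , λ
          { e∈ f∈ (inj₁ p) → proj₂ found e∈ f∈ (inj₁ refl) (inj₁ (cong (false ,_) (sym p)))
          ; e∈ f∈ (inj₂ p) → proj₂ found e∈ f∈ (inj₂ refl) (inj₂ (cong (true ,_) (sym p))) }
        where
        found : Σ (Dart → Fin q) λ c → ∀ {e f} {v : End₂} → e ∈ rigid → f ∈ rigid →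
          (false , tail e) ≡ v ⊎ (true , head e) ≡ v → (false , tail f) ≡ v ⊎ (true , head f) ≡ v → c e ≡ c f → e ≡ f
        found = Multigraph.König.könig (≡-dec Boolₚ._≟_ Finₚ._≟_) _≟D_ code₂ code₂-injective
          (λ e → false , tail e) (λ e → true , head e) {q} zero proj₁ position rigid (λ _ → refl , refl) distinguishes

    idx : Dart → Fin q
    idx = proj₁ indexing

    idx-injective : ∀ {e f} → e ∈ rigid → f ∈ rigid → tail e ≡ tail f ⊎ head e ≡ head f → idx e ≡ idx f → e ≡ f
    idx-injective = proj₂ indexing

    -- An index class has in- and out-degrees at most one, so every item meets at most two others.
    module ThreeColours where
      Bad : Dart → Dart → Fin 3 → Fin 3 → Set
      Bad e f x y = idx e ≡ idx f × x ≡ y × (tail e ≡ head f ⊎ head e ≡ tail f)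

      Bad-sym : ∀ {e f x y} → Bad e f x y → Bad f e y x
      Bad-sym (p , q , inj₁ r) = sym p , sym q , inj₂ (sym r)
      Bad-sym (p , q , inj₂ r) = sym p , sym q , inj₁ (sym r)

      before? : ∀ e f → Dec (idx f ≡ idx e × head f ≡ tail e)
      before? e f = (idx f Finₚ.≟ idx e) ×-dec (head f Finₚ.≟ tail e)

      after? : ∀ e f → Dec (idx f ≡ idx e × tail f ≡ head e)
      after? e f = (idx f Finₚ.≟ idx e) ×-dec (tail f Finₚ.≟ head e)

      meeting : Dart → List Dart
      meeting e = filter (before? e) rigid ++ filter (after? e) rigid

      open Greedy _≟D_ Bad Bad-sym (λ e c → map c (meeting e))

      few : ∀ e (c : Dart → Fin 3) → length (map c (meeting e)) < 3
      few e c = s≤s (≤-trans (≤-reflexive (trans (length-map c (meeting e)) (length-++ (filter (before? e) rigid))))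
        (+-mono-≤
          (filter-length (before? e) rigid-unique (λ _ → 0) {m = 1} (λ _ _ → s≤s z≤n)
            λ f∈ (i , h) g∈ (i′ , h′) _ → idx-injective f∈ g∈ (inj₂ (trans h (sym h′))) (trans i (sym i′)))
          (filter-length (after? e) rigid-unique (λ _ → 0) {m = 1} (λ _ _ → s≤s z≤n)
            λ f∈ (i , h) g∈ (i′ , h′) _ → idx-injective f∈ g∈ (inj₁ (trans h (sym h′))) (trans i (sym i′)))))

      covers : ∀ {e f} → f ∈ rigid → ∀ c x → Bad e f x (c f) → x ∈ map c (meeting e)
      covers f∈ c x (i , refl , inj₁ r) = ∈-map⁺ c (∈-++⁺ˡ (∈-filter⁺ (before? _) f∈ (sym i , sym r)))
      covers f∈ c x (i , refl , inj₂ r) = ∈-map⁺ c (∈-++⁺ʳ (filter (before? _) rigid) (∈-filter⁺ (after? _) f∈ (sym i , sym r)))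

      abstract
        result : Σ (Dart → Fin 3) λ c → Good c (rigid ++ [])
        result = extend rigid [] (λ _ → zero) (λ ()) (λ {e} _ c → few e c)
          λ {e} {f} _ f∈ _ → covers ([ id , (λ ()) ]′ (∈-++⁻ rigid f∈))

      tri : Dart → Fin 3
      tri = proj₁ result

      tri-good : ∀ {e f} → e ∈ rigid → f ∈ rigid → e ≢ f → ¬ Bad e f (tri e) (tri f)
      tri-good e∈ f∈ = proj₂ result (∈-++⁺ˡ e∈) (∈-++⁺ˡ f∈)

    open ThreeColours using (tri; tri-good)

    rigidPair : Dart → Fin P
    rigidPair e = combine (idx e) (tri e) ↑ˡ S

    share-end : ∀ {e f v} → v ≡ proj₂ e ⊎ v ≡ other e → v ≡ proj₂ f ⊎ v ≡ other f →
      (tail e ≡ tail f ⊎ head e ≡ head f) ⊎ (tail e ≡ head f ⊎ head e ≡ tail f)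
    share-end {e} {f} p r with class e Finₚ.≟ zero | class f Finₚ.≟ zero
    share-end (inj₁ refl) (inj₁ r) | yes _ | yes _ = inj₁ (inj₁ r)
    share-end (inj₁ refl) (inj₂ r) | yes _ | yes _ = inj₂ (inj₁ r)
    share-end (inj₂ refl) (inj₁ r) | yes _ | yes _ = inj₂ (inj₂ r)
    share-end (inj₂ refl) (inj₂ r) | yes _ | yes _ = inj₁ (inj₂ r)
    share-end (inj₁ refl) (inj₁ r) | yes _ | no _ = inj₂ (inj₁ r)
    share-end (inj₁ refl) (inj₂ r) | yes _ | no _ = inj₁ (inj₁ r)
    share-end (inj₂ refl) (inj₁ r) | yes _ | no _ = inj₁ (inj₂ r)
    share-end (inj₂ refl) (inj₂ r) | yes _ | no _ = inj₂ (inj₂ r)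
    share-end (inj₁ refl) (inj₁ r) | no _ | yes _ = inj₂ (inj₂ r)
    share-end (inj₁ refl) (inj₂ r) | no _ | yes _ = inj₁ (inj₂ r)
    share-end (inj₂ refl) (inj₁ r) | no _ | yes _ = inj₁ (inj₁ r)
    share-end (inj₂ refl) (inj₂ r) | no _ | yes _ = inj₂ (inj₁ r)
    share-end (inj₁ refl) (inj₁ r) | no _ | no _ = inj₁ (inj₂ r)
    share-end (inj₁ refl) (inj₂ r) | no _ | no _ = inj₂ (inj₂ r)
    share-end (inj₂ refl) (inj₁ r) | no _ | no _ = inj₂ (inj₁ r)
    share-end (inj₂ refl) (inj₂ r) | no _ | no _ = inj₁ (inj₁ r)

    low-rigid : ∀ {e v} → e ∈ rigid → v ∈ touched e → Low v → Active v × e ≡ e₁ v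
    low-rigid e∈ v∈ lo with it , _ , rg ← rigid-∈ e∈ with refl ← low-touched (proj₁ it) v∈ lo with rg
    ... | inj₁ f = f
    ... | inj₂ hi = contradiction lo hi

    -- A low vertex touched by a rigid item is active: it has no low neighbours and belongs to no
    -- other rigid item. Hence the conflict is at a common high end.
    rigid-conflict : ∀ {e f} → e ∈ rigid → f ∈ rigid → Conflict e f → e ≢ f →
      (tail e ≡ tail f ⊎ head e ≡ head f) ⊎ (tail e ≡ head f ⊎ head e ≡ tail f)
    rigid-conflict {e} {f} e∈ f∈ (u , v , u∈ , near , v∈) e≢f with near-cases near
    ... | inj₂ (lo , lo′ , p) = contradiction lo′ (proj₂ (proj₁ (low-rigid e∈ u∈ lo)) v p)
    ... | inj₁ refl = go (low? u)
      where
      go : Dec (Low u) → (tail e ≡ tail f ⊎ head e ≡ head f) ⊎ (tail e ≡ head f ⊎ head e ≡ tail f)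
      go (yes lo) = contradiction (trans (proj₂ (low-rigid e∈ u∈ lo)) (sym (proj₂ (low-rigid f∈ v∈ lo)))) e≢f
      go (no hi) = share-end (high-end u∈ hi) (high-end v∈ hi)

    module Extension where
      Bad : Dart → Dart → Fin P → Fin P → Set
      Bad e f x y = Conflict e f × x ≡ y

      Bad-sym : ∀ {e f x y} → Bad e f x y → Bad f e y x
      Bad-sym (p , q) = conflict-sym p , sym q

      open Greedy _≟D_ {P} Bad Bad-sym (λ e c → map c (conflicting bItems e))

      rigid-good : Good rigidPair rigid
      rigid-good {e} {f} e∈ f∈ e≢f (conf , eq)
        with p , t ← Finₚ.combine-injective (idx e) (tri e) (idx f) (tri f) (Finₚ.↑ˡ-injective S _ _ eq)
        with rigid-conflict e∈ f∈ conf e≢f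
      ... | inj₁ s = e≢f (idx-injective e∈ f∈ s p)
      ... | inj₂ s = tri-good e∈ f∈ e≢f (p , t , s)

      -- The low left end counts twice, as `proj₁ e` and as `other e`, which explains `S`; the high
      -- end contributes `2 * q ≤ q * 3`.
      flexible-few : ∀ {e} → e ∈ flexible → ∀ (c : Dart → Fin P) → length (map c (conflicting bItems e)) < P
      flexible-few {e} e∈ c with e∈b , nr ← ∈-filter⁻ (¬? ∘ rigid?) {xs = bItems} e∈ = <-≤-trans (s≤s bound) fits
        where
        near-length : V → ℕ
        near-length v = length (near-touching bItems v)
        left-bound : Dec (Low (proj₁ e)) → near-length (proj₁ e) ≤ W * W
        left-bound (yes lo) = near-low-length bItems (low-touching bItems (proj₁ ∘ proj₁ ∘ bItems-∈) bItems-unique) lo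
        left-bound (no hi) = contradiction (inj₂ hi) nr
        right-bound : near-length (proj₂ e) ≤ 2 * q
        right-bound = let hi = proj₂ (proj₁ (proj₁ (bItems-∈ e∈b))) in
          ≤-trans (≤-reflexive (near-high-length bItems hi)) (high-touching hi)
        bound : length (map c (conflicting bItems e)) ≤ W * W + (2 * q + (W * W + 0))
        bound = ≤-trans (≤-reflexive (trans (length-map c (conflicting bItems e)) (conflicting-length bItems e)))
          (+-mono-≤ (left-bound (low? (proj₁ e))) (+-mono-≤ right-bound
            (+-monoˡ-≤ 0 (subst (λ v → near-length v ≤ W * W) (sym (other-single (nr ∘ inj₁))) (left-bound (low? (proj₁ e)))))))
        fits : suc (W * W + (2 * q + (W * W + 0))) ≤ P
        fits = ≤-trans (≤-reflexive rearrange) (+-monoˡ-≤ S (≤-trans (≤-reflexive (*-comm 2 q)) (*-monoʳ-≤ q (n≤1+n 2))))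
          where
          rearrange : suc (W * W + (2 * q + (W * W + 0))) ≡ 2 * q + S
          rearrange = trans (cong suc (trans (cong (λ z → W * W + (2 * q + z)) (+-identityʳ (W * W)))
            (trans (sym (+-assoc (W * W) (2 * q) (W * W))) (trans (cong (_+ W * W) (+-comm (W * W) (2 * q)))
              (+-assoc (2 * q) (W * W) (W * W)))))) (trans (sym (+-suc (2 * q) (W * W + W * W))) (cong (2 * q +_) (sym S≡)))

      listed⇒b : ∀ {e} → e ∈ flexible ++ rigid → e ∈ bItems
      listed⇒b e∈ with ∈-++⁻ flexible e∈
      ... | inj₁ p = proj₁ (∈-filter⁻ (¬? ∘ rigid?) {xs = bItems} p)
      ... | inj₂ p = proj₁ (∈-filter⁻ rigid? {xs = bItems} p)

      b⇒listed : ∀ {e} → e ∈ bItems → e ∈ flexible ++ rigid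
      b⇒listed {e} e∈ with rigid? e
      ... | yes r = ∈-++⁺ʳ flexible (∈-filter⁺ rigid? e∈ r)
      ... | no nr = ∈-++⁺ˡ (∈-filter⁺ (¬? ∘ rigid?) e∈ nr)

      abstract
        result : Σ (Dart → Fin P) λ c → Good c (flexible ++ rigid)
        result = extend flexible rigid rigidPair rigid-good flexible-few
          λ { _ f∈ _ c x (conf , refl) → ∈-map⁺ c (∈-conflicting bItems (listed⇒b f∈) conf) }

    pair : Dart → Fin P
    pair = proj₁ Extension.result

    pair-injective : ∀ {e f} → IsItem e → IsItem f → Small e → Small f → Conflict e f → pair e ≡ pair f → e ≡ f
    pair-injective {e} {f} ie if se sf conf eq with e ≟D f
    ... | yes p = p
    ... | no ne = ⊥-elim (proj₂ Extension.result (Extension.b⇒listed (∈-bItems ie se)) (Extension.b⇒listed (∈-bItems if sf)) ne (conf , eq))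

  -- Owned edges of high vertices and their labels

  module Owners where

    -- The number of classes is `suc D = w`. The elements are items with ends `proj₂` and `other`,
    -- so that the two edges of a pair have the same owner.
    module O = Equitable {n = n G} _≟D_ (suc D-1) items items-unique proj₂ other

    asRight asOther : V → ℕ
    asRight v = O.L.count items v
    asOther v = O.R.count items v

    right? : ∀ (v : V) (e : Dart) → Dec (proj₂ e ≡ v)
    right? v e = proj₂ e Finₚ.≟ v

    other? : ∀ (v : V) (e : Dart) → Dec (other e ≡ v)
    other? v e = other e Finₚ.≟ v

    many-items : ∀ {v} → High v → W ≤ asRight v + asOther v
    many-items {v} hi = ≤-trans (high-many hi)
      (≤-trans (injection-length (neighbours-unique v) (λ u → item (canon v u)) inj into)
        (≤-reflexive (length-++ (filter (right? v) items))))
      where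
      inj : ∀ {u u′} → u ∈ neighbours v → u′ ∈ neighbours v → item (canon v u) ≡ item (canon v u′) → u ≡ u′
      inj {u} {u′} _ _ eq = canon-injective (trans (sym (dartAt-item hi (canon-end v u)))
        (trans (cong (dartAt v) eq) (dartAt-item hi (canon-end v u′))))
      into : ∀ {u} → u ∈ neighbours v → item (canon v u) ∈ filter (right? v) items ++ filter (other? v) items
      into {u} u∈ = place (high-end (end-touched (canon-end v u)) hi)
        where
        e∈ : item (canon v u) ∈ items
        e∈ = ∈-items (item-is-item (canon-edge (neighbours-∈ u∈) (hi ∘ proj₁)))
        place : v ≡ proj₂ (item (canon v u)) ⊎ v ≡ other (item (canon v u)) →
          item (canon v u) ∈ filter (right? v) items ++ filter (other? v) items
        place (inj₁ p) = ∈-++⁺ˡ (∈-filter⁺ (right? v) e∈ (sym p))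
        place (inj₂ p) = ∈-++⁺ʳ (filter (right? v) items) (∈-filter⁺ (other? v) e∈ (sym p))

    asRight-few : ∀ v → asRight v ≤ Δ + Δ
    asRight-few v = ≤-trans (injection-length (Uniqueₚ.filter⁺ (right? v) items-unique) proj₁ inj into)
        (≤-trans (neighbours-few v) (m≤m+n Δ Δ))
      where
      inj : ∀ {e f} → e ∈ filter (right? v) items → f ∈ filter (right? v) items → proj₁ e ≡ proj₁ f → e ≡ f
      inj e∈ f∈ eq with _ , p ← ∈-filter⁻ (right? v) {xs = items} e∈ | _ , p′ ← ∈-filter⁻ (right? v) {xs = items} f∈
        = cong₂ _,_ eq (trans p (sym p′))
      into : ∀ {e} → e ∈ filter (right? v) items → proj₁ e ∈ neighbours v
      into e∈ with e∈′ , refl ← ∈-filter⁻ (right? v) {xs = items} e∈ = ∈-neighbours (adj-comm (edge-adj (proj₁ (items-∈ e∈′))))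

    -- If `v` is the second end of an item, the item is either a dart leaving `v` or the `e₁` of a
    -- neighbour of `v`.
    asOther-few : ∀ v → asOther v ≤ Δ + Δ
    asOther-few v = ≤-trans (injection-length (Uniqueₚ.filter⁺ (other? v) items-unique) id (λ _ _ → id) into)
        (≤-trans (≤-reflexive (trans (length-++ (map (v ,_) (neighbours v)))
          (cong₂ _+_ (length-map (v ,_) (neighbours v)) (length-map e₁ (neighbours v)))))
          (+-mono-≤ (neighbours-few v) (neighbours-few v)))
      where
      cover : List Dart
      cover = map (v ,_) (neighbours v) ++ map e₁ (neighbours v)
      into : ∀ {e} → e ∈ filter (other? v) items → e ∈ cover
      into {e} e∈ with e∈′ , p ← ∈-filter⁻ (other? v) {xs = items} e∈ = go (first? e)
        where
        go : Dec (First e) → e ∈ cover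
        go (yes f@(ac , q)) = ∈-++⁺ʳ (map (v ,_) (neighbours v)) (subst (_∈ map e₁ (neighbours v)) (sym q)
          (∈-map⁺ e₁ (∈-neighbours (adj-comm (subst (Adj G (proj₁ e)) (trans (sym (other-first f)) p)
            (subst (λ x → Adj G x (proj₂ (e₂ (proj₁ e)))) (pick-left (suc zero) ac) (edge-adj (pick-edge (suc zero) ac))))))))
        go (no nf) with refl ← trans (sym (other-single nf)) p = ∈-++⁺ˡ (∈-map⁺ (proj₁ e ,_)
          (∈-neighbours (edge-adj (proj₁ (items-∈ e∈′)))))

    -- One of the two sides of a high vertex carries `4 * w` items, that is, four full blocks.
    -- Vertices of the first kind own items of class zero, those of the second kind items of class
    -- one; so no item is claimed from both of its ends.
    Out In : V → Set
    Out v = High v × 4 * w ≤ asRight v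
    In v = High v × ¬ 4 * w ≤ asRight v

    in-many : ∀ {v} → In v → 4 * w ≤ asOther v
    in-many {v} (hi , few) = +-cancelˡ-≤ (4 * w) (4 * w) (asOther v) (≤-trans
      (≤-trans (≤-reflexive (trans (sym (*-distribʳ-+ w 4 4)) (sym W≡))) (many-items hi)) (+-monoˡ-≤ (asOther v) (<⇒≤ (≰⇒> few))))

    OutOwned InOwned : Dart → Set
    OutOwned e = O.class e ≡ zero × Out (proj₂ e) × O.block-l e < 4
    InOwned e = O.class e ≡ suc zero × In (other e) × O.block-r e < 4

    abstract
      outOwned? : ∀ e → Dec (OutOwned e)
      outOwned? e = (O.class e Finₚ.≟ zero) ×-dec ((¬? (low? (proj₂ e)) ×-dec (4 * w ≤? asRight (proj₂ e))) ×-dec (O.block-l e <? 4))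

      inOwned? : ∀ e → Dec (InOwned e)
      inOwned? e = (O.class e Finₚ.≟ suc zero) ×-dec ((¬? (low? (other e)) ×-dec ¬? (4 * w ≤? asRight (other e))) ×-dec (O.block-r e <? 4))

    -- The owner of an item, with the group and the rank of the item among the owner's items of that group.
    owner : Dart → Maybe (V × Bool × Bool)
    owner e with outOwned? e | inOwned? e
    ... | yes _ | _ = just (proj₂ e , decodeSlot (O.block-l e))
    ... | no _ | yes _ = just (other e , decodeSlot (O.block-r e))
    ... | no _ | no _ = nothing

    owner-cases : ∀ {e v s} → owner e ≡ just (v , s) →
      (OutOwned e × proj₂ e ≡ v × O.block-l e ≡ encodeSlot s) ⊎ (InOwned e × other e ≡ v × O.block-r e ≡ encodeSlot s)
    owner-cases {e} eq with outOwned? e | inOwned? e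
    owner-cases refl | yes o@(_ , _ , lt) | _ = inj₁ (o , refl , sym (encode-decode lt))
    owner-cases refl | no _ | yes o@(_ , _ , lt) = inj₂ (o , refl , sym (encode-decode lt))

    owner-end : ∀ {e v s} → owner e ≡ just (v , s) → proj₂ e ≡ v ⊎ other e ≡ v
    owner-end eq with owner-cases eq
    ... | inj₁ (_ , p , _) = inj₁ p
    ... | inj₂ (_ , p , _) = inj₂ p

    owner-high : ∀ {e v s} → owner e ≡ just (v , s) → High v
    owner-high eq with owner-cases eq
    ... | inj₁ ((_ , (hi , _) , _) , refl , _) = hi
    ... | inj₂ ((_ , (hi , _) , _) , refl , _) = hi

    owner-class : ∀ {e v s} → owner e ≡ just (v , s) → toℕ (O.class e) < 2
    owner-class {e} eq with owner-cases eq
    ... | inj₁ ((p , _) , _) = subst (λ x → toℕ x < 2) (sym p) (s≤s z≤n)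
    ... | inj₂ ((p , _) , _) = subst (λ x → toℕ x < 2) (sym p) (s≤s (s≤s z≤n))

    owner-unique : ∀ {e f v s} → IsItem e → IsItem f → owner e ≡ just (v , s) → owner f ≡ just (v , s) → e ≡ f
    owner-unique ie if oe of with owner-cases oe | owner-cases of
    ... | inj₁ ((c , _) , p , b) | inj₁ ((c′ , _) , p′ , b′) =
      O.class-l (∈-items ie) (∈-items if) (trans p (sym p′)) (trans c (sym c′)) (trans b (sym b′))
    ... | inj₂ ((c , _) , p , b) | inj₂ ((c′ , _) , p′ , b′) =
      O.class-r (∈-items ie) (∈-items if) (trans p (sym p′)) (trans c (sym c′)) (trans b (sym b′))
    ... | inj₁ ((_ , (_ , many) , _) , refl , _) | inj₂ ((_ , (_ , few) , _) , p , _) =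
      contradiction (subst (λ v → 4 * w ≤ asRight v) (sym p) many) few
    ... | inj₂ ((_ , (_ , few) , _) , p , _) | inj₁ ((_ , (_ , many) , _) , refl , _) =
      contradiction (subst (λ v → 4 * w ≤ asRight v) (sym p) many) few

    owner-out : ∀ {e s} → OutOwned e → O.block-l e ≡ encodeSlot s → owner e ≡ just (proj₂ e , s)
    owner-out {e} {s} o b with outOwned? e | inOwned? e
    ... | yes _ | _ = cong (λ j → just (proj₂ e , j)) (trans (cong decodeSlot b) (decode-encode s))
    ... | no no-out | _ = contradiction o no-out

    owner-in : ∀ {e s} → InOwned e → O.block-r e ≡ encodeSlot s → owner e ≡ just (other e , s)
    owner-in {e} {s} o b with outOwned? e | inOwned? e
    ... | yes (c , _) | _ = contradiction (trans (sym c) (proj₁ o)) λ ()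
    ... | no _ | yes _ = cong (λ j → just (other e , j)) (trans (cong decodeSlot b) (decode-encode s))
    ... | no _ | no no-in = contradiction o no-in

    owner-exists : ∀ {v} → High v → ∀ s → ∃ λ e → IsItem e × owner e ≡ just (v , s)
    owner-exists {v} hi s = go (4 * w ≤? asRight v)
      where
      out : 4 * w ≤ asRight v → (∃ λ e → e ∈ items × proj₂ e ≡ v × O.class e ≡ zero × O.block-l e ≡ encodeSlot s) →
        ∃ λ e → IsItem e × owner e ≡ just (v , s)
      out many (e , e∈ , refl , c , b) = e , items-∈ e∈ , owner-out (c , (hi , many) , subst (_< 4) (sym b) (encode<4 s)) b
      into : ¬ 4 * w ≤ asRight v → (∃ λ e → e ∈ items × other e ≡ v × O.class e ≡ suc zero × O.block-r e ≡ encodeSlot s) →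
        ∃ λ e → IsItem e × owner e ≡ just (v , s)
      into few (e , e∈ , refl , c , b) = e , items-∈ e∈ , owner-in (c , (hi , few) , subst (_< 4) (sym b) (encode<4 s)) b
      go : Dec (4 * w ≤ asRight v) → ∃ λ e → IsItem e × owner e ≡ just (v , s)
      go (yes many) = out many (O.full-block-l (encodeSlot s) (≤-trans (*-monoˡ-≤ w (encode<4 s)) many) zero)
      go (no few) = into few (O.full-block-r (encodeSlot s) (≤-trans (*-monoˡ-≤ w (encode<4 s)) (in-many (hi , few))) (suc zero))

    -- All items of the two classes in which ownership takes place. They contain the owned items and
    -- still have degree of order `Δ / w` at high vertices.
    Shared : Dart → Set
    Shared e = toℕ (O.class e) < 2

    abstract
      shared? : ∀ e → Dec (Shared e)
      shared? e = toℕ (O.class e) <? 2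

    shared : List Dart
    shared = filter shared? items

    shared-unique : Unique shared
    shared-unique = Uniqueₚ.filter⁺ shared? items-unique

    shared-∈ : ∀ {e} → e ∈ shared → e ∈ items × Shared e
    shared-∈ = ∈-filter⁻ shared? {xs = items}

    high-touching : ∀ {v} → High v → length (touching shared v) ≤ 2 * T
    high-touching {v} hi = filter-length (touches? v) shared-unique
        (λ e → O.slot (suc M) v e + toℕ (O.class e) * T)
        (λ e∈ v∈ → radix-bound (bound e∈ v∈) (proj₂ (shared-∈ e∈)))
        (λ e∈ v∈ f∈ v∈′ eq → let ceq , peq = radix-injective T (bound e∈ v∈) (bound f∈ v∈′) eq in
          same (proj₁ (shared-∈ e∈)) (proj₁ (shared-∈ f∈)) (Finₚ.toℕ-injective ceq)
            (O.slot-injective right-bound (proj₁ (shared-∈ e∈)) (proj₁ (shared-∈ f∈)) (end v∈) (end v∈′) peq))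
      where
      right-bound : asOther v / w < suc M
      right-bound = s≤s (≤-trans (/-monoˡ-≤ w (asOther-few v)) (≤-reflexive (sym M≡)))
      end : ∀ {e} → v ∈ touched e → proj₂ e ≡ v ⊎ other e ≡ v
      end v∈ with high-end v∈ hi
      ... | inj₁ p = inj₁ (sym p)
      ... | inj₂ p = inj₂ (sym p)
      bound : ∀ {e} → e ∈ shared → v ∈ touched e → O.slot (suc M) v e < T
      bound e∈ v∈ = O.slot-bound right-bound (+-monoʳ-< (suc M) (s≤s (≤-trans (/-monoˡ-≤ w (asRight-few v)) (≤-reflexive (sym M≡))))) (proj₁ (shared-∈ e∈)) (end v∈)
      same : ∀ {e f} → e ∈ items → f ∈ items → O.class e ≡ O.class f →
        (other e ≡ v × other f ≡ v × O.block-r e ≡ O.block-r f) ⊎ (proj₂ e ≡ v × proj₂ f ≡ v × O.block-l e ≡ O.block-l f) → e ≡ f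
      same e∈ f∈ c (inj₁ (p , p′ , b)) = O.class-r e∈ f∈ (trans p (sym p′)) c b
      same e∈ f∈ c (inj₂ (p , p′ , b)) = O.class-l e∈ f∈ (trans p (sym p′)) c b

    conflicting-few : ∀ e → length (conflicting shared e) ≤ N
    conflicting-few e = ≤-trans (≤-reflexive (conflicting-length shared e))
        (+-mono-≤ (bound (proj₁ e)) (+-mono-≤ (bound (proj₂ e)) (+-monoˡ-≤ 0 (bound (other e)))))
      where
      bound : ∀ v → length (near-touching shared v) ≤ C
      bound v = go (low? v)
        where
        go : Dec (Low v) → length (near-touching shared v) ≤ C
        go (yes lo) = ≤-trans (near-low-length shared (low-touching shared (proj₁ ∘ items-∈ ∘ proj₁ ∘ shared-∈) shared-unique) lo)
          (≤-trans (m≤m+n (W * W) (2 * T)) (≤-reflexive (sym C≡)))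
        go (no hi) = ≤-trans (≤-trans (≤-reflexive (near-high-length shared hi)) (high-touching hi)) (≤-trans (m≤n+m (2 * T) (W * W)) (≤-reflexive (sym C≡)))

    abstract
      ownedBy? : ∀ v s e → Dec (owner e ≡ just (v , s))
      ownedBy? v s e = Maybeₚ.≡-dec (≡-dec Finₚ._≟_ (≡-dec Boolₚ._≟_ Boolₚ._≟_)) (owner e) (just (v , s))

    ownedBy : V → Bool × Bool → List Dart
    ownedBy v s = filter (ownedBy? v s) items

    ownedBy-few : ∀ v s → length (ownedBy v s) ≤ 1
    ownedBy-few v s = filter-length (ownedBy? v s) items-unique (λ _ → 0) {m = 1} (λ _ _ → s≤s z≤n)
      λ e∈ oe f∈ of _ → owner-unique (items-∈ e∈) (items-∈ f∈) oe of

    owners : Dart → List V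
    owners e with owner e
    ... | just (v , _) = v ∷ []
    ... | nothing = []

    owners-few : ∀ e → length (owners e) ≤ 1
    owners-few e with owner e
    ... | just _ = ≤-refl
    ... | nothing = z≤n

    ∈-owners : ∀ {e v s} → owner e ≡ just (v , s) → v ∈ owners e
    ∈-owners {e} eq with owner e
    ∈-owners refl | just _ = here refl

    group : Bool → V → List Dart
    group g v = ownedBy v (g , false) ++ ownedBy v (g , true)

    rivals : Bool → V → List V
    rivals g v = concatMap owners (concatMap (conflicting shared) (group g v))

    rivals-few : ∀ g v → length (rivals g v) ≤ 2 * N
    rivals-few g v = ≤-trans (concatMap-length owners (concatMap (conflicting shared) (group g v)) {1} (λ {e} _ → owners-few e))
      (≤-trans (≤-reflexive (*-identityʳ _))
        (≤-trans (concatMap-length (conflicting shared) (group g v) (λ {e} _ → conflicting-few e))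
          (*-monoˡ-≤ N (≤-trans (≤-reflexive (length-++ (ownedBy v (g , false))))
            (+-mono-≤ (ownedBy-few v (g , false)) (ownedBy-few v (g , true)))))))

    Rival : Bool → V → V → Set
    Rival g v v′ = ∃₂ λ e f → IsItem e × IsItem f × (∃ λ s → owner e ≡ just (v , g , s)) × (∃ λ s → owner f ≡ just (v′ , g , s)) × Conflict e f

    rival-sym : ∀ {g v v′} → Rival g v v′ → Rival g v′ v
    rival-sym (e , f , ie , if , oe , of , conf) = f , e , if , ie , of , oe , conflict-sym conf

    ∈-rivals : ∀ {g v v′} → Rival g v v′ → v′ ∈ rivals g v
    ∈-rivals {g} {v} (e , f , ie , if , (s , oe) , (s′ , of) , conf) = ∈-concatMap owners
        (∈-concatMap (conflicting shared) (e∈ s oe)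
          (∈-conflicting shared (∈-filter⁺ shared? (∈-items if) (owner-class of)) conf)) (∈-owners of)
      where
      e∈ : ∀ s → owner e ≡ just (v , g , s) → e ∈ group g v
      e∈ false o = ∈-++⁺ˡ (∈-filter⁺ (ownedBy? v (g , false)) (∈-items ie) o)
      e∈ true o = ∈-++⁺ʳ (ownedBy v (g , false)) (∈-filter⁺ (ownedBy? v (g , true)) (∈-items ie) o)

    E<q₂ : E < q₂
    E<q₂ = ≤-trans (m≤n+m (suc E) (2 * N + 2 * N)) (≤-reflexive (sym q₂≡))

    -- Both labels of a vertex are chosen at once as one code: a neighbour forbids its whole code, a
    -- rival all codes sharing one digit with its own.
    digit : Bool → Fin (q₂ * q₂) → Fin q₂
    digit false x = proj₁ (remQuot {q₂} q₂ x)
    digit true x = proj₂ (remQuot {q₂} q₂ x)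

    digits-injective : ∀ {x y} → digit false x ≡ digit false y → digit true x ≡ digit true y → x ≡ y
    digits-injective {x} {y} p p′ = trans (sym (Finₚ.combine-remQuot {q₂} q₂ x)) (trans (cong₂ combine p p′) (Finₚ.combine-remQuot {q₂} q₂ y))

    withDigit : Bool → Fin q₂ → List (Fin (q₂ * q₂))
    withDigit false i = map (combine i) (allFin q₂)
    withDigit true i = map (λ j → combine j i) (allFin q₂)

    withDigit-length : ∀ g i → length (withDigit g i) ≡ q₂
    withDigit-length false i = trans (length-map (combine i) (allFin q₂)) (length-tabulate {n = q₂} id)
    withDigit-length true i = trans (length-map (λ j → combine j i) (allFin q₂)) (length-tabulate {n = q₂} id)

    ∈-withDigit : ∀ g x → x ∈ withDigit g (digit g x)
    ∈-withDigit false x = subst (_∈ withDigit false (digit false x)) (Finₚ.combine-remQuot {q₂} q₂ x)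
      (∈-map⁺ (combine (digit false x)) (∈-allFin (digit true x)))
    ∈-withDigit true x = subst (_∈ withDigit true (digit true x)) (Finₚ.combine-remQuot {q₂} q₂ x)
      (∈-map⁺ (λ j → combine j (digit true x)) (∈-allFin (digit false x)))

    module Codes where
      Bad : V → V → Fin (q₂ * q₂) → Fin (q₂ * q₂) → Set
      Bad v v′ x y = (Adj G v v′ × x ≡ y) ⊎ (∃ λ g → Rival g v v′ × digit g x ≡ digit g y)

      Bad-sym : ∀ {v v′ x y} → Bad v v′ x y → Bad v′ v y x
      Bad-sym (inj₁ (p , r)) = inj₁ (adj-comm p , sym r)
      Bad-sym (inj₂ (g , p , r)) = inj₂ (g , rival-sym p , sym r)

      blocked : Bool → V → (V → Fin (q₂ * q₂)) → List (Fin (q₂ * q₂))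
      blocked g v c = concatMap (withDigit g ∘ digit g ∘ c) (rivals g v)

      blocked-length : ∀ g v c → length (blocked g v c) ≤ 2 * N * q₂
      blocked-length g v c = ≤-trans (concatMap-length (withDigit g ∘ digit g ∘ c) (rivals g v)
        (λ {u} _ → ≤-reflexive (withDigit-length g (digit g (c u))))) (*-monoˡ-≤ q₂ (rivals-few g v))

      forbidden : V → (V → Fin (q₂ * q₂)) → List (Fin (q₂ * q₂))
      forbidden v c = map c (neighbours v) ++ (blocked false v c ++ blocked true v c)

      -- Rivals forbid at most `2 * N * q₂` codes for each group and neighbours at most `Δ`. The
      -- choice of `q₂` leaves `suc E * q₂` codes beyond the former, more than `E * E` and hence
      -- more than `Δ`.
      few : ∀ v c → length (forbidden v c) < q₂ * q₂
      few v c = ≤-<-trans (≤-trans (≤-reflexive (trans (length-++ (map c (neighbours v)))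
          (cong₂ _+_ (length-map c (neighbours v)) (length-++ (blocked false v c)))))
          (+-mono-≤ (neighbours-few v) (+-mono-≤ (blocked-length false v c) (blocked-length true v c))))
        (subst (Δ + (2 * N * q₂ + 2 * N * q₂) <_) (sym expand) (subst (Δ + (2 * N * q₂ + 2 * N * q₂) <_)
          (+-comm (suc E * q₂) _) (+-monoˡ-< (2 * N * q₂ + 2 * N * q₂) small)))
        where
        expand : q₂ * q₂ ≡ (2 * N * q₂ + 2 * N * q₂) + suc E * q₂
        expand = trans (cong (_* q₂) q₂≡) (trans (*-distribʳ-+ q₂ (2 * N + 2 * N) (suc E))
          (cong (_+ suc E * q₂) (*-distribʳ-+ q₂ (2 * N) (2 * N))))
        small : Δ < suc E * q₂
        small = ≤-<-trans (Δ≤E² cube) (<-≤-trans (*-mono-< (n<1+n E) (n<1+n E)) (*-monoʳ-≤ (suc E) E<q₂))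

      covers : ∀ {v v′} → ∀ c x → Bad v v′ x (c v′) → x ∈ forbidden v c
      covers {v} c x (inj₁ (p , refl)) = ∈-++⁺ˡ (∈-map⁺ c (∈-neighbours p))
      covers {v} {v′} c x (inj₂ (g , p , r)) = ∈-++⁺ʳ (map c (neighbours v)) (place g
          (∈-concatMap (withDigit g ∘ digit g ∘ c) (∈-rivals p) (subst (λ i → x ∈ withDigit g i) r (∈-withDigit g x))))
        where
        place : ∀ g → x ∈ blocked g v c → x ∈ blocked false v c ++ blocked true v c
        place false = ∈-++⁺ˡ
        place true = ∈-++⁺ʳ (blocked false v c)

      open Greedy Finₚ._≟_ Bad Bad-sym forbidden

      abstract
        result : Σ (V → Fin (q₂ * q₂)) λ c → Good c (allFin (n G) ++ [])
        result = extend (allFin (n G)) [] (λ _ → combine default default) (λ ()) (λ {v} _ c → few v c) (λ _ _ _ → covers)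
          where
          default : Fin q₂
          default = fromℕ< (≤-trans (s≤s z≤n) E<q₂)

    label : Bool → V → Fin q₂
    label g v = digit g (proj₁ Codes.result v)

    codes-good : ∀ {v v′} → v ≢ v′ → ¬ Codes.Bad v v′ (proj₁ Codes.result v) (proj₁ Codes.result v′)
    codes-good {v} {v′} = proj₂ Codes.result (∈-++⁺ˡ (∈-allFin v)) (∈-++⁺ˡ (∈-allFin v′))

    label-rival : ∀ {g v v′} → Rival g v v′ → label g v ≡ label g v′ → v ≡ v′
    label-rival {g} {v} {v′} r eq with v Finₚ.≟ v′
    ... | yes p = p
    ... | no ne = ⊥-elim (codes-good ne (inj₂ (g , r , eq)))

    label-adjacent : ∀ {v v′} → Adj G v v′ → ∃ λ g → label g v ≢ label g v′
    label-adjacent {v} {v′} p with label false v Finₚ.≟ label false v′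
    ... | no ne = false , ne
    ... | yes eq = true , λ eq′ → codes-good (adj-distinct p) (inj₁ (p , digits-injective eq eq′))

  -- Plain edges, edges between low vertices, and the final colours

  module Colours where

    open Pairs using (pos; pos-bound; pos-injective; Small; small?; pick-small; pair; pair-injective)
    open Owners using (owner; owner-end; owner-high; owner-unique; owner-exists; label; label-rival; label-adjacent)

    IsPlain : Dart → Set
    IsPlain e = IsEdge e × ¬ Small e

    abstract
      isPlain? : ∀ e → Dec (IsPlain e)
      isPlain? e = isEdge? e ×-dec ¬? (small? e)

    plainEdges : List Dart
    plainEdges = filter isPlain? allDarts

    plainEdges-unique : Unique plainEdges
    plainEdges-unique = Uniqueₚ.filter⁺ isPlain? allDarts-unique

    plainEdges-∈ : ∀ {e} → e ∈ plainEdges → IsPlain e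
    plainEdges-∈ e∈ = proj₂ (∈-filter⁻ isPlain? {xs = allDarts} e∈)

    abstract
      end? : ∀ d v → Dec (End d v)
      end? d v = (proj₁ d Finₚ.≟ v) ⊎-dec (proj₂ d Finₚ.≟ v)

    Joins : Dart → V → V → Set
    Joins d u v = (proj₁ d ≡ u × proj₂ d ≡ v) ⊎ (proj₁ d ≡ v × proj₂ d ≡ u)

    cover : V → List Dart
    cover v = filter (λ e → end? e v) plainEdges

    cover-small : ∀ v → length (cover v) ≤ ΔA
    cover-small v = go (low? v)
      where
      low : Low v → length (cover v) ≤ W
      low lo = ≤-trans (injection-length (Uniqueₚ.filter⁺ (λ e → end? e v) plainEdges-unique) proj₂
          (λ e∈ f∈ → cong₂ _,_ (trans (left e∈) (sym (left f∈))))
          (λ {e} e∈ → ∈-neighbours (subst (λ x → Adj G x (proj₂ e)) (left e∈) (edge-adj (edge e∈)))))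
          (<⇒≤ (low-few lo))
        where
        edge : ∀ {e} → e ∈ cover v → IsEdge e
        edge e∈ = proj₁ (plainEdges-∈ (proj₁ (∈-filter⁻ (λ e → end? e v) {xs = plainEdges} e∈)))
        left : ∀ {e} → e ∈ cover v → proj₁ e ≡ v
        left {e} e∈ with proj₂ (∈-filter⁻ (λ e → end? e v) {xs = plainEdges} e∈)
        ... | inj₁ p = p
        ... | inj₂ p = contradiction lo (subst High p (proj₂ (edge e∈)))
      high : High v → length (cover v) ≤ δ-2 * q
      high hi = filter-length (λ e → end? e v) plainEdges-unique (λ e → pos v e + (toℕ (class e) ∸ 2) * q)
          (λ {e} e∈ i → radix-bound (bound e∈ i) (+-cancelˡ-< 2 _ _ (subst (_< δ) (sym (m+[n∸m]≡n (big e∈))) (Finₚ.toℕ<n (class e)))))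
          λ e∈ i f∈ i′ eq → let ceq , peq = radix-injective q (bound e∈ i) (bound f∈ i′) eq in
            pos-injective (dart e∈) (dart f∈) i i′ (Finₚ.toℕ-injective (trans (sym (m+[n∸m]≡n (big e∈)))
              (trans (cong (2 +_) ceq) (m+[n∸m]≡n (big f∈))))) peq
        where
        dart : ∀ {e} → e ∈ plainEdges → e ∈ darts
        dart e∈ = edge-dart (proj₁ (plainEdges-∈ e∈))
        big : ∀ {e} → e ∈ plainEdges → 2 ≤ toℕ (class e)
        big e∈ = ≮⇒≥ (proj₂ (plainEdges-∈ e∈))
        bound : ∀ {e} → e ∈ plainEdges → End e v → pos v e < q
        bound e∈ i = pos-bound hi (dart e∈) i
      go : Dec (Low v) → length (cover v) ≤ ΔA
      go (yes lo) = ≤-trans (low lo) (≤-trans (m≤n+m W (δ-2 * q)) (≤-reflexive (sym ΔA≡)))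
      go (no hi) = ≤-trans (high hi) (≤-trans (m≤m+n (δ-2 * q) W) (≤-reflexive (sym ΔA≡)))

    edges-simple : ∀ {e f v w} → IsEdge e → IsEdge f → Joins e v w → Joins f v w → e ≡ f
    edges-simple _ _ (inj₁ (refl , refl)) (inj₁ (refl , refl)) = refl
    edges-simple ie if (inj₁ (refl , refl)) (inj₂ (refl , refl)) = contradiction if (edge-asym ie)
    edges-simple ie if (inj₂ (refl , refl)) (inj₁ (refl , refl)) = contradiction if (edge-asym ie)
    edges-simple _ _ (inj₂ (refl , refl)) (inj₂ (refl , refl)) = refl

    abstract
      plainColouring : Σ (Dart → Fin kA) λ c → ∀ {e f v} → IsPlain e → IsPlain f → End e v → End f v → c e ≡ c f → e ≡ f
      plainColouring = proj₁ found , λ {e} {f} pe pf →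
          proj₂ found (∈-filter⁺ isPlain? (∈-allDarts e) pe) (∈-filter⁺ isPlain? (∈-allDarts f) pf)
        where
        found : Σ (Dart → Fin kA) λ c → ∀ {e f v} → e ∈ plainEdges → f ∈ plainEdges → End e v → End f v → c e ≡ c f → e ≡ f
        found = Multigraph.Vizing.vizing Finₚ._≟_ _≟D_ id id proj₁ proj₂ {ΔA} {r} {kA}
          (fromℕ< {0} (≤-trans (s≤s z≤n) (≤-trans (m≤n+m (suc r) ΔA) (≤-reflexive (sym kA≡)))))
          cover cover-small (≤-reflexive (sym kA≡)) (slack cube) plainEdges
          (λ e∈ → edge-distinct (proj₁ (plainEdges-∈ e∈)))
          (λ e∈ f∈ → edges-simple (proj₁ (plainEdges-∈ e∈)) (proj₁ (plainEdges-∈ f∈)))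
          (λ e∈ i → ∈-filter⁺ (λ e → end? e _) e∈ i)

    plain : Dart → Fin kA
    plain = proj₁ plainColouring

    plain-injective : ∀ {e f v} → IsPlain e → IsPlain f → End e v → End f v → plain e ≡ plain f → e ≡ f
    plain-injective = proj₂ plainColouring

    IsLow : Dart → Set
    IsLow e = Adj G (proj₁ e) (proj₂ e) × Low (proj₁ e) × Low (proj₂ e) × proj₁ e Fin.< proj₂ e

    abstract
      isLow? : ∀ e → Dec (IsLow e)
      isLow? e = adj? (proj₁ e) (proj₂ e) ×-dec (low? (proj₁ e) ×-dec (low? (proj₂ e) ×-dec (proj₁ e Finₚ.<? proj₂ e)))

    lowEdges : List Dart
    lowEdges = filter isLow? allDarts

    lowEdges-∈ : ∀ {e} → e ∈ lowEdges → IsLow e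
    lowEdges-∈ e∈ = proj₂ (∈-filter⁻ isLow? {xs = allDarts} e∈)

    low-other : ∀ {e} → IsLow e → other e ≡ proj₁ e
    low-other {e} (p , _ , lo , _) = other-single λ { ((_ , hi) , _) → hi (proj₂ e) p lo }

    low-end : ∀ {e v} → IsLow e → v ∈ touched e → End e v
    low-end _ (here p) = inj₁ (sym p)
    low-end _ (there (here p)) = inj₂ (sym p)
    low-end is (there (there (here p))) = inj₁ (sym (trans p (low-other is)))

    lowEdges-touching : ∀ v → Low v → length (touching lowEdges v) ≤ W + W
    lowEdges-touching v lo = ≤-trans (injection-length
        (Uniqueₚ.filter⁺ (touches? v) (Uniqueₚ.filter⁺ isLow? allDarts-unique)) id (λ _ _ → id) into)
        (≤-trans (≤-reflexive (trans (length-++ (map (v ,_) (neighbours v)))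
          (cong₂ _+_ (length-map (v ,_) (neighbours v)) (length-map (_, v) (neighbours v)))))
          (+-mono-≤ (<⇒≤ (low-few lo)) (<⇒≤ (low-few lo))))
      where
      into : ∀ {e} → e ∈ touching lowEdges v → e ∈ map (v ,_) (neighbours v) ++ map (_, v) (neighbours v)
      into {e} e∈ with e∈′ , v∈ ← ∈-filter⁻ (touches? v) {xs = lowEdges} e∈
        with is ← lowEdges-∈ e∈′ with low-end is v∈
      ... | inj₁ refl = ∈-++⁺ˡ (∈-map⁺ (v ,_) (∈-neighbours (proj₁ is)))
      ... | inj₂ refl = ∈-++⁺ʳ (map (v ,_) (neighbours v)) (∈-map⁺ (_, v) (∈-neighbours (adj-comm (proj₁ is))))

    module LowColouring where
      Bad : Dart → Dart → Fin k₃ → Fin k₃ → Set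
      Bad e f x y = Conflict e f × x ≡ y

      Bad-sym : ∀ {e f x y} → Bad e f x y → Bad f e y x
      Bad-sym (p , q) = conflict-sym p , sym q

      open Greedy _≟D_ {k₃} Bad Bad-sym (λ e c → map c (conflicting lowEdges e))

      few : ∀ {e} → e ∈ lowEdges → ∀ (c : Dart → Fin k₃) → length (map c (conflicting lowEdges e)) < k₃
      few {e} e∈ c with is@(_ , lo , lo′ , _) ← lowEdges-∈ e∈ = subst (length (map c (conflicting lowEdges e)) <_) (sym k₃≡) (s≤s (≤-trans
          (≤-reflexive (trans (length-map c (conflicting lowEdges e)) (conflicting-length lowEdges e)))
          (+-mono-≤ (bound lo) (+-mono-≤ (bound lo′) (+-monoˡ-≤ 0 (bound (subst Low (sym (low-other is)) lo)))))))
        where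
        bound : ∀ {v} → Low v → length (near-touching lowEdges v) ≤ W * (W + W)
        bound = near-low-length lowEdges (λ {u} → lowEdges-touching u)

      abstract
        result : Σ (Dart → Fin k₃) λ c → Good c (lowEdges ++ [])
        result = extend lowEdges [] (λ _ → fromℕ< (≤-trans (s≤s z≤n) (≤-reflexive (sym k₃≡)))) (λ ()) few
          λ { _ f∈ _ c x (conf , refl) → ∈-map⁺ c (∈-conflicting lowEdges ([ id , (λ ()) ]′ (∈-++⁻ lowEdges f∈)) conf) }

    lowColour : Dart → Fin k₃
    lowColour = proj₁ LowColouring.result

    lowColour-injective : ∀ {e f} → IsLow e → IsLow f → Conflict e f → lowColour e ≡ lowColour f → e ≡ f
    lowColour-injective {e} {f} ie if conf eq with e ≟D f
    ... | yes p = p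
    ... | no ne = ⊥-elim (proj₂ LowColouring.result (∈-++⁺ˡ (∈-filter⁺ isLow? (∈-allDarts e) ie))
            (∈-++⁺ˡ (∈-filter⁺ isLow? (∈-allDarts f) if)) ne (conf , eq))

    -- The bit of `pairC` separates the two darts of a pair. The fields of `ownC` are group, label
    -- of the owner, rank in the group and end bit.
    data Colour : Set where
      plainC : Fin kA → Colour
      pairC : Fin P → Bool → Colour
      ownC : Bool → Fin q₂ → Bool → Bool → Colour
      lowC : Fin k₃ → Colour

    -- For an owned item, the last bit tells whether the dart is at the owner.
    dartColour : Dart → Colour
    dartColour d with owner (item d) | small? (item d)
    ... | just (v , g , s) | _ = ownC g (label g v) s (does (end? d v))
    ... | nothing | yes _ = pairC (pair (item d)) (side d)
    ... | nothing | no _ = plainC (plain d)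

    data Kind (d : Dart) : Set where
      owned : ∀ {v g s} → owner (item d) ≡ just (v , g , s) → dartColour d ≡ ownC g (label g v) s (does (end? d v)) → Kind d
      paired : Small (item d) → owner (item d) ≡ nothing → dartColour d ≡ pairC (pair (item d)) (side d) → Kind d
      single : ¬ Small (item d) → owner (item d) ≡ nothing → dartColour d ≡ plainC (plain d) → Kind d

    kind : ∀ d → Kind d
    kind d with owner (item d) in eq | small? (item d) in eq′
    ... | just (v , g , s) | _ = owned eq (cong-owner eq)
      where
      cong-owner : owner (item d) ≡ just (v , g , s) → dartColour d ≡ ownC g (label g v) s (does (end? d v))
      cong-owner eq rewrite eq = refl
    ... | nothing | yes sm = paired sm eq lemma
      where
      lemma : dartColour d ≡ pairC (pair (item d)) (side d)
      lemma rewrite eq | eq′ = refl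
    ... | nothing | no ns = single ns eq lemma
      where
      lemma : dartColour d ≡ plainC (plain d)
      lemma rewrite eq | eq′ = refl

  -- Properness and the absence of palette inclusions

  module Verification where

    open Pairs using (Small; pick-small; pair; pair-injective)
    open Owners using (owner; owner-end; owner-high; owner-unique; owner-exists; label; label-rival; label-adjacent)
    open Colours

    -- Forgets what separates the two darts of an item. Unless the colour is plain, the rest
    -- identifies the item among those it conflicts with.
    unBit : Colour → Colour
    unBit (plainC x) = plainC x
    unBit (pairC p _) = pairC p false
    unBit (ownC g l s _) = ownC g l s false
    unBit (lowC x) = lowC x

    IsPlainC : Colour → Set
    IsPlainC c = ∃ λ x → c ≡ plainC x

    small-not-plain : ∀ {d} → Small (item d) → ¬ IsPlainC (dartColour d)
    small-not-plain {d} sm (x , eq) with kind d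
    ... | owned _ p = contradiction (trans (sym p) eq) λ ()
    ... | paired _ _ p = contradiction (trans (sym p) eq) λ ()
    ... | single ns _ _ = ns sm

    dart-not-low : ∀ d x → dartColour d ≢ lowC x
    dart-not-low d x eq with kind d
    ... | owned _ p = contradiction (trans (sym p) eq) λ ()
    ... | paired _ _ p = contradiction (trans (sym p) eq) λ ()
    ... | single _ _ p = contradiction (trans (sym p) eq) λ ()

    unBit-item : ∀ {d d′} → item d ≡ item d′ → Small (item d) → unBit (dartColour d) ≡ unBit (dartColour d′)
    unBit-item {d} {d′} ieq sm with kind d | kind d′
    ... | owned o p | owned o′ p′ with refl ← trans (sym o) (trans (cong owner ieq) o′) = trans (cong unBit p) (sym (cong unBit p′))
    ... | paired _ _ p | paired _ _ p′ = trans (cong unBit p) (trans (cong (λ e → pairC (pair e) false) ieq) (sym (cong unBit p′)))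
    ... | owned o _ | paired _ o′ _ = contradiction (trans (sym o) (trans (cong owner ieq) o′)) λ ()
    ... | paired _ o _ | owned o′ _ = contradiction (trans (sym o′) (trans (cong owner (sym ieq)) o)) λ ()
    ... | single ns _ _ | _ = contradiction sm ns
    ... | _ | single ns _ _ = contradiction (subst Small ieq sm) ns

    ownC-injective : ∀ {g g′ l l′ s s′ b b′} → ownC g l s b ≡ ownC g′ l′ s′ b′ → g ≡ g′ × l ≡ l′ × s ≡ s′ × b ≡ b′
    ownC-injective refl = refl , refl , refl , refl

    pairC-injective : ∀ {p p′ b b′} → pairC p b ≡ pairC p′ b′ → p ≡ p′ × b ≡ b′
    pairC-injective refl = refl , refl

    same-owner : ∀ {d d′ v v′ g s s′} → IsEdge d → IsEdge d′ → Conflict (item d) (item d′) →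
      owner (item d) ≡ just (v , g , s) → owner (item d′) ≡ just (v′ , g , s′) → label g v ≡ label g v′ → v ≡ v′
    same-owner {d} {d′} {s = s} {s′} ed ed′ conf o o′ = label-rival
      (item d , item d′ , item-is-item ed , item-is-item ed′ , (s , o) , (s′ , o′) , conf)

    unBit-injective : ∀ {d d′} → IsEdge d → IsEdge d′ → Conflict (item d) (item d′) → ¬ IsPlainC (dartColour d) →
      unBit (dartColour d) ≡ unBit (dartColour d′) → item d ≡ item d′
    unBit-injective {d} {d′} ed ed′ conf np eq with kind d | kind d′
    ... | single _ _ p | _ = contradiction (_ , p) np
    ... | owned o p | paired _ _ p′ = contradiction (trans (sym (cong unBit p)) (trans eq (cong unBit p′))) λ ()
    ... | owned o p | single _ _ p′ = contradiction (trans (sym (cong unBit p)) (trans eq (cong unBit p′))) λ ()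
    ... | paired _ _ p | owned _ p′ = contradiction (trans (sym (cong unBit p)) (trans eq (cong unBit p′))) λ ()
    ... | paired _ _ p | single _ _ p′ = contradiction (trans (sym (cong unBit p)) (trans eq (cong unBit p′))) λ ()
    ... | paired sm _ p | paired sm′ _ p′ = pair-injective (item-is-item ed) (item-is-item ed′) sm sm′ conf
            (proj₁ (pairC-injective (trans (sym (cong unBit p)) (trans eq (cong unBit p′)))))
    ... | owned o p | owned o′ p′ with ownC-injective (trans (sym (cong unBit p)) (trans eq (cong unBit p′)))
    ... | refl , leq , refl , _ with refl ← same-owner ed ed′ conf o o′ leq =
            owner-unique (item-is-item ed) (item-is-item ed′) o o′

    ends-of-item : ∀ {d d′ v} → Second d′ → ¬ Second d → item d ≡ item d′ →
      proj₂ (item d) ≡ v ⊎ other (item d) ≡ v → End d v ⊎ End d′ v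
    ends-of-item s ns eq (inj₁ p) = inj₁ (inj₂ (trans (cong proj₂ (sym (item-single ns))) p))
    ends-of-item {d} {d′} s@(ac , p′) ns eq (inj₂ p) = inj₂ (inj₂ (trans (cong proj₂ p′) (trans (sym
      (trans (other-first (e₁-first ac)) (cong (proj₂ ∘ e₂) (pick-left zero ac))))
      (trans (cong other (sym (trans eq (item-second s)))) p))))

    -- The owner is one of the two different high ends of a pair, so exactly one of its darts is at
    -- the owner.
    owned-bit : ∀ {d d′ v s} → item d ≡ item d′ → owner (item d) ≡ just (v , s) →
      does (end? d v) ≡ does (end? d′ v) → d ≡ d′
    owned-bit {d} {d′} {v} ieq o beq with end? d v | end? d′ v
    ... | yes p | yes p′ = trans (sym (dartAt-item (owner-high o) p)) (trans (cong (dartAt v) ieq) (dartAt-item (owner-high o) p′))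
    owned-bit _ _ () | yes _ | no _
    owned-bit _ _ () | no _ | yes _
    owned-bit {d} {d′} {v} ieq o beq | no ne | no ne′ = go (second? d) (second? d′)
      where
      oend : proj₂ (item d) ≡ v ⊎ other (item d) ≡ v
      oend = owner-end o
      go : Dec (Second d) → Dec (Second d′) → d ≡ d′
      go (yes s@(ac , p)) (yes s′@(ac′ , p′)) = trans p (trans (cong e₂ (trans (sym (pick-left zero ac))
        (trans (cong proj₁ (trans (sym (item-second s)) (trans ieq (item-second s′)))) (pick-left zero ac′)))) (sym p′))
      go (no ns) (no ns′) = trans (sym (item-single ns)) (trans ieq (item-single ns′))
      go (no ns) (yes s′) = contradiction (ends-of-item s′ ns ieq oend) [ ne , ne′ ]′
      go (yes s) (no ns′) = contradiction
        (ends-of-item s ns′ (sym ieq) (subst (λ e → proj₂ e ≡ v ⊎ other e ≡ v) ieq oend)) [ ne′ , ne ]′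

    -- Used with `z ≡ z′` for properness and with adjacent low `z` and `z′` for comparing their
    -- palettes. Plain colours are proper but not controlled at distance one, hence the condition on
    -- items that are not small.
    same-dart : ∀ {d d′ z z′} → IsEdge d → IsEdge d′ → End d z → End d′ z′ → z′ ∈ near z →
      (¬ Small (item d) → z ≡ z′) → dartColour d ≡ dartColour d′ → d ≡ d′
    same-dart {d} {d′} {z} {z′} ed ed′ dz dz′ near same eq with kind d | kind d′
    ... | owned o p | paired _ _ p′ = contradiction (trans (sym p) (trans eq p′)) λ ()
    ... | owned o p | single _ _ p′ = contradiction (trans (sym p) (trans eq p′)) λ ()
    ... | paired _ _ p | owned _ p′ = contradiction (trans (sym p) (trans eq p′)) λ ()
    ... | paired _ _ p | single _ _ p′ = contradiction (trans (sym p) (trans eq p′)) λ ()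
    ... | single _ _ p | owned _ p′ = contradiction (trans (sym p) (trans eq p′)) λ ()
    ... | single _ _ p | paired _ _ p′ = contradiction (trans (sym p) (trans eq p′)) λ ()
    ... | paired sm _ p | paired sm′ _ p′ with pairC-injective (trans (sym p) (trans eq p′))
    ... | peq , seq = item-side-injective (pair-injective (item-is-item ed) (item-is-item ed′) sm sm′
            (z , z′ , end-touched dz , near , end-touched dz′) peq) seq
    same-dart {d} {d′} {z} {z′} ed ed′ dz dz′ near same eq | owned o p | owned o′ p′
      with ownC-injective (trans (sym p) (trans eq p′))
    ... | refl , leq , refl , beq
      with refl ← same-owner ed ed′ (z , z′ , end-touched dz , near , end-touched dz′) o o′ leq
      = owned-bit (owner-unique (item-is-item ed) (item-is-item ed′) o o′) o beq
    same-dart {d} {d′} {z} {z′} ed ed′ dz dz′ near same eq | single ns _ p | single ns′ _ p′ = go (same ns) (trans (sym p) (trans eq p′))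
      where
      not-second : ∀ {e} → ¬ Small (item e) → ¬ Second e
      not-second ns s@(ac , _) = ns (subst Small (sym (item-second s)) (pick-small zero ac (s≤s z≤n)))
      is-plain : ∀ {e} → IsEdge e → ¬ Small (item e) → IsPlain e
      is-plain ed ns = ed , ns ∘ subst Small (sym (item-single (not-second ns)))
      go : z ≡ z′ → plainC (plain d) ≡ plainC (plain d′) → d ≡ d′
      go refl q = plain-injective (is-plain ed ns) (is-plain ed′ ns′) dz dz′ (plainC-injective q)
        where
        plainC-injective : ∀ {x y} → plainC x ≡ plainC y → x ≡ y
        plainC-injective refl = refl

    paint : ∀ {u v} → Dec (Low u × Low v) → Dart → Colour
    paint (yes _) e = lowC (lowColour e)
    paint (no _) e = dartColour e

    abstract
      bothLow? : ∀ u v → Dec (Low u × Low v)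
      bothLow? u v = low? u ×-dec low? v

    colour : V → V → Colour
    colour u v = paint (bothLow? u v) (canon u v)

    colour-low : ∀ {u v} → Low u → Low v → colour u v ≡ lowC (lowColour (canon u v))
    colour-low {u} {v} lo lo′ with bothLow? u v
    ... | yes _ = refl
    ... | no nl = contradiction (lo , lo′) nl

    colour-edge : ∀ {u v} → ¬ (Low u × Low v) → colour u v ≡ dartColour (canon u v)
    colour-edge {u} {v} nl with bothLow? u v
    ... | yes l = contradiction l nl
    ... | no _ = refl

    colour-comm : ∀ {u v} → Adj G u v → colour u v ≡ colour v u
    colour-comm {u} {v} p = go (bothLow? u v)
      where
      go : Dec (Low u × Low v) → colour u v ≡ colour v u
      go (yes (lo , lo′)) = trans (colour-low lo lo′) (trans (cong (lowC ∘ lowColour) (canon-comm (adj-distinct p))) (sym (colour-low lo′ lo)))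
      go (no nl) = trans (colour-edge nl) (trans (cong dartColour (canon-comm (adj-distinct p)))
        (sym (colour-edge λ (lo , lo′) → nl (lo′ , lo))))

    canon-is-low : ∀ {u v} → Adj G u v → Low u → Low v → IsLow (canon u v)
    canon-is-low {u} {v} p lo lo′ = go (canon-cases u v) (canon-low p lo lo′)
      where
      go : canon u v ≡ (u , v) ⊎ canon u v ≡ (v , u) → proj₁ (canon u v) Fin.< proj₂ (canon u v) → IsLow (canon u v)
      go (inj₁ q) lt = subst (λ e → proj₁ e Fin.< proj₂ e → IsLow e) (sym q) (λ lt → p , lo , lo′ , lt) lt
      go (inj₂ q) lt = subst (λ e → proj₁ e Fin.< proj₂ e → IsLow e) (sym q) (λ lt → adj-comm p , lo′ , lo , lt) lt

    touched-end : ∀ {e v} → End e v → v ∈ touched e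
    touched-end (inj₁ p) = here (sym p)
    touched-end (inj₂ p) = there (here (sym p))

    lowC-injective : ∀ {x y} → lowC x ≡ lowC y → x ≡ y
    lowC-injective refl = refl

    low-same : ∀ {u x w y} → Adj G u x → Adj G w y → Low u → Low x → Low w → Low y → w ∈ near u →
      colour u x ≡ colour w y → canon u x ≡ canon w y
    low-same {u} {x} {w} {y} p p′ lu lx lw ly near eq = lowColour-injective (canon-is-low p lu lx) (canon-is-low p′ lw ly)
      (u , w , touched-end (canon-end u x) , near , touched-end (canon-end w y))
      (lowC-injective (trans (sym (colour-low lu lx)) (trans eq (colour-low lw ly))))

    proper : ∀ {u v v′} → Adj G u v → Adj G u v′ → colour u v ≡ colour u v′ → v ≡ v′
    proper {u} {v} {v′} p p′ eq = canon-injective (go (bothLow? u v) (bothLow? u v′))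
      where
      go : Dec (Low u × Low v) → Dec (Low u × Low v′) → canon u v ≡ canon u v′
      go (yes (lu , lv)) (yes (_ , lv′)) = low-same p p′ lu lv lu lv′ (near-refl u) eq
      go (yes (lu , lv)) (no nl) = contradiction (trans (sym (colour-edge nl)) (trans (sym eq) (colour-low lu lv))) (dart-not-low _ _)
      go (no nl) (yes (lu , lv)) = contradiction (trans (sym (colour-edge nl)) (trans eq (colour-low lu lv))) (dart-not-low _ _)
      go (no nl) (no nl′) = same-dart (canon-edge p nl) (canon-edge p′ nl′) (canon-end u v) (canon-end u v′) (near-refl u) (λ _ → refl)
        (trans (sym (colour-edge nl)) (trans eq (colour-edge nl′)))

    edge-canon : ∀ {d u} → IsEdge d → End d u → ∃ λ x → Adj G u x × canon u x ≡ d
    edge-canon {a , b} ed (inj₁ refl) = b , edge-adj ed , go ed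
      where
      go : IsEdge (a , b) → canon a b ≡ (a , b)
      go ((p , inj₁ lo) , hi) = canon-low-high lo hi
      go ed@((p , inj₂ (hi , _ , lt)) , _) with canon-cases a b
      ... | inj₁ q = q
      ... | inj₂ q = contradiction (subst IsEdge q (canon-edge p (hi ∘ proj₁))) (edge-asym ed)
    edge-canon {a , b} ed (inj₂ refl) with x , p , eq ← edge-canon {a , b} ed (inj₁ refl) = a , adj-comm (edge-adj ed) , go (canon-cases b a)
      where
      go : canon b a ≡ (b , a) ⊎ canon b a ≡ (a , b) → canon b a ≡ (a , b)
      go (inj₁ q) = contradiction (subst IsEdge q (canon-edge (adj-comm (edge-adj ed)) (proj₂ ed ∘ proj₁))) (edge-asym ed)
      go (inj₂ q) = q

    Sub : V → V → Set
    Sub u w = ∀ x → Adj G u x → ∃ λ y → Adj G w y × colour w y ≡ colour u x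

    -- Edges between low vertices have colours of their own, so the colour of an edge with a high
    -- end can only be matched by such an edge.
    echo : ∀ {u w d} → Sub u w → IsEdge d → End d u →
      ∃ λ d′ → IsEdge d′ × End d′ w × dartColour d′ ≡ dartColour d
    echo {u} {w} {d} sub ed du
      with x , p , eq ← edge-canon ed du
      with y , p′ , ceq ← sub x p = go (bothLow? u x) (bothLow? w y)
      where
      go : Dec (Low u × Low x) → Dec (Low w × Low y) → ∃ λ d′ → IsEdge d′ × End d′ w × dartColour d′ ≡ dartColour d
      go (yes (lu , lx)) _ with canon-cases u x
      ... | inj₁ q = contradiction lx (proj₂ (subst IsEdge (trans (sym eq) q) ed))
      ... | inj₂ q = contradiction lu (proj₂ (subst IsEdge (trans (sym eq) q) ed))
      go (no nl) (yes (lw , ly)) = contradiction (trans (sym (trans ceq (colour-edge nl))) (colour-low lw ly)) (dart-not-low _ _)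
      go (no nl) (no nl′) = canon w y , canon-edge p′ nl′ , canon-end w y ,
        trans (sym (colour-edge nl′)) (trans ceq (trans (colour-edge nl) (cong dartColour eq)))

    end-joins : ∀ {d v w} → v ≢ w → End d v → End d w → Joins d v w
    end-joins v≢w (inj₁ p) (inj₁ q) = contradiction (trans (sym p) q) v≢w
    end-joins v≢w (inj₁ p) (inj₂ q) = inj₁ (p , q)
    end-joins v≢w (inj₂ p) (inj₁ q) = inj₂ (q , p)
    end-joins v≢w (inj₂ p) (inj₂ q) = contradiction (trans (sym p) q) v≢w

    own-colour : ∀ {u} → High u → ∀ g s → ∃ λ d → IsEdge d × End d u × dartColour d ≡ ownC g (label g u) s true
    own-colour {u} hi g s with e , it , o ← owner-exists hi (g , s) = d , ed , du , go (kind d)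
      where
      d : Dart
      d = dartAt u e
      ed : IsEdge d
      ed = dartAt-edge u (proj₁ it)
      u∈ : u ∈ touched e
      u∈ with owner-end o
      ... | inj₁ p = there (here (sym p))
      ... | inj₂ p = there (there (here (sym p)))
      du : End d u
      du = high-touched it u∈ hi
      od : owner (item d) ≡ just (u , g , s)
      od = trans (cong owner (item-dartAt u it)) o
      end-complete : ∀ {d v} → End d v → does (end? d v) ≡ true
      end-complete {d} {v} p with end? d v
      ... | yes _ = refl
      ... | no np = contradiction p np
      go : Kind d → dartColour d ≡ ownC g (label g u) s true
      go (owned o′ p) with refl ← trans (sym o′) od = trans p (cong (ownC g (label g u) s) (end-complete {d} {u} du))
      go (paired _ o′ _) = contradiction (trans (sym o′) od) λ ()
      go (single _ o′ _) = contradiction (trans (sym o′) od) λ ()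

    end-sound : ∀ {d v} → does (end? d v) ≡ true → End d v
    end-sound {d} {v} eq with end? d v
    ... | yes p = p

    own-view : ∀ {d g l s} → dartColour d ≡ ownC g l s true →
      ∃ λ v → owner (item d) ≡ just (v , g , s) × label g v ≡ l × End d v
    own-view {d} eq with kind d
    ... | paired _ _ p = contradiction (trans (sym p) eq) λ ()
    ... | single _ _ p = contradiction (trans (sym p) eq) λ ()
    ... | owned {v} o p with ownC-injective (trans (sym p) eq)
    ... | refl , refl , refl , beq = v , o , refl , end-sound {d} {v} beq

    -- In a group where the labels of `u` and `w` differ, the edges of `w` that repeat the two
    -- colours of `u` meet at `w`, so equal labels force a common owner `v`, and `v` is not `w`. The
    -- end bit places both edges at `v`; both are then the edge from `v` to `w`, although their
    -- ranks differ.
    high-not-sub : ∀ {u w} → High u → Adj G u w → ¬ Sub u w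
    high-not-sub {u} {w} hi p sub
      with g , l≢ ← label-adjacent p
      with d₀ , ed₀ , du₀ , c₀ ← own-colour hi g false | d₁ , ed₁ , du₁ , c₁ ← own-colour hi g true
      with d₀′ , ed₀′ , dw₀ , eq₀ ← echo sub ed₀ du₀ | d₁′ , ed₁′ , dw₁ , eq₁ ← echo sub ed₁ du₁
      with v₀ , o₀ , l₀ , dv₀ ← own-view (trans eq₀ c₀) | v₁ , o₁ , l₁ , dv₁ ← own-view (trans eq₁ c₁)
      with refl ← same-owner ed₀′ ed₁′ (w , w , end-touched dw₀ , near-refl w , end-touched dw₁) o₀ o₁ (trans l₀ (sym l₁))
      with v₀ Finₚ.≟ w
    ... | yes refl = l≢ (sym l₀)
    ... | no v≢w with refl ← edges-simple ed₀′ ed₁′ (end-joins v≢w dv₀ dw₀) (end-joins v≢w dv₁ dw₁)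
      = contradiction (trans (sym o₀) o₁) λ ()

    -- The two colours differ only in a bit, so at `w` they would come from darts of one item. As
    -- `w` is high it meets just one dart of an item, which cannot have both colours.
    active-not-sub : ∀ {u w} → Active u → Adj G u w → ¬ Sub u w
    active-not-sub {u} {w} ac@(lo , all-high) p sub
      with d₁ , ed₁ , dw₁ , eq₁ ← echo sub (pick-edge zero ac) (inj₁ (pick-left zero ac))
         | d₂ , ed₂ , dw₂ , eq₂ ← echo sub (pick-edge (suc zero) ac) (inj₁ (pick-left (suc zero) ac))
      = e₁≢e₂ ac (same-dart (pick-edge zero ac) (pick-edge (suc zero) ac) (inj₁ (pick-left zero ac)) (inj₁ (pick-left (suc zero) ac))
          (near-refl u) (λ _ → refl) (trans (sym eq₁) (trans (cong dartColour d₁≡d₂) eq₂)))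
      where
      hw : High w
      hw = all-high w p
      small : Small (item (e₁ u))
      small = subst Small (sym (item-e₁ ac)) (pick-small zero ac (s≤s z≤n))
      items-equal : item d₁ ≡ item d₂
      items-equal = unBit-injective ed₁ ed₂ (w , w , end-touched dw₁ , near-refl w , end-touched dw₂)
        (λ (x , q) → small-not-plain small (x , trans (sym eq₁) q))
        (trans (cong unBit eq₁) (trans (unBit-item (trans (item-e₁ ac) (sym (item-e₂ ac))) small) (sym (cong unBit eq₂))))
      d₁≡d₂ : d₁ ≡ d₂
      d₁≡d₂ = trans (sym (dartAt-item hw dw₁)) (trans (cong (dartAt w) items-equal) (dartAt-item hw dw₂))

    low-neighbour-high : ∀ {u w l} → Low u → High w → Adj G u l → Low l → ¬ Sub u w
    low-neighbour-high {u} {w} {l} lo hi pl ll sub with y , p , eq ← sub l pl =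
      dart-not-low _ _ (trans (sym (colour-edge (hi ∘ proj₁))) (trans eq (colour-low lo ll)))

    canon-ends : ∀ {u l w} → End (canon u l) w → w ≡ u ⊎ w ≡ l
    canon-ends {u} {l} end with canon u l | canon-cases u l
    canon-ends (inj₁ p) | _ | inj₁ refl = inj₁ (sym p)
    canon-ends (inj₂ p) | _ | inj₁ refl = inj₂ (sym p)
    canon-ends (inj₁ p) | _ | inj₂ refl = inj₂ (sym p)
    canon-ends (inj₂ p) | _ | inj₂ refl = inj₁ (sym p)

    -- In the strong colouring an edge at `w` with the colour of `ul` must be `ul` itself, whose
    -- ends are not `w`.
    two-low-neighbours : ∀ {u w l} → Low u → Low w → Adj G u w → Adj G u l → Low l → l ≢ w → ¬ Sub u w
    two-low-neighbours {u} {w} {l} lo lw p pl ll l≢w sub with y , py , eq ← sub l pl = go (bothLow? w y)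
      where
      go : ¬ Dec (Low w × Low y)
      go (no nl) = dart-not-low _ _ (trans (sym (colour-edge nl)) (trans eq (colour-low lo ll)))
      go (yes (_ , ly)) with canon-ends (subst (λ e → End e w) (sym (low-same pl py lo ll lw ly (near-low lo lw p) (sym eq))) (canon-end w y))
      ... | inj₁ w≡u = adj-distinct p (sym w≡u)
      ... | inj₂ w≡l = l≢w (sym w≡l)

    -- The two chosen darts at `u` have different ends, so one of them avoids `w` and leads to a
    -- high vertex. It lies in J, and `near` includes `w`, so only this very edge could repeat its
    -- colour at `w`.
    one-low-neighbour : ∀ {u w} → Low u → Low w → Adj G u w → (∀ l → Adj G u l → Low l → l ≡ w) → ¬ Sub u w
    one-low-neighbour {u} {w} lo lw p only sub with pick-spec zero lo | pick-spec (suc zero) lo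
    ... | e∈ , l₀ , c₀ | f∈ , l₁ , c₁ = go (proj₂ (e₁ u) Finₚ.≟ w) (proj₂ (e₂ u) Finₚ.≟ w)
      where
      use : ∀ {d} → d ∈ darts → proj₁ d ≡ u → Small d → proj₂ d ≢ w → ⊥
      use {d} d∈ refl sm b≢w = refute (echo sub ed (inj₁ refl))
        where
        ed : IsEdge d
        ed = darts-∈ d∈ , λ lb → b≢w (only (proj₂ d) (proj₁ (darts-∈ d∈)) lb)
        small : Small (item d)
        small = subst Small (sym (item-single λ { ((_ , hi) , _) → hi w p lw })) sm
        refute : ¬ (∃ λ d′ → IsEdge d′ × End d′ w × dartColour d′ ≡ dartColour d)
        refute (d′ , ed′ , dw , eq) with refl ← same-dart ed ed′ (inj₁ refl) dw (near-low lo lw p) (λ ns → contradiction small ns) (sym eq)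
          with dw
        ... | inj₁ q = adj-distinct p q
        ... | inj₂ q = b≢w q
      go : Dec (proj₂ (e₁ u) ≡ w) → Dec (proj₂ (e₂ u) ≡ w) → ⊥
      go (no b≢w) _ = use e∈ l₀ (subst (λ x → toℕ x < 2) (sym c₀) (s≤s z≤n)) b≢w
      go _ (no b≢w) = use f∈ l₁ (subst (λ x → toℕ x < 2) (sym c₁) (s≤s (s≤s z≤n))) b≢w
      go (yes q₀) (yes q₁) = contradiction (trans (sym c₀) (trans (cong class (cong₂ _,_ (trans l₀ (sym l₁)) (trans q₀ (sym q₁)))) c₁)) λ ()

    not-sub : ∀ {u w} → Adj G u w → ¬ Sub u w
    not-sub {u} {w} p = go (low? u) (low? w) (Finₚ.any? (λ l → adj? u l ×-dec low? l)) (Finₚ.any? (λ l → adj? u l ×-dec (low? l ×-dec ¬? (l Finₚ.≟ w))))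
      where
      go : Dec (Low u) → Dec (Low w) → Dec (∃ λ l → Adj G u l × Low l) → Dec (∃ λ l → Adj G u l × Low l × l ≢ w) → ¬ Sub u w
      go (no hi) _ _ _ = high-not-sub hi p
      go (yes lo) _ (no none) _ = active-not-sub (lo , λ v pv lv → none (v , pv , lv)) p
      go (yes lo) (no hw) (yes (l , pl , ll)) _ = low-neighbour-high lo hw pl ll
      go (yes lo) (yes lw) _ (yes (l , pl , ll , l≢w)) = two-low-neighbours lo lw p pl ll l≢w
      go (yes lo) (yes lw) _ (no none) = one-low-neighbour lo lw p only
        where
        only : ∀ l → Adj G u l → Low l → l ≡ w
        only l pl ll with l Finₚ.≟ w
        ... | yes q = q
        ... | no nq = contradiction (l , pl , ll , nq) none

  -- Numbering the colours

  module Encoding where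

    open Colours using (Colour; plainC; pairC; ownC; lowC)
    open Verification using (colour; colour-comm; proper; not-sub)

    encode : Colour → Fin χ
    encode (plainC x) = join kA _ (inj₁ x)
    encode (pairC p β) = join kA _ (inj₂ (join (P * 2) _ (inj₁ (combine p (bit β)))))
    encode (ownC g l s β) = join kA _ (inj₂ (join (P * 2) _ (inj₂ (join (q₂ * 8) _
      (inj₁ (combine l (combine (bit g) (combine (bit s) (bit β)))))))))
    encode (lowC x) = join kA _ (inj₂ (join (P * 2) _ (inj₂ (join (q₂ * 8) _ (inj₂ x)))))

    decodePair : Fin (P * 2) → Colour
    decodePair x = pairC (proj₁ (remQuot {P} 2 x)) (unbit (proj₂ (remQuot {P} 2 x)))

    decodeBits : Fin q₂ × Fin 8 → Colour
    decodeBits (l , y) = ownC (unbit (proj₁ (remQuot {2} 4 y))) l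
      (unbit (proj₁ (remQuot {2} 2 (proj₂ (remQuot {2} 4 y))))) (unbit (proj₂ (remQuot {2} 2 (proj₂ (remQuot {2} 4 y)))))

    decode₂ : Fin (q₂ * 8) ⊎ Fin k₃ → Colour
    decode₂ = [ decodeBits ∘ remQuot {q₂} 8 , lowC ]′

    decode₁ : Fin (P * 2) ⊎ Fin (q₂ * 8 + k₃) → Colour
    decode₁ = [ decodePair , decode₂ ∘ splitAt (q₂ * 8) ]′

    decode₀ : Fin kA ⊎ Fin (P * 2 + (q₂ * 8 + k₃)) → Colour
    decode₀ = [ plainC , decode₁ ∘ splitAt (P * 2) ]′

    decode : Fin χ → Colour
    decode = decode₀ ∘ splitAt kA

    decode-encode-colour : ∀ c → decode (encode c) ≡ c
    decode-encode-colour (plainC x) = cong decode₀ (Finₚ.splitAt-join kA _ (inj₁ x))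
    decode-encode-colour (pairC p β) = trans (cong decode₀ (Finₚ.splitAt-join kA _ (inj₂ _)))
      (trans (cong decode₁ (Finₚ.splitAt-join (P * 2) _ (inj₁ (combine p (bit β)))))
        (trans (cong (λ x → pairC (proj₁ x) (unbit (proj₂ x))) (Finₚ.remQuot-combine p (bit β))) (cong (pairC p) (unbit-bit β))))
    decode-encode-colour (ownC g l s β) = trans (cong decode₀ (Finₚ.splitAt-join kA _ (inj₂ _)))
      (trans (cong decode₁ (Finₚ.splitAt-join (P * 2) _ (inj₂ _)))
        (trans (cong decode₂ (Finₚ.splitAt-join (q₂ * 8) _ (inj₁ (combine l (combine (bit g) (combine (bit s) (bit β)))))))
          (trans (cong decodeBits (Finₚ.remQuot-combine l (combine (bit g) (combine (bit s) (bit β))))) (bits g s β))))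
      where
      bits : ∀ g s β → decodeBits (l , combine (bit g) (combine (bit s) (bit β))) ≡ ownC g l s β
      bits true true true = refl
      bits true true false = refl
      bits true false true = refl
      bits true false false = refl
      bits false true true = refl
      bits false true false = refl
      bits false false true = refl
      bits false false false = refl
    decode-encode-colour (lowC x) = trans (cong decode₀ (Finₚ.splitAt-join kA _ (inj₂ _)))
      (trans (cong decode₁ (Finₚ.splitAt-join (P * 2) _ (inj₂ _))) (cong decode₂ (Finₚ.splitAt-join (q₂ * 8) _ (inj₂ x))))

    encode-injective : ∀ {c c′} → encode c ≡ encode c′ → c ≡ c′
    encode-injective {c} {c′} eq = trans (sym (decode-encode-colour c)) (trans (cong decode eq) (decode-encode-colour c′))

    inclusion-free : InclChromIndexAtMost G χ
    inclusion-free = c ,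
        ((λ u v p → cong encode (colour-comm p)) , λ u v w p p′ v≢w eq → v≢w (proper p p′ (encode-injective eq))) ,
        λ u v p → no-sub p , no-sub (trans (adj-sym G v u) p)
      where
      c : EdgeColouring G χ
      c u v = encode (colour u v)
      no-sub : ∀ {u v} → Adj G u v → ¬ PaletteSub G c u v
      no-sub p sub = not-sub p λ x px → let y , py , eq = sub x px in y , py , encode-injective eq

-- Integer cube roots and the final bound

cube-root : ∀ m → ∃ λ D → m ≤ D * (D * D) × D * (D * D) ≤ 8 * m
cube-root zero = 0 , z≤n , z≤n
cube-root (suc m) with cube-root m
... | D , lower , upper with suc m ≤? D * (D * D)
... | yes p = D , p , ≤-trans upper (*-monoʳ-≤ 8 (n≤1+n m))
... | no np = suc D , ≤-trans (s≤s lower) (step D) , ≤-trans (grow D) (*-monoʳ-≤ 8 (≰⇒> np))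
  where
  step : ∀ D → suc (D * (D * D)) ≤ suc D * (suc D * suc D)
  step D = ≤-trans (m≤m+n _ (3 * (D * D) + 3 * D)) (≤-reflexive (solve 1 (λ D → (con 1 :+ D :* (D :* D)) :+ (con 3 :* (D :* D) :+ con 3 :* D)
    := (con 1 :+ D) :* ((con 1 :+ D) :* (con 1 :+ D))) refl D))
  -- For positive `D` the successor at most doubles it, which gives the factor `8`; the added one
  -- takes care of `D = 0`.
  grow : ∀ D → suc D * (suc D * suc D) ≤ 8 * suc (D * (D * D))
  grow zero = s≤s z≤n
  grow (suc D) = ≤-trans (*-mono-≤ twice (*-mono-≤ twice twice))
      (≤-trans (≤-reflexive (solve 1 (λ x → (x :+ x) :* ((x :+ x) :* (x :+ x)) := con 8 :* (x :* (x :* x))) refl (suc D)))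
        (*-monoʳ-≤ 8 (n≤1+n (suc D * (suc D * suc D)))))
    where
    twice : suc (suc D) ≤ suc D + suc D
    twice = s≤s (m≤n+m (suc D) D)

cube-bound : ∀ {x} c D Δ → x ≤ c * (D * D) → D * (D * D) ≤ 8 * Δ → x ^ 3 ≤ c ^ 3 * 64 * Δ ^ 2
cube-bound {x} c D Δ x≤ D³≤ = begin
  x ^ 3                                      ≤⟨ ^-monoˡ-≤ 3 x≤ ⟩
  (c * (D * D)) ^ 3                          ≡⟨ regroup c D ⟩
  c ^ 3 * (D * (D * D) * (D * (D * D)))      ≤⟨ *-monoʳ-≤ (c ^ 3) (*-mono-≤ D³≤ D³≤) ⟩
  c ^ 3 * (8 * Δ * (8 * Δ))                  ≡⟨ expand (c ^ 3) Δ ⟩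
  c ^ 3 * 64 * Δ ^ 2                         ∎
  where
  open ≤-Reasoning
  regroup : ∀ c D → (c * (D * D)) ^ 3 ≡ c ^ 3 * (D * (D * D) * (D * (D * D)))
  regroup = solve 2 (λ c D → (c :* (D :* D)) :^ 3 := c :^ 3 :* (D :* (D :* D) :* (D :* (D :* D)))) refl
  expand : ∀ k Δ → k * (8 * Δ * (8 * Δ)) ≡ k * 64 * Δ ^ 2
  expand = solve 2 (λ k Δ → k :* (con 8 :* Δ :* (con 8 :* Δ)) := k :* con 64 :* Δ :^ 2) refl

theorem3 : (δ : ℕ) → 2 ≤ δ →
    ∃ λ (K : ℕ) → (G : Graph) (Δ : ℕ) → MinDegree G δ → MaxDegree G Δ → 2 ≤ Δ →
    ∃ λ (χ : ℕ) → InclChromIndexAtMost G χ × Bound K δ Δ χ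
-- The excess is at most `c * (D * D)`; its cube contains the square of `D * (D * D)`, which is at
-- most `8 * Δ`, and `64` is the square of `8`.
theorem3 (suc (suc δ-2)) (s≤s (s≤s z≤n)) = c ^ 3 * 64 , construct
  where
  open Constants δ-2
  construct : (G : Graph) (Δ : ℕ) → MinDegree G δ → MaxDegree G Δ → 2 ≤ Δ →
    ∃ λ (χ : ℕ) → InclChromIndexAtMost G χ × Bound (c ^ 3 * 64) δ Δ χ
  construct G Δ (min-degree , _) (max-degree , _) 2≤Δ with cube-root Δ
  ... | zero , lower , _ = contradiction (≤-trans 2≤Δ lower) λ ()
  ... | suc D-1 , lower , upper = χ , Construction.Encoding.inclusion-free G δ-2 Δ D-1 min-degree max-degree lower ,
      -- Since `2 ≤ Δ`, the logarithm is positive, and multiplying by its power preserves the bound.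
      ≤-trans (cube-bound c (suc D-1) Δ (excess lower) upper) (m≤m*n (c ^ 3 * 64 * Δ ^ 2) (⌈log₂ Δ ⌉ ^ 12) {{log-nonzero}})
    where
    open Parameters δ-2 Δ D-1 using (χ; excess)
    log-nonzero : NonZero (⌈log₂ Δ ⌉ ^ 12)
    log-nonzero = m^n≢0 ⌈log₂ Δ ⌉ 12 {{>-nonZero (⌈log₂⌉-mono-≤ 2≤Δ)}}
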